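{- Let $B$ be a finite set of Boolean functions such that $B\subseteq\mathrm{L}$, let $\mathcal F\in\{\mathrm{K},\mathrm{KD}\}$, and $k\ge 1$. Then $\mathcal F\text{ - }\mathsf{CSAT}_{\{\Box,\Diamond\}}^k(B)\in\mathrm{P}$.
   Context: $\mathrm{L}$ is the set of all linear Boolean functions, i.e. functions of the form $c\oplus x_{i_1}\oplus\dots\oplus x_{i_m}$ with $c\in\{0,1\}$ (the clone generated by $\oplus$ and $1$). Semantics. Fix a countably infinite set $X$ of propositional variables. A $k$-modal frame is $(W,R_1,\dots,R_k)$ with $W$ a set of worlds and $R_i\subseteq W\times W$. A model $\mathcal M$ is a frame with a map $\pi\colon X\to\mathcal P(W)$. $\mathcal M,w\models x$ iff $w\in\pi(x)$; Boolean functions are evaluated at each world in the usual way; $\mathcal M,w\models\Diamond_i\varphi$ iff some $w'$ with $(w,w')\in R_i$ has $\mathcal M,w'\models\varphi$; $\Box_i\varphi$ means $\neg\Diamond_i\neg\varphi$. $\mathrm{K}$ is the class of all frames $(W,R)$; $\mathrm{KD}$ is the class of frames in which every world has a successor. For $k$ modalities, each $(W,R_i)$ must be in $\mathcal F$. A formula is $\mathcal F$-satisfiable if it holds at some world of some model over such a $k$-modal frame. Circuits. $\mathrm{MCIRC}_{\{\Box,\Diamond\}}^k(B)$ is the set of circuits, i.e. finite directed acyclic graphs with ordered incoming edges and a designated output gate, whose gates of in-degree $0$ are labeled by variables or $0$-ary functions (constants) of $B$, and whose gates of in-degree $d>0$ are labeled by $d$-ary functions of $B$ or, if $d=1$, by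 $\Box_i$ or $\Diamond_i$, $1\le i\le k$. A circuit represents the modal formula obtained by unfolding it, and is satisfiable iff that formula is. $\mathcal F\text{ - }\mathsf{CSAT}_{\{\Box,\Diamond\}}^k(B)$ is the problem of deciding whether a given circuit in $\mathrm{MCIRC}_{\{\Box,\Diamond\}}^k(B)$ is $\mathcal F$-satisfiable. -}

module Defs where

open import Data.Bool.Base using (Bool; true; _xor_)
open import Data.Fin.Base using (Fin; zero; toℕ)
open import Data.Fin.Induction using (spo-wellFounded)
open import Data.List.Base as List using (List; []; _∷_; _++_; concatMap)
open import Data.Maybe.Base using (Maybe; just; nothing)
open import Data.Nat.Base using (ℕ; zero; suc; _+_; _*_; _^_)
open import Data.Nat.Binary.Base as ℕᵇ using (ℕᵇ; 2[1+_]; 1+[2_])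
open import Data.Product.Base using (∃; ∃₂; _×_; _,_; proj₁; proj₂)
open import Data.Unit.Base using (⊤)
open import Data.Vec.Base as Vec using (Vec; []; _∷_; lookup; toList)
open import Data.Vec.Membership.Propositional using (_∈_)
open import Data.Vec.Membership.Propositional.Properties using (∈-lookup)
open import Function.Bundles using (_↔_; _↣_; Injection)
open import Induction.WellFounded using (WellFounded; Acc; acc)
open import Level using (Level; _⊔_; 0ℓ) renaming (suc to ℓsuc)
open import Relation.Binary.Construct.Closure.Transitive
  using (TransClosure; transitive; wellFounded⁻)
open import Relation.Binary.PropositionalEquality
  using (_≡_; refl; isEquivalence; resp₂)
open import Relation.Nullary.Negation.Core using (¬_)
open import Relation.Nullary.Reflects using (Reflects)

BoolFun : Set
BoolFun = ∃ λ n → Vec Bool n → Bool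

arity : BoolFun → ℕ
arity = proj₁

L : BoolFun → Set
L (n , f) = ∃₂ λ (c : Bool) (is : List (Fin n)) →
  ∀ v → f v ≡ List.foldr _xor_ c (List.map (lookup v) is)

-- A finite set of Boolean functions, given by an enumeration.
Basis : Set
Basis = List BoolFun

data Label (B : Basis) (k : ℕ) : Set where
  var : ℕ → Label B k
  fn  : Fin (List.length B) → Label B k
  □ ◇ : Fin k → Label B k

inDegree : {B : Basis} {k : ℕ} → Label B k → ℕ
inDegree     (var x) = 0
inDegree {B} (fn f)  = arity (List.lookup B f)
inDegree     (□ i)   = 1
inDegree     (◇ i)   = 1

data Formula (B : Basis) (k : ℕ) : Set where
  node : (ℓ : Label B k) → (Fin (inDegree ℓ) → Formula B k) → Formula B k

record Frame (k : ℕ) : Set₁ where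
  field
    World : Set
    R     : Fin k → World → World → Set

data FrameClass : Set where
  K KD : FrameClass

_∈Class_ : {k : ℕ} → Frame k → FrameClass → Set
F ∈Class K  = ⊤
F ∈Class KD = ∀ i w → ∃ λ w′ → R i w w′
  where open Frame F

record Model (k : ℕ) : Set₁ where
  field
    frame : Frame k
  open Frame frame public
  field
    π : ℕ → World → Set

infix 4 _,_⊨_

-- The truth value of a formula is a proposition, so a Boolean function is
-- applied to the bits that reflect the truth values of its arguments.
_,_⊨_ : {B : Basis} {k : ℕ} (M : Model k) → Model.World M → Formula B k → Set
M , w ⊨ node (var x) φs = Model.π M x w
_,_⊨_ {B} M w (node (fn f) φs) = ∃ λ (bs : Vec Bool (arity (List.lookup B f))) →
  (∀ j → Reflects (M , w ⊨ φs j) (lookup bs j)) ×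
  proj₂ (List.lookup B f) bs ≡ true
M , w ⊨ node (□ i) φs = ¬ (∃ λ w′ → Model.R M i w w′ × ¬ (M , w′ ⊨ φs zero))
M , w ⊨ node (◇ i) φs = ∃ λ w′ → Model.R M i w w′ × (M , w′ ⊨ φs zero)

Satisfiable : {B : Basis} {k : ℕ} → FrameClass → Formula B k → Set₁
Satisfiable {k = k} 𝓕 φ = ∃ λ (M : Model k) → Model.frame M ∈Class 𝓕 ×
  ∃ λ (w : Model.World M) → M , w ⊨ φ

-- The vector lists the sources of the incoming edges in order; repeats are allowed.
Gate : Basis → ℕ → ℕ → Set
Gate B k n = ∃ λ (ℓ : Label B k) → Vec (Fin n) (inDegree ℓ)

Edge : {B : Basis} {k n : ℕ} → Vec (Gate B k n) n → Fin n → Fin n → Set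
Edge gates u v = u ∈ proj₂ (lookup gates v)

record Circuit (B : Basis) (k : ℕ) : Set where
  field
    size    : ℕ
    gates   : Vec (Gate B k size) size
    output  : Fin size
    acyclic : ∀ v → ¬ TransClosure (Edge gates) v v

edge-wellFounded : {B : Basis} {k : ℕ} (C : Circuit B k) →
                   WellFounded (Edge (Circuit.gates C))
edge-wellFounded C = wellFounded⁻ _ (spo-wellFounded record
  { isEquivalence = isEquivalence
  ; irrefl        = λ { refl → acyclic _ }
  ; trans         = transitive _
  ; <-resp-≈      = resp₂ _
  })
  where open Circuit C

module _ {B : Basis} {k n : ℕ} where

  expand : (g : Gate B k n) → (∀ {u} → u ∈ proj₂ g → Formula B k) → Formula B k
  expand (ℓ , us) rec = node ℓ (λ j → rec (∈-lookup j us))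

  unfoldAt : (gates : Vec (Gate B k n) n) {v : Fin n} → Acc (Edge gates) v → Formula B k
  unfoldAt gates {v} (acc rs) =
    expand (lookup gates v) (λ u→v → unfoldAt gates (rs u→v))

unfold : {B : Basis} {k : ℕ} → Circuit B k → Formula B k
unfold C = unfoldAt gates (edge-wellFounded C output)
  where open Circuit C

-- The alphabet is finite because B and k are fixed parameters of the problem.
data Symbol (B : Basis) (k : ℕ) : Set where
  one two end : Symbol B k
  var         : Symbol B k
  fn          : Fin (List.length B) → Symbol B k
  □ ◇         : Fin k → Symbol B k

module _ {B : Basis} {k : ℕ} where

  -- Bijective base-2 numeration, least significant digit first: every string
  -- of ones and twos denotes exactly one number.
  digits : ℕᵇ → List (Symbol B k)
  digits ℕᵇ.zero  = []
  digits 2[1+ b ] = two ∷ digits b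
  digits 1+[2 b ] = one ∷ digits b

  encodeℕ : ℕ → List (Symbol B k)
  encodeℕ n = digits (ℕᵇ.fromℕ n) ++ end ∷ []

  encodeFin : {n : ℕ} → Fin n → List (Symbol B k)
  encodeFin i = encodeℕ (toℕ i)

  encodeLabel : Label B k → List (Symbol B k)
  encodeLabel (var x) = var ∷ encodeℕ x
  encodeLabel (fn f)  = fn f ∷ []
  encodeLabel (□ i)   = □ i ∷ []
  encodeLabel (◇ i)   = ◇ i ∷ []

  encodeGate : {n : ℕ} → Gate B k n → List (Symbol B k)
  encodeGate (ℓ , us) = encodeLabel ℓ ++ concatMap encodeFin (toList us)

  encode : Circuit B k → List (Symbol B k)
  encode C = encodeFin output ++ concatMap encodeGate (toList gates)
    where open Circuit C

-- The set of yes-instances; strings that encode no circuit are not in it.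
CSAT : (𝓕 : FrameClass) (k : ℕ) (B : Basis) → List (Symbol B k) → Set₁
CSAT 𝓕 k B s = ∃ λ (C : Circuit B k) → encode C ≡ s × Satisfiable 𝓕 (unfold C)

Finite : Set → Set
Finite A = ∃ λ n → A ↔ Fin n

data Move : Set where
  left right stay : Move

-- A two-way infinite tape: the cells to the left of the head (nearest first),
-- the scanned cell, and the cells to its right; all further cells are blank.
record Tape (Γ : Set) : Set where
  constructor tape
  field
    before  : List Γ
    scanned : Γ
    after   : List Γ

data Action (Γ Q : Set) (t : ℕ) : Set where
  halt : Bool → Action Γ Q t
  next : Q → Vec (Γ × Move) t → Action Γ Q t

record TM (Σ : Set) : Set₁ where
  field
    Γ              : Set
    Γ-finite       : Finite Γ
    blank          : Γ
    input          : Σ ↣ Γ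
    input-nonblank : ∀ a → ¬ Injection.to input a ≡ blank
    Q              : Set
    Q-finite       : Finite Q
    start          : Q
    workTapes      : ℕ

  tapes : ℕ
  tapes = suc workTapes

  field
    δ : Q → Vec Γ tapes → Action Γ Q tapes

module _ {Σ : Set} (M : TM Σ) where
  open TM M

  Config : Set
  Config = Q × Vec (Tape Γ) tapes

  emptyTape : Tape Γ
  emptyTape = tape [] blank []

  inputTape : List Σ → Tape Γ
  inputTape []       = emptyTape
  inputTape (a ∷ as) = tape [] (to a) (List.map to as)
    where open Injection input

  initial : List Σ → Config
  initial as = start , inputTape as ∷ Vec.replicate workTapes emptyTape

  moveHead : Move → Tape Γ → Tape Γ
  moveHead stay  τ                     = τ
  moveHead left  (tape [] a rs)        = tape [] blank (a ∷ rs)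
  moveHead left  (tape (l ∷ ls) a rs)  = tape ls l (a ∷ rs)
  moveHead right (tape ls a [])        = tape (a ∷ ls) blank []
  moveHead right (tape ls a (r ∷ rs))  = tape (a ∷ ls) r rs

  writeMove : Γ × Move → Tape Γ → Tape Γ
  writeMove (b , m) (tape ls _ rs) = moveHead m (tape ls b rs)

  -- The answer, if the machine halts after at most the given number of
  -- evaluations of δ.
  run : ℕ → Config → Maybe Bool
  run zero    _        = nothing
  run (suc n) (q , τs) with δ q (Vec.map Tape.scanned τs)
  ... | halt b     = just b
  ... | next q′ as = run n (q′ , Vec.zipWith writeMove as τs)

P : {ℓ : Level} {Σ : Set} → (List Σ → Set ℓ) → Set (ℓsuc 0ℓ ⊔ ℓ)
P {Σ = Σ} A = ∃ λ (M : TM Σ) → ∃₂ λ c d → ∀ s → ∃ λ b →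
  run M (c * List.length s ^ d + c) (initial M s) ≡ just b × Reflects (A s) b

{-# OPTIONS --safe #-}
module Submission where

-- A gate whose arguments have known values is a vector over GF(2): the first
-- coordinate stands for the constant 1, the others for atoms, which are the
-- variables and the formulas ◇ᵢ ψ, where ψ is given by its own vector; □ᵢ ψ is
-- 1 + ◇ᵢ (1 + ψ).  Atoms with equal keys are identified, ◇ᵢ 0 = 0, and in KD also
-- ◇ᵢ 1 = 1.  The remaining atoms are independent: given pairwise inequivalent
-- ψ₁, …, ψₘ, one finds successors that falsify some ψⱼ and realise all the others,
-- and one more successor flips ◇ᵢ ψⱼ alone.  Hence a circuit is satisfiable
-- if and only if the vector of its output gate is not zero.  Since a model need
-- not be decidable, values agree with truth up to double negation only; the models
-- constructed consist of finite trees, where truth is decidable.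
--
-- Polynomial time is obtained compositionally: functions on binary trees closed under
-- pairing, branching and folding over lists run on a machine with four stacks, and
-- such a fold stays polynomial as long as the intermediate states are of
-- polynomial size.

open import Data.Bool.Base using (Bool; true; false; if_then_else_; not; _∧_; _∨_; _xor_)
open import Data.Bool.ListAction using (any)
open import Data.Bool.Properties as Bool using (xor-assoc; xor-comm; xor-identityʳ)
open import Data.Fin.Base using (Fin; zero; suc; toℕ; fromℕ<)
open import Data.Fin.Properties as Fin using (+↔⊎)
open import Data.Fin.Subset using (Subset; inside) renaming (∣_∣ to card; _∈_ to _∈ˢ_)
open import Data.Fin.Subset.Properties using (p⊂q⇒∣p∣<∣q∣; ∣p∣≤n; ∣p∣≡n⇒p≡⊤)
open import Data.List.Base as List
  using (List; []; _∷_; _++_; _ʳ++_; concatMap; drop; foldl; foldr; head; length; reverse)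
open import Data.List.Membership.Propositional using (_∈_; lose) renaming (find to find-member)
open import Data.List.Membership.Propositional.Properties
  using (∈-allFin; ∈-map⁺; ∈-tabulate⁺; ∈-tabulate⁻)
open import Data.List.Properties as List
  using (++-assoc; ++-identityʳ; foldl-++; length-++; length-reverse; length-tabulate; map-++; map-cong; map-∘;
         reverse-involutive; unfold-reverse; ʳ++-defn; ∷-injectiveˡ; ∷-injectiveʳ)
open import Data.List.Relation.Binary.Pointwise using (Pointwise; []; _∷_)
open import Data.List.Relation.Unary.All as All using (All; []; _∷_)
open import Data.List.Relation.Unary.All.Properties using (++⁺)
open import Data.List.Relation.Unary.AllPairs using (AllPairs; []; _∷_)
import Data.List.Relation.Unary.AllPairs.Properties as AllPairs
open import Data.List.Relation.Unary.Any as Any using (here; there)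
open import Data.List.Relation.Unary.Any.Properties using (reverse⁺; reverse⁻)
open import Data.Maybe.Base using (Maybe; just; nothing; maybe′)
open import Data.Maybe.Properties using (just-injective)
open import Data.Nat.Base using (ℕ; zero; suc; _+_; _*_; _∸_; _^_; _≤_; _<_; _≥_; _≡ᵇ_; z≤n; s≤s)
open import Data.Nat.Binary.Base as ℕᵇ using (ℕᵇ; 2[1+_]; 1+[2_])
import Data.Nat.Binary.Properties as ℕᵇ
open import Data.Nat.Properties
open import Data.Nat.Tactic.RingSolver using (solve-∀)
open import Data.Product.Base using (Σ; ∃; ∃₂; _×_; _,_; proj₁; proj₂)
open import Data.Sum.Base using (_⊎_; inj₁; inj₂)
open import Data.Sum.Function.Propositional using (_⊎-↔_)
open import Data.Unit.Base using (⊤; tt)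
open import Data.Vec.Base as Vec using (Vec; []; _∷_; _[_]≔_; lookup; toList)
import Data.Vec.Membership.Propositional as Vec
open import Data.Vec.Membership.Propositional.Properties using (∈-lookup)
open import Data.Vec.Properties as Vec
  using (lookup∘tabulate; lookup∘updateAt; lookup∘updateAt′; lookup-map; lookup-replicate;
         lookup⇒[]=; tabulate-cong; tabulate∘lookup; []=⇒lookup)
import Data.Vec.Relation.Unary.Any as VecAny
open import Function.Base using (_∘_)
open import Function.Bundles using (_↔_; _↣_; Injection; Inverse; mk↔ₛ′; mk↣)
open import Function.Properties.Inverse using (↔-refl; ↔-sym; ↔-trans)
open import Induction.WellFounded using (Acc; WellFounded; acc; wf⇒irrefl)
open import Level using (Lift; lift)
import Relation.Binary.Construct.Closure.Transitive as Transitive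
open import Relation.Binary.PropositionalEquality
open import Relation.Nullary using (¬_; Dec; yes; no; does; proof)
open import Relation.Nullary.Decidable
  using (dec-false; dec-true; decidable-stable; map′; ¬?; ¬¬-excluded-middle)
open import Relation.Nullary.Negation using (contradiction)
open import Relation.Nullary.Reflects using (Reflects; det; invert; ofʸ; ofⁿ)
open import Defs

-- Stack programs and Turing machines

-- Independence is meant in the linear sense only. Not every truth assignment to the atoms occurs:
-- in K any ◇ᵢ ψ implies ◇ᵢ 1, so the index j that is flipped cannot be prescribed. It suffices that
-- no non-zero vector is constantly 0, and for this one changes exactly one of the atoms it
-- contains. The induction follows the age of the atoms: ψ refers only to older atoms, so a world
-- that separates ψ from ψ′ is one that satisfies the non-zero vector ψ + ψ′.
--
-- For the same reason comparing vectors is a complete test of equivalence, and equivalent ψ never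
-- give different atoms. A gate creates at most one atom, so vectors stay short although the
-- unfolded formula may be exponentially large.
--
-- The gates of a string come in any order. Instead of sorting them, the table of gates is traversed
-- as often as there are gates. A gate on a cycle or with a missing source never receives a value,
-- so the same traversals decide whether the string encodes a circuit.

Finite-⊎ : ∀ {A B} → Finite A → Finite B → Finite (A ⊎ B)
Finite-⊎ (m , f) (n , g) = m + n , ↔-trans (f ⊎-↔ g) (↔-sym +↔⊎)

Finite-Fin : ∀ {n} → Finite (Fin n)
Finite-Fin {n} = n , ↔-refl

Finite-Maybe : ∀ {A} → Finite A → Finite (Maybe A)
Finite-Maybe {A} (n , f) = suc n , mk↔ₛ′ to′ from′ to∘from from∘to
  where
  open Inverse f
  to′ : Maybe A → Fin (suc n)
  to′ nothing  = zero
  to′ (just a) = suc (to a)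
  from′ : Fin (suc n) → Maybe A
  from′ zero    = nothing
  from′ (suc i) = just (from i)
  to∘from : ∀ i → to′ (from′ i) ≡ i
  to∘from zero    = refl
  to∘from (suc i) = cong suc (strictlyInverseˡ i)
  from∘to : ∀ a → from′ (to′ a) ≡ a
  from∘to nothing  = refl
  from∘to (just a) = cong just (strictlyInverseʳ a)

module Stack (A : Set) (A-finite : Finite A) (w : ℕ) where

  Reg : Set
  Reg = Fin (suc w)

  infixr 5 _⨾_

  data Cmd : Set where
    skip  : Cmd
    push  : Reg → A → Cmd
    pop   : Reg → Cmd
    copy  : Reg → Reg → Cmd
    _⨾_   : Cmd → Cmd → Cmd
    if    : Reg → (Maybe A → Bool) → Cmd → Cmd → Cmd
    while : Reg → (Maybe A → Bool) → Cmd → Cmd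

  State : Set
  State = Vec (List A) (suc w)

  top : State → Reg → Maybe A
  top s r = head (lookup s r)

  infix 4 ⟨_∣_⟩⇒_within_

  -- Costs count machine steps: `push` and `copy` take two because the head must move to a new cell
  -- before it can write there. `copy` wants distinct stacks since its second step still reads the
  -- source. `relax` turns exact counts into upper bounds.
  data ⟨_∣_⟩⇒_within_ : Cmd → State → State → ℕ → Set where
    skip  : ∀ {s} → ⟨ skip ∣ s ⟩⇒ s within 1
    push  : ∀ {s r a} → ⟨ push r a ∣ s ⟩⇒ s [ r ]≔ (a ∷ lookup s r) within 2
    pop   : ∀ {s r} → ⟨ pop r ∣ s ⟩⇒ s [ r ]≔ (drop 1 (lookup s r)) within 1
    copy  : ∀ {s r r′ a} → r ≢ r′ → top s r ≡ just a →
            ⟨ copy r r′ ∣ s ⟩⇒ s [ r′ ]≔ (a ∷ lookup s r′) within 2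
    _⨾_   : ∀ {c d s s′ s″ m n} → ⟨ c ∣ s ⟩⇒ s′ within m → ⟨ d ∣ s′ ⟩⇒ s″ within n →
            ⟨ c ⨾ d ∣ s ⟩⇒ s″ within (m + n)
    ifᵗ   : ∀ {r p c d s s′ n} → p (top s r) ≡ true → ⟨ c ∣ s ⟩⇒ s′ within n →
            ⟨ if r p c d ∣ s ⟩⇒ s′ within suc n
    ifᶠ   : ∀ {r p c d s s′ n} → p (top s r) ≡ false → ⟨ d ∣ s ⟩⇒ s′ within n →
            ⟨ if r p c d ∣ s ⟩⇒ s′ within suc n
    done  : ∀ {r p c s} → p (top s r) ≡ false → ⟨ while r p c ∣ s ⟩⇒ s within 1
    loop  : ∀ {r p c s s′ s″ m n} → p (top s r) ≡ true →
            ⟨ c ∣ s ⟩⇒ s′ within m → ⟨ while r p c ∣ s′ ⟩⇒ s″ within n →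
            ⟨ while r p c ∣ s ⟩⇒ s″ within suc (m + n)
    relax : ∀ {c s s′ m n} → m ≤ n → ⟨ c ∣ s ⟩⇒ s′ within m → ⟨ c ∣ s ⟩⇒ s′ within n

  -- Program points, one per machine step of an atomic command and one per test. Together with a
  -- halting state they are the states of the machine.
  Pos : Cmd → Set
  Pos skip          = Fin 1
  Pos (push r a)    = Fin 2
  Pos (pop r)       = Fin 1
  Pos (copy r r′)   = Fin 2
  Pos (c ⨾ d)       = Pos c ⊎ Pos d
  Pos (if r p c d)  = Fin 1 ⊎ (Pos c ⊎ Pos d)
  Pos (while r p c) = Fin 1 ⊎ Pos c

  Pos-finite : ∀ c → Finite (Pos c)
  Pos-finite skip          = Finite-Fin
  Pos-finite (push r a)    = Finite-Fin
  Pos-finite (pop r)       = Finite-Fin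
  Pos-finite (copy r r′)   = Finite-Fin
  Pos-finite (c ⨾ d)       = Finite-⊎ (Pos-finite c) (Pos-finite d)
  Pos-finite (if r p c d)  = Finite-⊎ Finite-Fin (Finite-⊎ (Pos-finite c) (Pos-finite d))
  Pos-finite (while r p c) = Finite-⊎ Finite-Fin (Pos-finite c)

  entry : ∀ c → Pos c
  entry skip          = zero
  entry (push r a)    = zero
  entry (pop r)       = zero
  entry (copy r r′)   = zero
  entry (c ⨾ d)       = inj₁ (entry c)
  entry (if r p c d)  = inj₁ zero
  entry (while r p c) = inj₁ zero

  Γ : Set
  Γ = Maybe A

  Acts : Set
  Acts = Vec (Γ × Move) (suc w)

  keep : Vec Γ (suc w) → Acts
  keep = Vec.map (_, stay)

  -- `ι` embeds the program points of the command into the states of the whole machine and `e` is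
  -- the state to continue with. Since the exit of `c` is the entry of `d`, sequencing costs no step
  -- of its own.
  step : ∀ {Q : Set} c → (Pos c → Q) → Q → Pos c → Vec Γ (suc w) → Q × Acts
  step skip          ι e p        ts = e , keep ts
  step (push r a)    ι e zero     ts = ι (suc zero) , keep ts [ r ]≔ (lookup ts r , left)
  step (push r a)    ι e (suc _)  ts = e , keep ts [ r ]≔ (just a , stay)
  step (pop r)       ι e p        ts = e , keep ts [ r ]≔ (lookup ts r , right)
  step (copy r r′)   ι e zero     ts = ι (suc zero) , keep ts [ r′ ]≔ (lookup ts r′ , left)
  step (copy r r′)   ι e (suc _)  ts = e , keep ts [ r′ ]≔ (lookup ts r , stay)
  step (c ⨾ d)       ι e (inj₁ p) ts = step c (ι ∘ inj₁) (ι (inj₂ (entry d))) p ts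
  step (c ⨾ d)       ι e (inj₂ p) ts = step d (ι ∘ inj₂) e p ts
  step (if r t c d)  ι e (inj₁ _) ts =
    (if_then_else_ (t (lookup ts r)) (ι (inj₂ (inj₁ (entry c)))) (ι (inj₂ (inj₂ (entry d))))) , keep ts
  step (if r t c d)  ι e (inj₂ (inj₁ p)) ts = step c (ι ∘ inj₂ ∘ inj₁) e p ts
  step (if r t c d)  ι e (inj₂ (inj₂ p)) ts = step d (ι ∘ inj₂ ∘ inj₂) e p ts
  step (while r t c) ι e (inj₁ _) ts =
    (if_then_else_ (t (lookup ts r)) (ι (inj₂ (entry c))) e) , keep ts
  step (while r t c) ι e (inj₂ p) ts = step c (ι ∘ inj₂) (ι (inj₁ zero)) p ts

  module Machine {S : Set} (inject : S ↣ Γ) (nonblank : ∀ a → ¬ (Injection.to inject a ≡ nothing))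
           (main : Cmd) (out : Reg) (accept : Maybe A → Bool) where

    machine : TM S
    machine = record
      { Γ = Γ ; Γ-finite = Finite-Maybe A-finite ; blank = nothing
      ; input = inject ; input-nonblank = nonblank
      ; Q = Maybe (Pos main) ; Q-finite = Finite-Maybe (Pos-finite main)
      ; start = just (entry main) ; workTapes = w
      ; δ = λ { nothing  ts → halt (accept (lookup ts out))
              ; (just p) ts → next (proj₁ (step main just nothing p ts)) (proj₂ (step main just nothing p ts)) } }

    private
      Q = Maybe (Pos main)
      δ = TM.δ machine
      act = writeMove machine
      _⊢run_ : ℕ → Config machine → Maybe Bool
      n ⊢run c = run machine n c

    cells : Tape Γ → List Γ
    cells (tape _ a rs) = a ∷ rs

    -- What lies to the left of the head is garbage.
    record Holds (τ : Tape Γ) (l : List A) : Set where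
      constructor holds
      field
        blanks   : ℕ
        contents : cells τ ≡ List.map just l ++ List.replicate blanks nothing

    record Represents (τs : Vec (Tape Γ) (suc w)) (s : State) : Set where
      constructor represents
      field
        tape-holds : ∀ r → Holds (lookup τs r) (lookup s r)

    open Represents

    scan : Vec (Tape Γ) (suc w) → Vec Γ (suc w)
    scan = Vec.map Tape.scanned

    Holds-scanned : ∀ {τ l} → Holds τ l → Tape.scanned τ ≡ head l
    Holds-scanned {tape _ a rs} {[]}    (holds (suc m) eq) = ∷-injectiveˡ eq
    Holds-scanned {tape _ a rs} {x ∷ l} (holds (m) eq)     = ∷-injectiveˡ eq

    Holds-pop : ∀ {τ l} → Holds τ l → Holds (act (Tape.scanned τ , right) τ) (drop 1 l)
    Holds-pop {tape _ _ []}       {[]}    (holds (suc m) eq)    = holds 1 (refl)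
    Holds-pop {tape _ _ (r ∷ rs)} {[]}    (holds (suc m) eq)    = holds m (∷-injectiveʳ eq)
    Holds-pop {tape _ _ []}       {x ∷ []} (holds (m) eq)       = holds 1 (refl)
    Holds-pop {tape _ _ (r ∷ rs)} {x ∷ l} (holds (m) eq)        = holds m (∷-injectiveʳ eq)

    -- Moving left may uncover a symbol left behind by an earlier pop; it is overwritten at once.
    Holds-push : ∀ {τ l} a → Holds τ l →
                 Holds (act (just a , stay) (act (Tape.scanned τ , left) τ)) (a ∷ l)
    Holds-push {tape [] _ _}      a (holds (m) eq) = holds m (cong (just a ∷_) eq)
    Holds-push {tape (x ∷ _) _ _} a (holds (m) eq) = holds m (cong (just a ∷_) eq)

    apply-keep : ∀ τs → Vec.zipWith act (keep (scan τs)) τs ≡ τs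
    apply-keep τs = go τs
      where
      go : ∀ {n} (τs : Vec (Tape Γ) n) →
           Vec.zipWith act (Vec.map (_, stay) (Vec.map Tape.scanned τs)) τs ≡ τs
      go []       = refl
      go (τ ∷ τs) = cong (τ ∷_) (go τs)

    apply-update : ∀ τs r x →
      Vec.zipWith act (keep (scan τs) [ r ]≔ x) τs ≡ τs [ r ]≔ act x (lookup τs r)
    apply-update τs r x = go τs r
      where
      go : ∀ {n} (τs : Vec (Tape Γ) n) r →
           Vec.zipWith act (Vec.map (_, stay) (Vec.map Tape.scanned τs) [ r ]≔ x) τs
           ≡ τs [ r ]≔ act x (lookup τs r)
      go (τ ∷ τs) zero    = cong (act x τ ∷_) (go₀ τs)
        where
        go₀ : ∀ {n} (τs : Vec (Tape Γ) n) →
              Vec.zipWith act (Vec.map (_, stay) (Vec.map Tape.scanned τs)) τs ≡ τs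
        go₀ []       = refl
        go₀ (τ ∷ τs) = cong (τ ∷_) (go₀ τs)
      go (τ ∷ τs) (suc r) = cong (τ ∷_) (go τs r)

    lookup-scan : ∀ τs r → lookup (scan τs) r ≡ Tape.scanned (lookup τs r)
    lookup-scan τs r = lookup-map r Tape.scanned τs

    scan-top : ∀ {τs s} → Represents τs s → ∀ r → lookup (scan τs) r ≡ top s r
    scan-top {τs} rep r = trans (lookup-scan τs r) (Holds-scanned (tape-holds rep r))

    Represents-update : ∀ {τs s r τ l} → Represents τs s → Holds τ l →
                        Represents (τs [ r ]≔ τ) (s [ r ]≔ l)
    tape-holds (Represents-update {τs} {s} {r} {τ} {l} rep h) r′ with r′ Fin.≟ r
    ... | yes refl = subst₂ Holds (sym (lookup∘updateAt r τs)) (sym (lookup∘updateAt r s)) h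
    ... | no r′≢r  = subst₂ Holds (sym (lookup∘updateAt′ r′ r r′≢r τs))
                                  (sym (lookup∘updateAt′ r′ r r′≢r s)) (tape-holds rep r′)

    run-next : ∀ {q τs q′ as n} → δ q (scan τs) ≡ next q′ as →
               suc n ⊢run (q , τs) ≡ n ⊢run (q′ , Vec.zipWith act as τs)
    run-next eq rewrite eq = refl

    run-mono : ∀ {m n c b} → m ≤ n → m ⊢run c ≡ just b → n ⊢run c ≡ just b
    run-mono {c = q , τs} (s≤s m≤n) eq with δ q (scan τs)
    ... | halt b     = eq
    ... | next q′ as = run-mono m≤n eq

    run-assoc : ∀ m n k {c b} → (m + (n + k)) ⊢run c ≡ just b → (m + n + k) ⊢run c ≡ just b
    run-assoc m n k {c} {b} = subst (λ z → z ⊢run c ≡ just b) (sym (+-assoc m n k))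

    Agrees : ∀ c → (Pos c → Q) → Q → Set
    Agrees c ι e = ∀ p ts → δ (ι p) ts ≡ next (proj₁ (step c ι e p ts)) (proj₂ (step c ι e p ts))

    -- Stated through continuations: a halting run from the exit is prolonged to one from `q`.
    -- Simulations then compose as functions, without a notion of reachable configuration.
    Simulates : Q → Q → State → Vec (Tape Γ) (suc w) → ℕ → Set
    Simulates q e s′ τs t = ∃ λ τs′ → Represents τs′ s′ ×
      (∀ {n b} → n ⊢run (e , τs′) ≡ just b → (t + n) ⊢run (q , τs) ≡ just b)

    keep-step : ∀ {q q′ τs s b n} → Represents τs s →
                δ q (scan τs) ≡ next q′ (keep (scan τs)) →
                n ⊢run (q′ , τs) ≡ just b → suc n ⊢run (q , τs) ≡ just b
    keep-step {q′ = q′} {τs} {n = n} rep eq h =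
      trans (run-next eq) (trans (cong (λ τs′ → n ⊢run (q′ , τs′)) (apply-keep τs)) h)

    update-step : ∀ {q q′ τs r x b n} → δ q (scan τs) ≡ next q′ (keep (scan τs) [ r ]≔ x) →
                  n ⊢run (q′ , τs [ r ]≔ act x (lookup τs r)) ≡ just b →
                  suc n ⊢run (q , τs) ≡ just b
    update-step {q′ = q′} {τs} {r} {x} {n = n} eq h =
      trans (run-next eq) (trans (cong (λ τs′ → n ⊢run (q′ , τs′)) (apply-update τs r x)) h)

    -- Common to `push` and `copy`. The second step is assumed for all scanned symbols that agree
    -- off `r`, because `copy` takes the symbol to be written from another tape.
    push-twice : ∀ {q q₁ e τs r s a x} → Represents τs s →
      δ q (scan τs) ≡ next q₁ (keep (scan τs) [ r ]≔ (lookup (scan τs) r , left)) →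
      (∀ {ts} → (∀ r′ → r′ ≢ r → lookup ts r′ ≡ lookup (scan τs) r′) →
                δ q₁ ts ≡ next e (keep ts [ r ]≔ x)) →
      x ≡ (just a , stay) →
      Simulates q e (s [ r ]≔ (a ∷ lookup s r)) τs 2
    push-twice {q} {e = e} {τs} {r} {s} {a} rep eq₁ eq₂ refl =
      τs [ r ]≔ act (just a , stay) τ₁ , Represents-update rep held , go
      where
      τ  = lookup τs r
      τ₁ = act (Tape.scanned τ , left) τ
      τ₁≡ : act (lookup (scan τs) r , left) τ ≡ τ₁
      τ₁≡ = cong (λ y → act (y , left) τ) (lookup-scan τs r)
      held : Holds (act (just a , stay) τ₁) (a ∷ lookup s r)
      held = Holds-push a (tape-holds rep r)
      τs₁ = τs [ r ]≔ act (lookup (scan τs) r , left) τ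
      same : ∀ r′ → r′ ≢ r → lookup (scan τs₁) r′ ≡ lookup (scan τs) r′
      same r′ r′≢r = trans (lookup-scan τs₁ r′)
        (trans (cong Tape.scanned (lookup∘updateAt′ r′ r r′≢r τs)) (sym (lookup-scan τs r′)))
      final : τs₁ [ r ]≔ act (just a , stay) (lookup τs₁ r) ≡ τs [ r ]≔ act (just a , stay) τ₁
      final = trans (cong (λ z → τs₁ [ r ]≔ act (just a , stay) z) (trans (lookup∘updateAt r τs) τ₁≡))
                    (Vec.[]≔-idempotent τs r)
      go : ∀ {n b} → n ⊢run (e , τs [ r ]≔ act (just a , stay) τ₁) ≡ just b → (2 + n) ⊢run (q , τs) ≡ just b
      go {n} h = update-step {n = suc n} eq₁ (update-step {n = n} (eq₂ same)
        (trans (cong (λ z → n ⊢run (e , z)) final) h))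

    if-true : ∀ {X : Set} {b : Bool} {x y : X} → b ≡ true → if_then_else_ b x y ≡ x
    if-true refl = refl

    if-false : ∀ {X : Set} {b : Bool} {x y : X} → b ≡ false → if_then_else_ b x y ≡ y
    if-false refl = refl

    simulate : ∀ {c s s′ t} ι e → Agrees c ι e → ⟨ c ∣ s ⟩⇒ s′ within t → ∀ {τs} →
               Represents τs s → Simulates (ι (entry c)) e s′ τs t
    simulate ι e agr skip {τs} rep = τs , rep , keep-step rep (agr zero _)
    simulate {push r a} ι e agr push rep = push-twice rep (agr zero _) (λ _ → agr (suc zero) _) refl
    simulate {pop r} {s} ι e agr pop {τs} rep =
      _ , Represents-update rep (Holds-pop (tape-holds rep r)) , λ h →
      update-step (trans (agr zero _) (cong (λ y → next e (keep (scan τs) [ r ]≔ (y , right))) (lookup-scan τs r))) h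
    simulate {copy r r′} ι e agr (copy {a = a} r≢r′ eq) {τs} rep =
      push-twice rep (agr zero _)
        (λ {ts} same → trans (agr (suc zero) ts)
          (cong (λ y → next e (keep ts [ r′ ]≔ (y , stay)))
            (trans (same r r≢r′) (trans (scan-top rep r) eq)))) refl
    simulate {c ⨾ d} ι e agr (_⨾_ {m = m} {n} x y) {τs} rep
      with simulate (ι ∘ inj₁) _ (agr ∘ inj₁) x rep
    ... | τs₁ , rep₁ , go₁ with simulate (ι ∘ inj₂) e (agr ∘ inj₂) y rep₁
    ... | τs₂ , rep₂ , go₂ = τs₂ , rep₂ , λ {k} h →
          run-assoc m n k (go₁ (go₂ h))
    simulate {if r p c d} ι e agr (ifᵗ eq x) {τs} rep
      with simulate (ι ∘ inj₂ ∘ inj₁) e (agr ∘ inj₂ ∘ inj₁) x rep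
    ... | τs₁ , rep₁ , go = τs₁ , rep₁ , λ h →
          keep-step rep (trans (agr (inj₁ zero) _)
            (cong (λ q → next q _) (if-true (trans (cong p (scan-top rep r)) eq)))) (go h)
    simulate {if r p c d} ι e agr (ifᶠ eq x) {τs} rep
      with simulate (ι ∘ inj₂ ∘ inj₂) e (agr ∘ inj₂ ∘ inj₂) x rep
    ... | τs₁ , rep₁ , go = τs₁ , rep₁ , λ h →
          keep-step rep (trans (agr (inj₁ zero) _)
            (cong (λ q → next q _) (if-false (trans (cong p (scan-top rep r)) eq)))) (go h)
    simulate {while r p c} ι e agr (done eq) {τs} rep = τs , rep , λ h →
          keep-step rep (trans (agr (inj₁ zero) _)
            (cong (λ q → next q _) (if-false (trans (cong p (scan-top rep r)) eq)))) h
    simulate {while r p c} ι e agr (loop {m = m} {n} eq x y) {τs} rep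
      with simulate (ι ∘ inj₂) _ (agr ∘ inj₂) x rep
    ... | τs₁ , rep₁ , go₁ with simulate ι e agr y rep₁
    ... | τs₂ , rep₂ , go₂ = τs₂ , rep₂ , λ {k} h →
          keep-step rep (trans (agr (inj₁ zero) _)
            (cong (λ q → next q _) (if-true (trans (cong p (scan-top rep r)) eq))))
            (run-assoc m n k (go₁ (go₂ h)))
    simulate ι e agr (relax m≤n x) rep with simulate ι e agr x rep
    ... | τs₁ , rep₁ , go = τs₁ , rep₁ , λ {k} h → run-mono (+-monoˡ-≤ k m≤n) (go h)

    -- The extra step is the evaluation of `δ` in the state `nothing`, which inspects the stack
    -- `out` and halts.
    machine-run : ∀ {τs s s′ t n} → Represents τs s → ⟨ main ∣ s ⟩⇒ s′ within t → t + 1 ≤ n →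
                  n ⊢run (just (entry main) , τs) ≡ just (accept (top s′ out))
    machine-run rep x t<n with simulate just nothing (λ _ _ → refl) x rep
    ... | τs₁ , rep₁ , go = run-mono t<n (go (cong (just ∘ accept) (scan-top rep₁ out)))

-- Programs on binary trees

module TreeCode (S : Set) (S-finite : Finite S) (nil : S) where

  data Cell : Set where
    cons delim : Cell
    atom       : S → Cell

  Cell-finite : Finite Cell
  Cell-finite = proj₁ fin , ↔-trans iso (proj₂ fin)
    where
    fin : Finite (Fin 2 ⊎ S)
    fin = Finite-⊎ Finite-Fin S-finite
    iso : Cell ↔ (Fin 2 ⊎ S)
    iso = mk↔ₛ′ (λ { cons → inj₁ zero ; delim → inj₁ (suc zero) ; (atom a) → inj₂ a })
                (λ { (inj₁ zero) → cons ; (inj₁ (suc zero)) → delim ; (inj₂ a) → atom a })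
                (λ { (inj₁ zero) → refl ; (inj₁ (suc zero)) → refl ; (inj₂ a) → refl })
                (λ { cons → refl ; delim → refl ; (atom a) → refl })

  open Stack Cell Cell-finite 3

  infixr 6 _·_

  data D : Set where
    atom : S → D
    _·_  : D → D → D

  size : D → ℕ
  size (atom a) = 1
  size (d · e)  = suc (size d + size e)

  root : D → Maybe S
  root (atom a) = just a
  root (d · e)  = nothing

  -- What remains of a list on its stack once a fold has consumed the elements.
  terminator : D → S
  terminator (atom a) = a
  terminator (d · e)  = terminator e

  infixr 9 _⊚_

  data Fun : Set where
    id hd tl : Fun
    _⊚_      : Fun → Fun → Fun
    const    : S → Fun
    ⟨_,_⟩    : Fun → Fun → Fun
    branch   : (Maybe S → Bool) → Fun → Fun → Fun
    fold     : Fun → Fun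

  iter : (D → D) → D → D → D
  iter f (atom _) s = s
  iter f (x · xs) s = iter f xs (f (x · s))

  ⟦_⟧ : Fun → D → D
  ⟦ id ⟧           d        = d
  ⟦ hd ⟧           (atom a) = atom a
  ⟦ hd ⟧           (d · e)  = d
  ⟦ tl ⟧           (atom a) = atom a
  ⟦ tl ⟧           (d · e)  = e
  ⟦ g ⊚ f ⟧        d        = ⟦ g ⟧ (⟦ f ⟧ d)
  ⟦ const a ⟧      d        = atom a
  ⟦ ⟨ f , g ⟩ ⟧    d        = ⟦ f ⟧ d · ⟦ g ⟧ d
  ⟦ branch p f g ⟧ (atom a) = atom a
  ⟦ branch p f g ⟧ (d · e)  = if p (root d) then ⟦ f ⟧ e else ⟦ g ⟧ e
  ⟦ fold f ⟧       (atom a) = atom a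
  ⟦ fold f ⟧       (xs · s) = iter ⟦ f ⟧ xs s

  -- Polish notation, in which the end of a subtree is found by counting.
  ser : D → List Cell → List Cell
  ser (atom a) l = atom a ∷ l
  ser (d · e)  l = cons ∷ ser d (ser e l)

  -- The same word reversed in front of `l`, as it arises when a subtree is moved to another stack
  -- cell by cell.
  res : D → List Cell → List Cell
  res (atom a) l = atom a ∷ l
  res (d · e)  l = res e (res d (cons ∷ l))

  private
    -- `X` carries the argument and the result on top of saved values, `Y` is the buffer through
    -- which subtrees are moved, and `C` is a counter that is empty between commands. `Z` carries
    -- the lists of the folds in progress; being tape 0 it also holds the input.
    pattern Z = zero
    pattern X = suc zero
    pattern Y = suc (suc zero)
    pattern C = suc (suc (suc zero))

  present isCons isn'tDelim : Maybe Cell → Bool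
  present nothing  = false
  present (just _) = true
  isCons (just cons) = true
  isCons _           = false
  isn'tDelim (just delim) = false
  isn'tDelim _            = true

  onRoot : (Maybe S → Bool) → Maybe Cell → Bool
  onRoot p (just (atom a)) = p (just a)
  onRoot p _               = p nothing

  -- The stack C counts the subtrees that remain to be read.
  fetchLoop fetch restoreLoop restore : Reg → Cmd
  fetchLoop r = while C present (if r isCons (push C cons) (pop C) ⨾ copy r Y ⨾ pop r)
  fetch r     = push Y delim ⨾ push C cons ⨾ fetchLoop r
  restoreLoop r = while Y isn'tDelim (copy Y r ⨾ pop Y)
  restore r     = restoreLoop r ⨾ pop Y

  -- To duplicate a subtree it is moved to `Y`, unloaded onto `Z` and `X` at once, and the copy on
  -- `Z` is carried through `Y` to `X`.
  discardLoop discard restore₂Loop restore₂ dup : Cmd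
  discardLoop  = while C present (if X isCons (push C cons) (pop C) ⨾ pop X)
  discard      = push C cons ⨾ discardLoop
  restore₂Loop = while Y isn'tDelim (copy Y Z ⨾ copy Y X ⨾ pop Y)
  restore₂     = restore₂Loop ⨾ pop Y
  dup          = fetch X ⨾ restore₂ ⨾ fetch Z ⨾ restore X

  compile : Fun → Cmd
  compile id             = skip
  compile hd             = if X isCons (pop X ⨾ fetch X ⨾ discard ⨾ restore X) skip
  compile tl             = if X isCons (pop X ⨾ discard) skip
  compile (g ⊚ f)        = compile f ⨾ compile g
  compile (const a)      = discard ⨾ push X (atom a)
  -- The value of `f` waits on `Y` above a delimiter while `g` treats the second copy of the
  -- argument. The delimiters let such waiting values be stacked.
  compile ⟨ f , g ⟩      = dup ⨾ compile f ⨾ fetch X ⨾ compile g ⨾ restore X ⨾ push X cons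
  compile (branch p f g) =
    if X isCons (pop X ⨾ if X (onRoot p) (discard ⨾ compile f) (discard ⨾ compile g)) skip
  compile (fold f)       =
    if X isCons
      -- The list is moved to `Z` and the state remains on `X`. Each round puts the next element in
      -- front of the state, which forms the argument `x · s` of `f`; the last `pop Z` removes the
      -- terminator.
      (pop X ⨾ fetch X ⨾ restore Z ⨾
       while Z isCons (pop Z ⨾ fetch Z ⨾ restore X ⨾ push X cons ⨾ compile f) ⨾ pop Z)
      skip

  -- Sealed, because unification would otherwise unfold the products in unary.
  opaque
    fetchT restoreT restore₂T discardT : ℕ → ℕ
    fetchT n    = 2 + (2 + (7 * n + 1))
    restoreT n  = 4 * n + 1 + 1
    restore₂T n = 6 * n + 1 + 1
    discardT n  = 2 + (5 * n + 1)

  dupT : ℕ → ℕ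
  dupT n = fetchT n + (restore₂T n + (fetchT n + restoreT n))

  iterT : (D → D) → (D → ℕ) → D → D → ℕ
  iterT f t (atom _) s = 1
  iterT f t (x · xs) s =
    suc ((1 + (fetchT (size x) + (restoreT (size x) + (2 + t (x · s))))) + iterT f t xs (f (x · s)))

  -- A function of the argument and not of its size: the cost of a composition or a fold depends on
  -- intermediate results, whose sizes are bounded only later and case by case.
  T : Fun → D → ℕ
  T id             d        = 1
  T hd             (atom a) = 2
  T hd             (d · e)  = suc (1 + (fetchT (size d) + (discardT (size e) + restoreT (size d))))
  T tl             (atom a) = 2
  T tl             (d · e)  = suc (1 + discardT (size d))
  T (g ⊚ f)        d        = T f d + T g (⟦ f ⟧ d)
  T (const a)      d        = discardT (size d) + 2
  T ⟨ f , g ⟩      d        =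
    dupT (size d) + (T f d + (fetchT (size (⟦ f ⟧ d)) + (T g d + (restoreT (size (⟦ f ⟧ d)) + 2))))
  T (branch p f g) (atom a) = 2
  T (branch p f g) (d · e)  =
    suc (1 + suc (discardT (size d) + (if p (root d) then T f e else T g e)))
  T (fold f)       (atom a) = 2
  T (fold f)       (xs · s) =
    suc (1 + (fetchT (size xs) + (restoreT (size xs) + (iterT ⟦ f ⟧ (T f) xs s + 1))))

  split-cost : ∀ c m n t → c + (c * m + (c * n + t)) ≡ c * suc (m + n) + t
  split-cost = solve-∀

  split-cost′ : ∀ c m n t → c * n + (c * m + (c + t)) ≡ c * suc (m + n) + t
  split-cost′ = solve-∀

  leaf-cost : ∀ c t → c + t ≡ c * 1 + t
  leaf-cost = solve-∀

  retime : ∀ {c s s′ m n} → m ≡ n → ⟨ c ∣ s ⟩⇒ s′ within m → ⟨ c ∣ s ⟩⇒ s′ within n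
  retime refl x = x

  -- Written with the rest of the run as a premise, so that the two subtrees of `d · e` are chained
  -- directly. A `cons` adds one to the count of subtrees still to be read, an atom takes one off.
  -- Seven steps pay for a cell: one for the loop test, at most three for the counter, two for
  -- copying, one for popping.
  fetchLoop-X : ∀ d {z x y c s t} →
    ⟨ fetchLoop X ∣ z ∷ x ∷ res d y ∷ c ∷ [] ⟩⇒ s within t →
    ⟨ fetchLoop X ∣ z ∷ ser d x ∷ y ∷ (cons ∷ c) ∷ [] ⟩⇒ s within (7 * size d + t)
  fetchLoop-X (atom a) {t = t} k = retime (leaf-cost 7 t)
    (loop refl (relax (n≤1+n _) (ifᶠ refl pop) ⨾ copy (λ ()) refl ⨾ pop) k)
  fetchLoop-X (d · e)  {t = t} k = retime (split-cost 7 (size d) (size e) t)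
    (loop refl (ifᵗ refl push ⨾ copy (λ ()) refl ⨾ pop) (fetchLoop-X d (fetchLoop-X e k)))

  fetchLoop-Z : ∀ d {z x y c s t} →
    ⟨ fetchLoop Z ∣ z ∷ x ∷ res d y ∷ c ∷ [] ⟩⇒ s within t →
    ⟨ fetchLoop Z ∣ ser d z ∷ x ∷ y ∷ (cons ∷ c) ∷ [] ⟩⇒ s within (7 * size d + t)
  fetchLoop-Z (atom a) {t = t} k = retime (leaf-cost 7 t)
    (loop refl (relax (n≤1+n _) (ifᶠ refl pop) ⨾ copy (λ ()) refl ⨾ pop) k)
  fetchLoop-Z (d · e)  {t = t} k = retime (split-cost 7 (size d) (size e) t)
    (loop refl (ifᵗ refl push ⨾ copy (λ ()) refl ⨾ pop) (fetchLoop-Z d (fetchLoop-Z e k)))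

  opaque
    unfolding fetchT

    fetch-X : ∀ d {z x y} → ⟨ fetch X ∣ z ∷ ser d x ∷ y ∷ [] ∷ [] ⟩⇒
              z ∷ x ∷ res d (delim ∷ y) ∷ [] ∷ [] within fetchT (size d)
    fetch-X d = push ⨾ push ⨾ fetchLoop-X d (done refl)

    fetch-Z : ∀ d {z x y} → ⟨ fetch Z ∣ ser d z ∷ x ∷ y ∷ [] ∷ [] ⟩⇒
              z ∷ x ∷ res d (delim ∷ y) ∷ [] ∷ [] within fetchT (size d)
    fetch-Z d = push ⨾ push ⨾ fetchLoop-Z d (done refl)

  discardLoop-runs : ∀ d {z x y c s t} →
    ⟨ discardLoop ∣ z ∷ x ∷ y ∷ c ∷ [] ⟩⇒ s within t →
    ⟨ discardLoop ∣ z ∷ ser d x ∷ y ∷ (cons ∷ c) ∷ [] ⟩⇒ s within (5 * size d + t)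
  discardLoop-runs (atom a) {t = t} k = retime (leaf-cost 5 t)
    (loop refl (relax (n≤1+n _) (ifᶠ refl pop) ⨾ pop) k)
  discardLoop-runs (d · e)  {t = t} k = retime (split-cost 5 (size d) (size e) t)
    (loop refl (ifᵗ refl push ⨾ pop) (discardLoop-runs d (discardLoop-runs e k)))

  opaque
    unfolding discardT

    discard-runs : ∀ d {z x y} → ⟨ discard ∣ z ∷ ser d x ∷ y ∷ [] ∷ [] ⟩⇒
                   z ∷ x ∷ y ∷ [] ∷ [] within discardT (size d)
    discard-runs d = push ⨾ discardLoop-runs d (done refl)

  restoreLoop-X : ∀ d {z x y s t} →
    ⟨ restoreLoop X ∣ z ∷ ser d x ∷ y ∷ [] ∷ [] ⟩⇒ s within t →
    ⟨ restoreLoop X ∣ z ∷ x ∷ res d y ∷ [] ∷ [] ⟩⇒ s within (4 * size d + t)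
  restoreLoop-X (atom a) {t = t} k = retime (leaf-cost 4 t)
    (loop refl (copy (λ ()) refl ⨾ pop) k)
  restoreLoop-X (d · e)  {t = t} k = retime (split-cost′ 4 (size d) (size e) t)
    (restoreLoop-X e (restoreLoop-X d (loop refl (copy (λ ()) refl ⨾ pop) k)))

  restoreLoop-Z : ∀ d {z x y s t} →
    ⟨ restoreLoop Z ∣ ser d z ∷ x ∷ y ∷ [] ∷ [] ⟩⇒ s within t →
    ⟨ restoreLoop Z ∣ z ∷ x ∷ res d y ∷ [] ∷ [] ⟩⇒ s within (4 * size d + t)
  restoreLoop-Z (atom a) {t = t} k = retime (leaf-cost 4 t)
    (loop refl (copy (λ ()) refl ⨾ pop) k)
  restoreLoop-Z (d · e)  {t = t} k = retime (split-cost′ 4 (size d) (size e) t)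
    (restoreLoop-Z e (restoreLoop-Z d (loop refl (copy (λ ()) refl ⨾ pop) k)))

  restore₂Loop-runs : ∀ d {z x y s t} →
    ⟨ restore₂Loop ∣ ser d z ∷ ser d x ∷ y ∷ [] ∷ [] ⟩⇒ s within t →
    ⟨ restore₂Loop ∣ z ∷ x ∷ res d y ∷ [] ∷ [] ⟩⇒ s within (6 * size d + t)
  restore₂Loop-runs (atom a) {t = t} k = retime (leaf-cost 6 t)
    (loop refl (copy (λ ()) refl ⨾ copy (λ ()) refl ⨾ pop) k)
  restore₂Loop-runs (d · e)  {t = t} k = retime (split-cost′ 6 (size d) (size e) t)
    (restore₂Loop-runs e (restore₂Loop-runs d
      (loop refl (copy (λ ()) refl ⨾ copy (λ ()) refl ⨾ pop) k)))

  opaque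
    unfolding restoreT

    restore-X : ∀ d {z x y} → ⟨ restore X ∣ z ∷ x ∷ res d (delim ∷ y) ∷ [] ∷ [] ⟩⇒
                z ∷ ser d x ∷ y ∷ [] ∷ [] within restoreT (size d)
    restore-X d = restoreLoop-X d (done refl) ⨾ pop

    restore-Z : ∀ d {z x y} → ⟨ restore Z ∣ z ∷ x ∷ res d (delim ∷ y) ∷ [] ∷ [] ⟩⇒
                ser d z ∷ x ∷ y ∷ [] ∷ [] within restoreT (size d)
    restore-Z d = restoreLoop-Z d (done refl) ⨾ pop

  opaque
    unfolding restore₂T

    restore₂-runs : ∀ d {z x y} → ⟨ restore₂ ∣ z ∷ x ∷ res d (delim ∷ y) ∷ [] ∷ [] ⟩⇒
                    ser d z ∷ ser d x ∷ y ∷ [] ∷ [] within restore₂T (size d)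
    restore₂-runs d = restore₂Loop-runs d (done refl) ⨾ pop

  dup-runs : ∀ d {z x y} → ⟨ dup ∣ z ∷ ser d x ∷ y ∷ [] ∷ [] ⟩⇒
             z ∷ ser d (ser d x) ∷ y ∷ [] ∷ [] within dupT (size d)
  dup-runs d = fetch-X d ⨾ restore₂-runs d ⨾ fetch-Z d ⨾ restore-X d

  onRoot-ser : ∀ p d {l} → onRoot p (head (ser d l)) ≡ p (root d)
  onRoot-ser p (atom a) = refl
  onRoot-ser p (d · e)  = refl

  -- The remainders `z`, `x` and `y` are arbitrary because subprograms run on top of values saved by
  -- the surrounding ones.
  compile-runs : ∀ f d {z x y} → ⟨ compile f ∣ z ∷ ser d x ∷ y ∷ [] ∷ [] ⟩⇒
                 z ∷ ser (⟦ f ⟧ d) x ∷ y ∷ [] ∷ [] within T f d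

  iter-runs : ∀ f xs s {z x y} →
    ⟨ while Z isCons (pop Z ⨾ fetch Z ⨾ restore X ⨾ push X cons ⨾ compile f)
      ∣ ser xs z ∷ ser s x ∷ y ∷ [] ∷ [] ⟩⇒
    (atom (terminator xs) ∷ z) ∷ ser (iter ⟦ f ⟧ xs s) x ∷ y ∷ [] ∷ [] within iterT ⟦ f ⟧ (T f) xs s

  compile-runs id        d        = skip
  compile-runs hd        (atom a) = ifᶠ refl skip
  compile-runs hd        (d · e)  = ifᵗ refl (pop ⨾ fetch-X d ⨾ discard-runs e ⨾ restore-X d)
  compile-runs tl        (atom a) = ifᶠ refl skip
  compile-runs tl        (d · e)  = ifᵗ refl (pop ⨾ discard-runs d)
  compile-runs (g ⊚ f)   d        = compile-runs f d ⨾ compile-runs g (⟦ f ⟧ d)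
  compile-runs (const a) d        = discard-runs d ⨾ push
  compile-runs ⟨ f , g ⟩ d        =
    dup-runs d ⨾ compile-runs f d ⨾ fetch-X (⟦ f ⟧ d) ⨾ compile-runs g d ⨾
    restore-X (⟦ f ⟧ d) ⨾ push
  compile-runs (branch p f g) (atom a) = ifᶠ refl skip
  compile-runs (branch p f g) (d · e) with p (root d) in eq
  ... | true  = ifᵗ refl (pop ⨾ ifᵗ (trans (onRoot-ser p d) eq) (discard-runs d ⨾ compile-runs f e))
  ... | false = ifᵗ refl (pop ⨾ ifᶠ (trans (onRoot-ser p d) eq) (discard-runs d ⨾ compile-runs g e))
  compile-runs (fold f) (atom a) = ifᶠ refl skip
  compile-runs (fold f) (xs · s) =
    ifᵗ refl (pop ⨾ fetch-X xs ⨾ restore-Z xs ⨾ iter-runs f xs s ⨾ pop)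

  iter-runs f (atom a) s = done refl
  iter-runs f (x · xs) s =
    loop refl (pop ⨾ fetch-Z x ⨾ restore-X x ⨾ push ⨾ compile-runs f (x · s))
         (iter-runs f xs (⟦ f ⟧ (x · s)))

  encodeList : List S → D
  encodeList = List.foldr (λ a d → atom a · d) (atom nil)

  readLoop : Cmd
  readLoop = while Z present (copy Z X ⨾ pop Z ⨾ push X cons)

  readLoop-runs : ∀ as out {y} →
    ⟨ readLoop ∣ List.map atom as ∷ ser (encodeList out) [] ∷ y ∷ [] ∷ [] ⟩⇒
    [] ∷ ser (encodeList (as List.ʳ++ out)) [] ∷ y ∷ [] ∷ [] within (6 * List.length as + 1)
  readLoop-runs []       out = done refl
  readLoop-runs (a ∷ as) out = retime (sym (cong (_+ 1) (*-suc 6 (List.length as))))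
    (loop refl (copy (λ ()) refl ⨾ pop ⨾ push) (readLoop-runs as (a ∷ out)))

  -- The input is pushed symbol by symbol in front of the empty list, so `f` receives it reversed.
  decide : Fun → Cmd
  decide f = push X (atom nil) ⨾ readLoop ⨾ compile f

  decide-runs : ∀ f as → ⟨ decide f ∣ List.map atom as ∷ [] ∷ [] ∷ [] ∷ [] ⟩⇒
    [] ∷ ser (⟦ f ⟧ (encodeList (List.reverse as))) [] ∷ [] ∷ [] ∷ []
    within (2 + (6 * List.length as + 1 + T f (encodeList (List.reverse as))))
  decide-runs f as = push ⨾ readLoop-runs as [] ⨾ compile-runs f _

  inject : S ↣ Maybe Cell
  inject = mk↣ {to = λ a → just (atom a)} λ { refl → refl }

  decider : Fun → (Maybe S → Bool) → TM S
  decider f p = Machine.machine inject (λ _ ()) (decide f) X (onRoot p)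

  module _ (f : Fun) (p : Maybe S → Bool) where
    open Machine inject (λ _ ()) (decide f) X (onRoot p)

    private
      initial-holds : ∀ as → Holds (inputTape machine as) (List.map atom as)
      initial-holds []       = holds 1 refl
      initial-holds (a ∷ as) = holds 0 (cong (just (atom a) ∷_)
        (trans (map-∘ as) (sym (++-identityʳ _))))

      initial-represents : ∀ as →
        Represents (proj₂ (initial machine as)) (List.map atom as ∷ [] ∷ [] ∷ [] ∷ [])
      initial-represents as = represents λ
        { Z → initial-holds as ; X → holds 1 refl ; Y → holds 1 refl ; C → holds 1 refl }

    decider-run : ∀ as {n} →
      2 + (6 * List.length as + 1 + T f (encodeList (List.reverse as))) + 1 ≤ n →
      run (decider f p) n (initial (decider f p) as)
      ≡ just (p (root (⟦ f ⟧ (encodeList (List.reverse as)))))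
    decider-run as t≤n =
      trans (machine-run (initial-represents as) (decide-runs f as) t≤n)
            (cong just (onRoot-ser p (⟦ f ⟧ (encodeList (List.reverse as)))))

-- Polynomial time

caseList : ∀ {A B : Set} → B → (A → List A → B) → List A → B
caseList n c []       = n
caseList n c (x ∷ xs) = c x xs

caseMaybe : ∀ {A B : Set} → B → (A → B) → Maybe A → B
caseMaybe n c nothing  = n
caseMaybe n c (just x) = c x

-- Bounds are kept as syntax with natural coefficients: monotonicity and substitution then follow by
-- induction, and the form c n^d + c is reached only once, at the end.
data Poly : Set where
  con     : ℕ → Poly
  var     : Poly
  _⊕_ _⊗_ : Poly → Poly → Poly

infixl 6 _⊕_
infixl 7 _⊗_

eval : Poly → ℕ → ℕ
eval (con a) n = a
eval var     n = n
eval (p ⊕ q) n = eval p n + eval q n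
eval (p ⊗ q) n = eval p n * eval q n

_⟨_⟩ : Poly → Poly → Poly
con a   ⟨ r ⟩ = con a
var     ⟨ r ⟩ = r
(p ⊕ q) ⟨ r ⟩ = p ⟨ r ⟩ ⊕ q ⟨ r ⟩
(p ⊗ q) ⟨ r ⟩ = p ⟨ r ⟩ ⊗ q ⟨ r ⟩

eval-⟨⟩ : ∀ p r n → eval (p ⟨ r ⟩) n ≡ eval p (eval r n)
eval-⟨⟩ (con a) r n = refl
eval-⟨⟩ var     r n = refl
eval-⟨⟩ (p ⊕ q) r n = cong₂ _+_ (eval-⟨⟩ p r n) (eval-⟨⟩ q r n)
eval-⟨⟩ (p ⊗ q) r n = cong₂ _*_ (eval-⟨⟩ p r n) (eval-⟨⟩ q r n)

eval-mono : ∀ p {m n} → m ≤ n → eval p m ≤ eval p n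
eval-mono (con a) m≤n = ≤-refl
eval-mono var     m≤n = m≤n
eval-mono (p ⊕ q) m≤n = +-mono-≤ (eval-mono p m≤n) (eval-mono q m≤n)
eval-mono (p ⊗ q) m≤n = *-mono-≤ (eval-mono p m≤n) (eval-mono q m≤n)

≤-subst : ∀ p r {m n} → m ≤ eval r n → eval p m ≤ eval (p ⟨ r ⟩) n
≤-subst p r {n = n} m≤ = ≤-trans (eval-mono p m≤) (≤-reflexive (sym (eval-⟨⟩ p r n)))

-- The base is `suc n` because powers of 0 are not monotone in the exponent.
monomial-bound : ∀ p → ∃₂ λ c d → ∀ n → eval p n ≤ c * suc n ^ d
monomial-bound (con a) = a , 0 , λ n → ≤-reflexive (sym (*-identityʳ a))
monomial-bound var     = 1 , 1 , λ n → ≤-trans (n≤1+n n)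
  (≤-reflexive (sym (trans (*-identityˡ _) (*-identityʳ (suc n)))))
monomial-bound (p ⊕ q) with monomial-bound p | monomial-bound q
... | c , d , p≤ | c′ , d′ , q≤ = c + c′ , d + d′ , λ n →
  ≤-trans (+-mono-≤ (≤-trans (p≤ n) (*-monoʳ-≤ c (^-monoʳ-≤ (suc n) (m≤m+n d d′))))
                    (≤-trans (q≤ n) (*-monoʳ-≤ c′ (^-monoʳ-≤ (suc n) (m≤n+m d′ d)))))
          (≤-reflexive (sym (*-distribʳ-+ (suc n ^ (d + d′)) c c′)))
monomial-bound (p ⊗ q) with monomial-bound p | monomial-bound q
... | c , d , p≤ | c′ , d′ , q≤ = c * c′ , d + d′ , λ n →
  ≤-trans (*-mono-≤ (p≤ n) (q≤ n))
    (≤-reflexive (trans (swap c c′ (suc n ^ d) (suc n ^ d′))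
                        (cong (c * c′ *_) (sym (^-distribˡ-+-* (suc n) d d′)))))
  where
  swap : ∀ c c′ x y → c * x * (c′ * y) ≡ c * c′ * (x * y)
  swap = solve-∀

-- For positive n this is n + 1 ≤ 2n; the summand 2^d takes care of n = 0.
suc-power-bound : ∀ n d → suc n ^ d ≤ 2 ^ d * n ^ d + 2 ^ d
suc-power-bound zero    d = ≤-trans (≤-reflexive (^-zeroˡ d))
  (≤-trans (m^n>0 2 d) (m≤n+m (2 ^ d) _))
suc-power-bound (suc n) d = ≤-trans (^-monoˡ-≤ d (s≤s (≤-trans (≤-reflexive (+-comm 1 n)) (+-monoʳ-≤ n (s≤s z≤n)))))
  (≤-trans (≤-reflexive (trans (cong (_^ d) (double n)) (^-distribʳ-* 2 (suc n) d))) (m≤m+n _ _))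
  where
  double : ∀ n → suc (n + suc n) ≡ 2 * suc n
  double = solve-∀
  ^-distribʳ-* : ∀ a b d → (a * b) ^ d ≡ a ^ d * b ^ d
  ^-distribʳ-* a b zero    = refl
  ^-distribʳ-* a b (suc d) = trans (cong (a * b *_) (^-distribʳ-* a b d)) (swap a b (a ^ d) (b ^ d))
    where
    swap : ∀ a b x y → a * b * (x * y) ≡ a * x * (b * y)
    swap = solve-∀

poly-bound : ∀ p → ∃₂ λ c d → ∀ n → eval p n ≤ c * n ^ d + c
poly-bound p with monomial-bound p
... | c , d , p≤ = c * 2 ^ d , d , λ n → ≤-trans (p≤ n)
  (≤-trans (*-monoʳ-≤ c (suc-power-bound n d)) (≤-reflexive (rearrange c (2 ^ d) (n ^ d))))
  where
  rearrange : ∀ c x y → c * (x * y + x) ≡ c * x * y + c * x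
  rearrange = solve-∀

poly-trans : ∀ p r {m n} → m ≤ eval p (eval r n) → m ≤ eval (p ⟨ r ⟩) n
poly-trans p r {n = n} m≤ = ≤-trans m≤ (≤-reflexive (sym (eval-⟨⟩ p r n)))

opaque
  Symbol-finite : ∀ {B k} → Finite (Symbol B k)
  Symbol-finite {B} {k} = proj₁ fin , ↔-trans iso (proj₂ fin)
    where
    fin : Finite (Fin 4 ⊎ (Fin (length B) ⊎ (Fin k ⊎ Fin k)))
    fin = Finite-⊎ Finite-Fin (Finite-⊎ Finite-Fin (Finite-⊎ Finite-Fin Finite-Fin))
    iso : Symbol B k ↔ (Fin 4 ⊎ (Fin (length B) ⊎ (Fin k ⊎ Fin k)))
    iso = mk↔ₛ′
      (λ { one → inj₁ zero ; two → inj₁ (suc zero) ; end → inj₁ (suc (suc zero))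
         ; var → inj₁ (suc (suc (suc zero))) ; (fn f) → inj₂ (inj₁ f)
         ; (□ i) → inj₂ (inj₂ (inj₁ i)) ; (◇ i) → inj₂ (inj₂ (inj₂ i)) })
      (λ { (inj₁ zero) → one ; (inj₁ (suc zero)) → two ; (inj₁ (suc (suc zero))) → end
         ; (inj₁ (suc (suc (suc zero)))) → var ; (inj₂ (inj₁ f)) → fn f
         ; (inj₂ (inj₂ (inj₁ i))) → □ i ; (inj₂ (inj₂ (inj₂ i))) → ◇ i })
      (λ { (inj₁ zero) → refl ; (inj₁ (suc zero)) → refl ; (inj₁ (suc (suc zero))) → refl
         ; (inj₁ (suc (suc (suc zero)))) → refl ; (inj₂ (inj₁ f)) → refl
         ; (inj₂ (inj₂ (inj₁ i))) → refl ; (inj₂ (inj₂ (inj₂ i))) → refl })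
      (λ { one → refl ; two → refl ; end → refl ; var → refl ; (fn f) → refl
         ; (□ i) → refl ; (◇ i) → refl })

module PolyTime (B : Basis) (k : ℕ) where

  Sym : Set
  Sym = Symbol B k

  open TreeCode Sym Symbol-finite one public

  size>0 : ∀ d → 1 ≤ size d
  size>0 (atom a) = s≤s z≤n
  size>0 (d · e)  = s≤s z≤n

  opaque
    unfolding fetchT

    fetchP restoreP restore₂P discardP : Poly
    fetchP    = con 2 ⊕ (con 2 ⊕ (con 7 ⊗ var ⊕ con 1))
    restoreP  = con 4 ⊗ var ⊕ con 1 ⊕ con 1
    restore₂P = con 6 ⊗ var ⊕ con 1 ⊕ con 1
    discardP  = con 2 ⊕ (con 5 ⊗ var ⊕ con 1)

    fetchT≤ : ∀ {m n} → m ≤ n → fetchT m ≤ eval fetchP n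
    fetchT≤ = eval-mono fetchP

    restoreT≤ : ∀ {m n} → m ≤ n → restoreT m ≤ eval restoreP n
    restoreT≤ = eval-mono restoreP

    restore₂T≤ : ∀ {m n} → m ≤ n → restore₂T m ≤ eval restore₂P n
    restore₂T≤ = eval-mono restore₂P

    discardT≤ : ∀ {m n} → m ≤ n → discardT m ≤ eval discardP n
    discardT≤ = eval-mono discardP

  dupP : Poly
  dupP = fetchP ⊕ (restore₂P ⊕ (fetchP ⊕ restoreP))

  dupT≤ : ∀ n → dupT n ≤ eval dupP n
  dupT≤ n = +-mono-≤ (fetchT≤ ≤-refl) (+-mono-≤ (restore₂T≤ ≤-refl)
            (+-mono-≤ (fetchT≤ ≤-refl) (restoreT≤ ≤-refl)))

  -- All claims are restricted to the inputs `inp i`, so that knowledge about the input, such as the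
  -- outcome of a test, can be put into the index type. The bound on the output size is what makes
  -- the running times of compositions polynomial.
  record Comp {I : Set} (inp out : I → D) : Set where
    constructor mkComp
    field
      code    : Fun
      correct : ∀ i → ⟦ code ⟧ (inp i) ≡ out i
      timeP   : Poly
      time≤   : ∀ i → T code (inp i) ≤ eval timeP (size (inp i))
      sizeP   : Poly
      size≤   : ∀ i → size (out i) ≤ eval sizeP (size (inp i))

  open Comp

  module _ {I : Set} {inp : I → D} where

    restrict : ∀ {J out} (h : J → I) → Comp inp out → Comp (λ j → inp (h j)) (λ j → out (h j))
    restrict h c = mkComp (code c) (λ j → correct c (h j)) (timeP c) (λ j → time≤ c (h j))
                          (sizeP c) (λ j → size≤ c (h j))

    convert : ∀ {inp′ out out′} → (∀ i → inp i ≡ inp′ i) → (∀ i → out i ≡ out′ i) →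
              Comp inp out → Comp inp′ out′
    convert inp≗ out≗ c = mkComp (code c)
      (λ i → trans (cong ⟦ code c ⟧ (sym (inp≗ i))) (trans (correct c i) (out≗ i)))
      (timeP c) (λ i → subst (λ d → T (code c) d ≤ eval (timeP c) (size d)) (inp≗ i) (time≤ c i))
      (sizeP c) (λ i → subst₂ (λ d e → size e ≤ eval (sizeP c) (size d)) (inp≗ i) (out≗ i) (size≤ c i))

    idC : Comp inp inp
    idC = mkComp id (λ i → refl) (con 1) (λ i → ≤-refl) var (λ i → ≤-refl)

    compC : ∀ {mid out} → Comp mid out → Comp inp mid → Comp inp out
    compC {mid} g f = mkComp (code g ⊚ code f)
      (λ i → trans (cong ⟦ code g ⟧ (correct f i)) (correct g i))
      (timeP f ⊕ timeP g ⟨ sizeP f ⟩)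
      (λ i → +-mono-≤ (time≤ f i)
        (subst (λ d → T (code g) d ≤ _) (sym (correct f i))
          (≤-trans (time≤ g i) (≤-subst (timeP g) (sizeP f) (size≤ f i)))))
      (sizeP g ⟨ sizeP f ⟩)
      (λ i → ≤-trans (size≤ g i) (≤-subst (sizeP g) (sizeP f) (size≤ f i)))

    constC : (a : Sym) → Comp inp (λ _ → atom a)
    constC a = mkComp (const a) (λ i → refl) (discardP ⊕ con 2) (λ i → +-monoˡ-≤ 2 (discardT≤ ≤-refl))
                      (con 1) (λ i → ≤-refl)

    pairC : ∀ {out₁ out₂} → Comp inp out₁ → Comp inp out₂ → Comp inp (λ i → out₁ i · out₂ i)
    pairC f g = mkComp ⟨ code f , code g ⟩ (λ i → cong₂ _·_ (correct f i) (correct g i))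
      (dupP ⊕ (timeP f ⊕ (fetchP ⟨ sizeP f ⟩ ⊕ (timeP g ⊕ (restoreP ⟨ sizeP f ⟩ ⊕ con 2)))))
      (λ i → let s≤ = ≤-trans (≤-reflexive (cong size (correct f i))) (size≤ f i) in
        +-mono-≤ (dupT≤ (size (inp i))) (+-mono-≤ (time≤ f i) (+-mono-≤ (poly-trans fetchP (sizeP f) (fetchT≤ s≤))
        (+-mono-≤ (time≤ g i) (+-monoˡ-≤ 2 (poly-trans restoreP (sizeP f) (restoreT≤ s≤)))))))
      (con 1 ⊕ (sizeP f ⊕ sizeP g))
      (λ i → s≤s (+-mono-≤ (size≤ f i) (size≤ g i)))

    fstC : ∀ {l r : I → D} → Comp inp (λ i → l i · r i) → Comp inp l
    fstC {l} {r} = compC hdC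
      where
      l≤ : ∀ i → size (l i) ≤ size (l i · r i)
      l≤ i = ≤-trans (m≤m+n (size (l i)) (size (r i))) (n≤1+n _)
      r≤ : ∀ i → size (r i) ≤ size (l i · r i)
      r≤ i = ≤-trans (m≤n+m (size (r i)) (size (l i))) (n≤1+n _)
      hdC : Comp (λ i → l i · r i) l
      hdC = mkComp hd (λ i → refl) (con 1 ⊕ (con 1 ⊕ (fetchP ⊕ (discardP ⊕ restoreP))))
        (λ i → s≤s (s≤s (+-mono-≤ (fetchT≤ (l≤ i))
          (+-mono-≤ (discardT≤ (r≤ i)) (restoreT≤ (l≤ i))))))
        var l≤

    sndC : ∀ {l r : I → D} → Comp inp (λ i → l i · r i) → Comp inp r
    sndC {l} {r} = compC tlC
      where
      tlC : Comp (λ i → l i · r i) r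
      tlC = mkComp tl (λ i → refl) (con 1 ⊕ (con 1 ⊕ discardP))
        (λ i → s≤s (s≤s (discardT≤ (≤-trans (m≤m+n (size (l i)) (size (r i))) (n≤1+n _)))))
        var (λ i → ≤-trans (m≤n+m (size (r i)) (size (l i))) (n≤1+n _))

    caseC : ∀ {test out} p (b : I → Bool) → Comp inp test → (∀ i → p (root (test i)) ≡ b i) →
            Comp {I = Σ I λ i → b i ≡ true}  (λ i → inp (proj₁ i)) (λ i → out (proj₁ i)) →
            Comp {I = Σ I λ i → b i ≡ false} (λ i → inp (proj₁ i)) (λ i → out (proj₁ i)) →
            Comp inp out
    -- `branch` inspects the first component and continues with the second, hence the test value is
    -- paired in front of a copy of the input. The bounds of both branches are added.
    caseC {test} {out} p b t p≗b f g = compC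
      branched (pairC t idC)
      where
      tp sp : Poly
      tp = con 1 ⊕ (con 1 ⊕ (con 1 ⊕ (discardP ⊕ (timeP f ⊕ timeP g))))
      sp = sizeP f ⊕ sizeP g
      n : I → ℕ
      n i = size (test i · inp i)
      inp≤ : ∀ i → size (inp i) ≤ size (test i · inp i)
      inp≤ i = ≤-trans (m≤n+m (size (inp i)) (size (test i))) (n≤1+n _)
      test≤ : ∀ i → size (test i) ≤ size (test i · inp i)
      test≤ i = ≤-trans (m≤m+n (size (test i)) (size (inp i))) (n≤1+n _)
      sound : ∀ i → ⟦ branch p (code f) (code g) ⟧ (test i · inp i) ≡ out i
      sound i = trans (cong (λ x → if x then ⟦ code f ⟧ (inp i) else ⟦ code g ⟧ (inp i)) (p≗b i)) (go (b i) refl)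
        where
        go : ∀ x → b i ≡ x → (if x then ⟦ code f ⟧ (inp i) else ⟦ code g ⟧ (inp i)) ≡ out i
        go true  eq = correct f (i , eq)
        go false eq = correct g (i , eq)
      time : ∀ i → T (branch p (code f) (code g)) (test i · inp i) ≤ eval tp (size (test i · inp i))
      time i = s≤s (s≤s (s≤s (+-mono-≤ (discardT≤ (test≤ i))
        (≤-trans (≤-reflexive (cong (λ x → if x then T (code f) (inp i) else T (code g) (inp i)) (p≗b i)))
                 (go (b i) refl)))))
        where
        go : ∀ x → b i ≡ x → (if x then T (code f) (inp i) else T (code g) (inp i)) ≤
             eval (timeP f) (n i) + eval (timeP g) (n i)
        go true  eq = ≤-trans (≤-trans (time≤ f (i , eq)) (eval-mono (timeP f) (inp≤ i)))
                              (m≤m+n (eval (timeP f) (n i)) (eval (timeP g) (n i)))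
        go false eq = ≤-trans (≤-trans (time≤ g (i , eq)) (eval-mono (timeP g) (inp≤ i)))
                              (m≤n+m (eval (timeP g) (n i)) (eval (timeP f) (n i)))
      sz : ∀ i → size (out i) ≤ eval sp (size (test i · inp i))
      sz i = go (b i) refl
        where
        go : ∀ x → b i ≡ x → size (out i) ≤ eval sp (n i)
        go true  eq = ≤-trans (≤-trans (size≤ f (i , eq)) (eval-mono (sizeP f) (inp≤ i)))
                              (m≤m+n (eval (sizeP f) (n i)) (eval (sizeP g) (n i)))
        go false eq = ≤-trans (≤-trans (size≤ g (i , eq)) (eval-mono (sizeP g) (inp≤ i)))
                              (m≤n+m (eval (sizeP g) (n i)) (eval (sizeP f) (n i)))
      branched : Comp (λ i → test i · inp i) out
      branched = mkComp (branch p (code f) (code g)) sound tp time sp sz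

  -- A calculus of polynomial-time functions on encoded data

  record Enc (A : Set) : Set where
    field
      ⌜_⌝ : A → D

  open Enc {{...}} public

  isTwo : Sym → Bool
  isTwo two = true
  isTwo _   = false

  instance
    Enc-Sym : Enc Sym
    Enc-Sym = record { ⌜_⌝ = atom }

    Enc-Bool : Enc Bool
    Enc-Bool = record { ⌜_⌝ = λ b → atom (if b then two else one) }

    Enc-× : ∀ {A B} → {{Enc A}} → {{Enc B}} → Enc (A × B)
    Enc-× = record { ⌜_⌝ = λ ab → ⌜ proj₁ ab ⌝ · ⌜ proj₂ ab ⌝ }

    -- Coincides on strings with `encodeList`, whose end marker is also `one`, so the list built by
    -- the machine is already the encoding of its input.
    Enc-List : ∀ {A} → {{Enc A}} → Enc (List A)
    Enc-List = record { ⌜_⌝ = foldr (λ a d → ⌜ a ⌝ · d) (atom one) }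

    Enc-Maybe : ∀ {A} → {{Enc A}} → Enc (Maybe A)
    Enc-Maybe = record { ⌜_⌝ = λ { nothing → atom one ; (just a) → atom one · ⌜ a ⌝ } }

  ⟪_⟫ : ∀ {A} → {{Enc A}} → A → ℕ
  ⟪ a ⟫ = size ⌜ a ⌝

  record PF {A B : Set} {{_ : Enc A}} {{_ : Enc B}} (f : A → B) : Set where
    constructor mkPF
    field
      comp : Comp ⌜_⌝ (λ a → ⌜ f a ⌝)

    bound : Poly
    bound = sizeP comp

    bounded : ∀ a → ⟪ f a ⟫ ≤ eval bound ⟪ a ⟫
    bounded = size≤ comp

  open PF public

  module _ {A B : Set} {{_ : Enc A}} {{_ : Enc B}} where

    extP : {f g : A → B} → (∀ a → f a ≡ g a) → PF f → PF g
    extP f≗g (mkPF c) = mkPF (convert (λ _ → refl) (λ a → cong ⌜_⌝ (f≗g a)) c)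

    fstP : PF {A × B} proj₁
    fstP = mkPF (fstC idC)

    sndP : PF {A × B} proj₂
    sndP = mkPF (sndC idC)

    constP : (b : B) → PF {A} (λ _ → b)
    constP b = mkPF (go ⌜ b ⌝)
      where
      go : ∀ d → Comp {A} ⌜_⌝ (λ _ → d)
      go (atom a) = constC a
      go (d · e)  = pairC (go d) (go e)

  idP : ∀ {A} {{_ : Enc A}} → PF {A} (λ a → a)
  idP = mkPF idC

  module _ {E : Set} {{_ : Enc E}} where

    infixr 9 _∘P_
    infixr 4 _,P_
    infixr 5 _∷P_

    -- The combinators work over a common environment `E`; compositions of `fstP` and `sndP` play
    -- the role of variables.
    _∘P_ : ∀ {A B} {{_ : Enc A}} {{_ : Enc B}} {g : A → B} {f : E → A} →
           PF g → PF f → PF (λ ρ → g (f ρ))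
    _∘P_ {f = f} (mkPF g) (mkPF c) = mkPF (compC (restrict f g) c)

    _,P_ : ∀ {A B} {{_ : Enc A}} {{_ : Enc B}} {f : E → A} {g : E → B} →
           PF f → PF g → PF (λ ρ → f ρ , g ρ)
    mkPF f ,P mkPF g = mkPF (pairC f g)

    _∷P_ : ∀ {A} {{_ : Enc A}} {f : E → A} {g : E → List A} →
           PF f → PF g → PF (λ ρ → f ρ ∷ g ρ)
    mkPF f ∷P mkPF g = mkPF (pairC f g)

    justP : ∀ {A} {{_ : Enc A}} {f : E → A} → PF f → PF (λ ρ → just (f ρ))
    justP (mkPF f) = mkPF (pairC (constC one) f)

    ifP : ∀ {A} {{_ : Enc A}} {b : E → Bool} {f g : E → A} →
          PF b → PF f → PF g → PF (λ ρ → if b ρ then f ρ else g ρ)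
    ifP {b = b} {f} {g} (mkPF c) (mkPF cf) (mkPF cg) = mkPF (caseC (maybe′ isTwo false) b c (λ ρ → is-b (b ρ))
      (convert (λ _ → refl) (λ { (ρ , eq) → sym (cong (λ x → ⌜ if x then f ρ else g ρ ⌝) eq) }) (restrict proj₁ cf))
      (convert (λ _ → refl) (λ { (ρ , eq) → sym (cong (λ x → ⌜ if x then f ρ else g ρ ⌝) eq) }) (restrict proj₁ cg)))
      where
      is-b : ∀ x → isTwo (if x then two else one) ≡ x
      is-b true  = refl
      is-b false = refl

    listP : ∀ {A B} {{_ : Enc A}} {{_ : Enc B}} {xs : E → List A} {n : E → B} {c : E × A × List A → B} →
            PF xs → PF n → PF c → PF (λ ρ → caseList (n ρ) (λ y ys → c (ρ , y , ys)) (xs ρ))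
    listP {A} {B} {xs = xs} {n} {c} (mkPF cx) (mkPF cn) (mkPF cc) =
      mkPF (caseC (maybe′ (λ _ → true) false) (λ ρ → null (xs ρ)) cx (λ ρ → root-null (xs ρ))
        (convert (λ _ → refl) (λ { (ρ , eq) → on-nil ρ eq }) (restrict proj₁ cn))
        (compC (convert on-arg on-cons (restrict arg cc)) (pairC idC (restrict proj₁ cx))))
      where
      null : List A → Bool
      null []      = true
      null (_ ∷ _) = false
      root-null : ∀ l → maybe′ (λ _ → true) false (root ⌜ l ⌝) ≡ null l
      root-null []      = refl
      root-null (_ ∷ _) = refl
      result : E → B
      result ρ = caseList (n ρ) (λ y ys → c (ρ , y , ys)) (xs ρ)
      on-nil : ∀ ρ → null (xs ρ) ≡ true → ⌜ n ρ ⌝ ≡ ⌜ result ρ ⌝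
      on-nil ρ eq with xs ρ
      ... | [] = refl
      split : ∀ l → null l ≡ false → A × List A
      split (y ∷ ys) _ = y , ys
      split-⌜⌝ : ∀ l eq → ⌜ split l eq ⌝ ≡ ⌜ l ⌝
      split-⌜⌝ (y ∷ ys) _ = refl
      arg : (Σ E λ ρ → null (xs ρ) ≡ false) → E × A × List A
      arg (ρ , eq) = ρ , split (xs ρ) eq
      on-arg : ∀ i → ⌜ arg i ⌝ ≡ ⌜ proj₁ i ⌝ · ⌜ xs (proj₁ i) ⌝
      on-arg (ρ , eq) = cong (⌜ ρ ⌝ ·_) (split-⌜⌝ (xs ρ) eq)
      on-cons : ∀ i → ⌜ c (arg i) ⌝ ≡ ⌜ result (proj₁ i) ⌝
      on-cons (ρ , eq) = go (xs ρ) eq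
        where
        go : ∀ l eq → ⌜ c (ρ , split l eq) ⌝ ≡ ⌜ caseList (n ρ) (λ y ys → c (ρ , y , ys)) l ⌝
        go (y ∷ ys) _ = refl

    maybeP : ∀ {A B} {{_ : Enc A}} {{_ : Enc B}} {x : E → Maybe A} {n : E → B} {c : E × A → B} →
             PF x → PF n → PF c → PF (λ ρ → caseMaybe (n ρ) (λ y → c (ρ , y)) (x ρ))
    maybeP {A} {B} {x = x} {n} {c} (mkPF cx) (mkPF cn) (mkPF cc) =
      mkPF (caseC (maybe′ (λ _ → true) false) (λ ρ → null (x ρ)) cx (λ ρ → root-null (x ρ))
        (convert (λ _ → refl) (λ { (ρ , eq) → on-nil ρ eq }) (restrict proj₁ cn))
        (compC (convert (λ _ → refl) on-cons (restrict arg cc))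
               (pairC idC (sndC (convert (λ _ → refl) on-arg (restrict proj₁ cx))))))
      where
      null : Maybe A → Bool
      null nothing  = true
      null (just _) = false
      root-null : ∀ l → maybe′ (λ _ → true) false (root ⌜ l ⌝) ≡ null l
      root-null nothing  = refl
      root-null (just _) = refl
      result : E → B
      result ρ = caseMaybe (n ρ) (λ y → c (ρ , y)) (x ρ)
      on-nil : ∀ ρ → null (x ρ) ≡ true → ⌜ n ρ ⌝ ≡ ⌜ result ρ ⌝
      on-nil ρ eq with x ρ
      ... | nothing = refl
      get : ∀ l → null l ≡ false → A
      get (just y) _ = y
      arg : (Σ E λ ρ → null (x ρ) ≡ false) → E × A
      arg (ρ , eq) = ρ , get (x ρ) eq
      on-arg : ∀ i → ⌜ x (proj₁ i) ⌝ ≡ atom one · ⌜ proj₂ (arg i) ⌝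
      on-arg (ρ , eq) = go (x ρ) eq
        where
        go : ∀ l eq → ⌜ l ⌝ ≡ atom one · ⌜ get l eq ⌝
        go (just y) _ = refl
      on-cons : ∀ i → ⌜ c (arg i) ⌝ ≡ ⌜ result (proj₁ i) ⌝
      on-cons (ρ , eq) = go (x ρ) eq
        where
        go : ∀ l eq → ⌜ c (ρ , get l eq) ⌝ ≡ ⌜ caseMaybe (n ρ) (λ y → c (ρ , y)) l ⌝
        go (just y) _ = refl

    testP : (p : Sym → Bool) {a : E → Sym} → PF a → PF (λ ρ → p (a ρ))
    testP p {a} (mkPF ca) = mkPF (caseC (maybe′ p false) (λ ρ → p (a ρ)) ca (λ _ → refl)
      (convert (λ _ → refl) (λ { (ρ , eq) → sym (cong ⌜_⌝ eq) }) (constC two))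
      (convert (λ _ → refl) (λ { (ρ , eq) → sym (cong ⌜_⌝ eq) }) (constC one)))

  open Inverse (proj₂ (Symbol-finite {B} {k})) using (to; from; strictlyInverseʳ)

  infix 4 _==_

  _==_ : Sym → Sym → Bool
  a == b = does (to a Fin.≟ to b)

  ==-refl : ∀ a → (a == a) ≡ true
  ==-refl a = dec-true (to a Fin.≟ to a) refl

  ==⇒≡ : ∀ a b → (a == b) ≡ true → a ≡ b
  ==⇒≡ a b eq with to a Fin.≟ to b
  ... | yes p = trans (sym (strictlyInverseʳ a)) (trans (cong from p) (strictlyInverseʳ b))

  symbols : List Sym
  symbols = List.map from (List.allFin (proj₁ (Symbol-finite {B} {k})))

  ∈-symbols : ∀ a → a ∈ symbols
  ∈-symbols a = subst (_∈ symbols) (strictlyInverseʳ a) (∈-map⁺ from (∈-allFin (to a)))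

  switchP : ∀ {X Y} {{_ : Enc X}} {{_ : Enc Y}} {g : Sym → X → Y} →
            (∀ a → PF (g a)) → PF (λ (ax : Sym × X) → g (proj₁ ax) (proj₂ ax))
  switchP {X} {Y} {g} gP = extP (λ ax → select-∈ ax symbols (∈-symbols (proj₁ ax))) (selectP symbols)
    where
    select : List Sym → Sym × X → Y
    -- An arbitrary default: `symbols` contains every symbol, so the search never runs out.
    select []       ax = g one (proj₂ ax)
    select (b ∷ bs) ax = if proj₁ ax == b then g b (proj₂ ax) else select bs ax
    selectP : ∀ bs → PF (select bs)
    selectP []       = gP one ∘P sndP
    selectP (b ∷ bs) = ifP (testP (_== b) fstP) (gP b ∘P sndP) (selectP bs)
    select-∈ : ∀ ax bs → proj₁ ax ∈ bs → select bs ax ≡ g (proj₁ ax) (proj₂ ax)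
    select-∈ (a , x) (b ∷ bs) a∈ with a == b in eq
    select-∈ (a , x) (b ∷ bs) a∈         | true  rewrite ==⇒≡ a b eq = refl
    select-∈ (a , x) (b ∷ bs) (there a∈) | false = select-∈ (a , x) bs a∈
    select-∈ (a , x) (b ∷ bs) (here refl) | false = contradiction (trans (sym eq) (==-refl b)) λ ()

  length≤size : ∀ {A} {{_ : Enc A}} (xs : List A) → length xs ≤ ⟪ xs ⟫
  length≤size []       = z≤n
  length≤size (x ∷ xs) = s≤s (≤-trans (length≤size xs) (m≤n+m _ _))

  size-prefix : ∀ {A} {{_ : Enc A}} (xs ys : List A) → ⟪ xs ⟫ ≤ ⟪ xs ++ ys ⟫
  size-prefix []       ys = size>0 ⌜ ys ⌝
  size-prefix (x ∷ xs) ys = s≤s (+-monoʳ-≤ ⟪ x ⟫ (size-prefix xs ys))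

  module _ {A St : Set} {{_ : Enc A}} {{_ : Enc St}} {f : A × St → St} (step : PF f) where

    private
      stepC = comp step
      F : D → D
      F = ⟦ Comp.code stepC ⟧
      g : St → A → St
      g s a = f (a , s)

    iter-correct : ∀ xs s → iter F ⌜ xs ⌝ ⌜ s ⌝ ≡ ⌜ foldl g s xs ⌝
    iter-correct []       s = refl
    iter-correct (x ∷ xs) s =
      trans (cong (iter F ⌜ xs ⌝) (Comp.correct stepC (x , s))) (iter-correct xs (f (x , s)))

    -- N bounds the list and Q the intermediate states.
    iterationP : Poly → Poly → Poly
    iterationP N Q = con 1 ⊕ ((con 1 ⊕ (fetchP ⟨ N ⟩ ⊕ (restoreP ⟨ N ⟩ ⊕ (con 2 ⊕ Comp.timeP stepC ⟨ con 1 ⊕ (N ⊕ Q) ⟩)))))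

    -- Iterating the size bound of the step alone would compound to an exponential one. The sizes of
    -- the states after all prefixes are therefore a hypothesis, and the cost is then at most the
    -- number of rounds times the cost of one round on states of size `Q`.
    iterT-bound : ∀ N Q m xs s → ⟪ xs ⟫ ≤ eval N m →
      (∀ ys zs → xs ≡ ys ++ zs → ⟪ foldl g s ys ⟫ ≤ eval Q m) →
      iterT F (T (Comp.code stepC)) ⌜ xs ⌝ ⌜ s ⌝ ≤ length xs * eval (iterationP N Q) m + 1
    iterT-bound N Q m []       s xs≤ s≤ = ≤-refl
    iterT-bound N Q m (x ∷ xs) s xs≤ bnd =
      ≤-trans (+-mono-≤ head≤ (subst (λ d → iterT F (T (Comp.code stepC)) ⌜ xs ⌝ d ≤ _)
                                    (sym (Comp.correct stepC (x , s))) tail≤))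
              (≤-reflexive (sym (+-assoc (eval (iterationP N Q) m) (length xs * eval (iterationP N Q) m) 1)))
      where
      x≤ : ⟪ x ⟫ ≤ eval N m
      x≤ = ≤-trans (≤-trans (m≤m+n ⟪ x ⟫ ⟪ xs ⟫) (n≤1+n _)) xs≤
      head≤ : suc (1 + (fetchT ⟪ x ⟫ + (restoreT ⟪ x ⟫ + (2 + T (Comp.code stepC) ⌜ x , s ⌝)))) ≤ eval (iterationP N Q) m
      head≤ = s≤s (s≤s (+-mono-≤ (poly-trans fetchP N (fetchT≤ x≤)) (+-mono-≤ (poly-trans restoreP N (restoreT≤ x≤))
        (+-monoʳ-≤ 2 (≤-trans (Comp.time≤ stepC (x , s))
          (≤-subst (Comp.timeP stepC) (con 1 ⊕ (N ⊕ Q)) (s≤s (+-mono-≤ x≤ (bnd [] (x ∷ xs) refl)))))))))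
      tail≤ : iterT F (T (Comp.code stepC)) ⌜ xs ⌝ ⌜ f (x , s) ⌝ ≤ length xs * eval (iterationP N Q) m + 1
      tail≤ = iterT-bound N Q m xs (f (x , s)) (≤-trans (≤-trans (m≤n+m ⟪ xs ⟫ ⟪ x ⟫) (n≤1+n _)) xs≤)
                          (λ ys zs eq → bnd (x ∷ ys) zs (cong (x ∷_) eq))

    foldC : ∀ {I : Set} (xs : I → List A) (s : I → St) (Q : Poly) →
            (∀ i ys zs → xs i ≡ ys ++ zs → ⟪ foldl g (s i) ys ⟫ ≤ eval Q ⟪ (xs i , s i) ⟫) →
            Comp (λ i → ⌜ xs i , s i ⌝) (λ i → ⌜ foldl g (s i) (xs i) ⌝)
    foldC xs s Q bnd = mkComp (fold (Comp.code stepC)) (λ i → iter-correct (xs i) (s i))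
      (con 1 ⊕ (con 1 ⊕ (fetchP ⊕ (restoreP ⊕ (var ⊗ iterationP var Q ⊕ con 1 ⊕ con 1)))))
      (λ i → let m = ⟪ (xs i , s i) ⟫
                 xs≤ : ⟪ xs i ⟫ ≤ m
                 xs≤ = ≤-trans (m≤m+n ⟪ xs i ⟫ ⟪ s i ⟫) (n≤1+n _)
             in s≤s (s≤s (+-mono-≤ (fetchT≤ xs≤) (+-mono-≤ (restoreT≤ xs≤) (+-monoˡ-≤ 1
                  (≤-trans (iterT-bound var Q m (xs i) (s i) xs≤ (bnd i))
                    (+-monoˡ-≤ 1 (*-monoˡ-≤ (eval (iterationP var Q) m) (≤-trans (length≤size (xs i)) xs≤)))))))))
      Q (λ i → bnd i (xs i) [] (sym (++-identityʳ (xs i))))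

  module _ {E A St : Set} {{_ : Enc E}} {{_ : Enc A}} {{_ : Enc St}} where

    foldlP : {f : E × A × St → St} {xs : E → List A} {s : E → St} →
             PF f → PF xs → PF s → (Q : Poly) →
             (∀ ρ ys zs → xs ρ ≡ ys ++ zs → ⟪ foldl (λ s a → f (ρ , a , s)) (s ρ) ys ⟫ ≤ eval Q ⟪ ρ ⟫) →
             PF (λ ρ → foldl (λ s a → f (ρ , a , s)) (s ρ) (xs ρ))
    foldlP {f} {xs} {s} fP xsP sP Q bnd = mkPF (sndC {l = λ ρ → ⌜ ρ ⌝}
      (convert (λ _ → refl) (λ ρ → cong ⌜_⌝ (carry ρ (s ρ) (xs ρ)))
        (compC (foldC stepP xs (λ ρ → ρ , s ρ) Q′ bnd′)
               (comp (xsP ,P (idP ,P sP))))))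
      where
      -- A program has no free variables, so the environment travels with the state.
      step : A × (E × St) → E × St
      step (a , ρ , s) = ρ , f (ρ , a , s)
      stepP : PF step
      stepP = (fstP ∘P sndP) ,P (fP ∘P ((fstP ∘P sndP) ,P (fstP ,P (sndP ∘P sndP))))
      carry : ∀ ρ s xs → foldl (λ ρs a → step (a , ρs)) (ρ , s) xs ≡ (ρ , foldl (λ s a → f (ρ , a , s)) s xs)
      carry ρ s []       = refl
      carry ρ s (x ∷ xs) = carry ρ (f (ρ , x , s)) xs
      Q′ : Poly
      Q′ = con 1 ⊕ (var ⊕ Q)
      bnd′ : ∀ ρ ys zs → xs ρ ≡ ys ++ zs →
             ⟪ foldl (λ ρs a → step (a , ρs)) (ρ , s ρ) ys ⟫ ≤ eval Q′ ⟪ (xs ρ , ρ , s ρ) ⟫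
      bnd′ ρ ys zs eq = ≤-trans (≤-reflexive (cong ⟪_⟫ (carry ρ (s ρ) ys)))
        (s≤s (+-mono-≤ ρ≤ (≤-trans (bnd ρ ys zs eq) (eval-mono Q ρ≤))))
        where
        ρ≤ : ⟪ ρ ⟫ ≤ ⟪ (xs ρ , ρ , s ρ) ⟫
        ρ≤ = ≤-trans (≤-trans (≤-trans (m≤m+n ⟪ ρ ⟫ ⟪ s ρ ⟫) (n≤1+n _)) (m≤n+m ⟪ (ρ , s ρ) ⟫ ⟪ xs ρ ⟫)) (n≤1+n _)

    -- The increase depends on the environment and the element but not on the state, so the
    -- increases add up along the list instead of compounding.
    Grows : (E × A × St → St) → Poly → Set
    Grows f G = ∀ ρ a s → ⟪ f (ρ , a , s) ⟫ ≤ eval G (⟪ ρ ⟫ + ⟪ a ⟫) + ⟪ s ⟫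

    grows-foldl : ∀ {f} G → Grows f G → ∀ ρ ys s →
      ⟪ foldl (λ s a → f (ρ , a , s)) s ys ⟫ ≤ ⟪ ys ⟫ * eval G (⟪ ρ ⟫ + ⟪ ys ⟫) + ⟪ s ⟫
    grows-foldl {f} G grows ρ []       s = m≤n+m ⟪ s ⟫ _
    grows-foldl {f} G grows ρ (y ∷ ys) s = begin
      ⟪ foldl (λ s a → f (ρ , a , s)) (f (ρ , y , s)) ys ⟫
        ≤⟨ grows-foldl {f} G grows ρ ys (f (ρ , y , s)) ⟩
      ⟪ ys ⟫ * eval G (⟪ ρ ⟫ + ⟪ ys ⟫) + ⟪ f (ρ , y , s) ⟫
        ≤⟨ +-mono-≤ (*-monoʳ-≤ ⟪ ys ⟫ (eval-mono G (+-monoʳ-≤ ⟪ ρ ⟫ ys≤)))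
                    (≤-trans (grows ρ y s) (+-monoˡ-≤ ⟪ s ⟫ (eval-mono G (+-monoʳ-≤ ⟪ ρ ⟫ y≤)))) ⟩
      ⟪ ys ⟫ * b + (b + ⟪ s ⟫)
        ≡⟨ rearrange ⟪ ys ⟫ b ⟪ s ⟫ ⟩
      suc ⟪ ys ⟫ * b + ⟪ s ⟫
        ≤⟨ +-monoˡ-≤ ⟪ s ⟫ (*-monoˡ-≤ b (s≤s (m≤n+m ⟪ ys ⟫ ⟪ y ⟫))) ⟩
      ⟪ y ∷ ys ⟫ * b + ⟪ s ⟫ ∎
      where
      open ≤-Reasoning
      b = eval G (⟪ ρ ⟫ + ⟪ y ∷ ys ⟫)
      y≤ : ⟪ y ⟫ ≤ ⟪ y ∷ ys ⟫
      y≤ = ≤-trans (m≤m+n ⟪ y ⟫ ⟪ ys ⟫) (n≤1+n _)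
      ys≤ : ⟪ ys ⟫ ≤ ⟪ y ∷ ys ⟫
      ys≤ = ≤-trans (m≤n+m ⟪ ys ⟫ ⟪ y ⟫) (n≤1+n _)
      rearrange : ∀ a b c → a * b + (b + c) ≡ suc a * b + c
      rearrange = solve-∀

    foldl⁺P : {f : E × A × St → St} {xs : E → List A} {s : E → St} →
              PF f → PF xs → PF s → (G : Poly) → Grows f G →
              PF (λ ρ → foldl (λ s a → f (ρ , a , s)) (s ρ) (xs ρ))
    foldl⁺P {f} {xs} {s} fP xsP sP G grows =
      foldlP fP xsP sP (bound xsP ⊗ G ⟨ var ⊕ bound xsP ⟩ ⊕ bound sP) bnd
      where
      bnd : ∀ ρ ys zs → xs ρ ≡ ys ++ zs → ⟪ foldl (λ s a → f (ρ , a , s)) (s ρ) ys ⟫ ≤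
            eval (bound xsP) ⟪ ρ ⟫ * eval (G ⟨ var ⊕ bound xsP ⟩) ⟪ ρ ⟫ + eval (bound sP) ⟪ ρ ⟫
      bnd ρ ys zs eq = ≤-trans (grows-foldl {f} G grows ρ ys (s ρ))
        (+-mono-≤ (*-mono-≤ ys≤ (≤-subst G (var ⊕ bound xsP) (+-monoʳ-≤ ⟪ ρ ⟫ ys≤))) (bounded sP ρ))
        where
        ys≤ : ⟪ ys ⟫ ≤ eval (bound xsP) ⟪ ρ ⟫
        ys≤ = ≤-trans (size-prefix ys zs) (≤-trans (≤-reflexive (cong ⟪_⟫ (sym eq))) (bounded xsP ρ))

  module _ {E A : Set} {{_ : Enc E}} {{_ : Enc A}} where

    ʳ++P : {xs ys : E → List A} → PF xs → PF ys → PF (λ ρ → xs ρ ʳ++ ys ρ)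
    ʳ++P {xs} {ys} xsP ysP = extP (λ ρ → go (xs ρ) (ys ρ))
      (foldl⁺P {f = λ (_ , a , s) → a ∷ s} ((fstP ∘P sndP) ∷P (sndP ∘P sndP)) xsP ysP
        (con 1 ⊕ var) (λ ρ a s → s≤s (+-monoˡ-≤ ⟪ s ⟫ (m≤n+m ⟪ a ⟫ ⟪ ρ ⟫))))
      where
      go : ∀ (xs ys : List A) → foldl (λ s a → a ∷ s) ys xs ≡ xs ʳ++ ys
      go []       ys = refl
      go (x ∷ xs) ys = go xs (x ∷ ys)

    reverseP : {xs : E → List A} → PF xs → PF (λ ρ → reverse (xs ρ))
    reverseP xsP = ʳ++P xsP (constP [])

  foldr-reverse : ∀ {A St : Set} (h : A → St → St) s xs →
                  foldl (λ s a → h a s) s (reverse xs) ≡ foldr h s xs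
  foldr-reverse h s []       = refl
  foldr-reverse h s (x ∷ xs) = trans (cong (foldl _ s) (List-reverse x xs))
    (trans (foldl-++ _ s (reverse xs) (x ∷ [])) (cong (h x) (foldr-reverse h s xs)))
    where
    List-reverse : ∀ {A : Set} (x : A) xs → reverse (x ∷ xs) ≡ reverse xs ++ x ∷ []
    List-reverse x xs = unfold-reverse x xs

  module _ {E A St : Set} {{_ : Enc E}} {{_ : Enc A}} {{_ : Enc St}} where

    foldrP : {f : E × A × St → St} {xs : E → List A} {s : E → St} →
             PF f → PF xs → PF s → (G : Poly) → Grows f G →
             PF (λ ρ → foldr (λ a s → f (ρ , a , s)) (s ρ) (xs ρ))
    foldrP {f} {xs} {s} fP xsP sP G grows =
      extP (λ ρ → foldr-reverse (λ a s → f (ρ , a , s)) (s ρ) (xs ρ))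
           (foldl⁺P fP (reverseP xsP) sP G grows)

  module _ {E A : Set} {{_ : Enc E}} {{_ : Enc A}} where

    ++P : {xs ys : E → List A} → PF xs → PF ys → PF (λ ρ → xs ρ ++ ys ρ)
    ++P {xs} {ys} xsP ysP = extP (λ ρ → go (xs ρ) (ys ρ))
      (foldrP {f = λ (_ , a , s) → a ∷ s} ((fstP ∘P sndP) ∷P (sndP ∘P sndP)) xsP ysP
        (con 1 ⊕ var) (λ ρ a s → s≤s (+-monoˡ-≤ ⟪ s ⟫ (m≤n+m ⟪ a ⟫ ⟪ ρ ⟫))))
      where
      go : ∀ (xs ys : List A) → foldr _∷_ ys xs ≡ xs ++ ys
      go []       ys = refl
      go (x ∷ xs) ys = cong (x ∷_) (go xs ys)

-- Linear algebra over GF(2)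

-- Missing coordinates count as 0, so a vector keeps its meaning when later atoms prolong the
-- assignment.
dot : List Bool → List Bool → Bool
dot []      _       = false
dot (b ∷ v) []      = false
dot (b ∷ v) (a ∷ as) = (b ∧ a) xor dot v as

xor-interchange : ∀ a b c d → (a xor b) xor (c xor d) ≡ (a xor c) xor (b xor d)
xor-interchange a b c d = trans (xor-assoc a b (c xor d)) (trans (cong (a xor_)
  (trans (sym (xor-assoc b c d)) (trans (cong (_xor d) (xor-comm b c)) (xor-assoc c b d))))
  (sym (xor-assoc a c (b xor d))))

dot-++ : ∀ v as bs → length v ≤ length as → dot v (as ++ bs) ≡ dot v as
dot-++ []      as       bs p       = refl
dot-++ (b ∷ v) (a ∷ as) bs (s≤s p) = cong ((b ∧ a) xor_) (dot-++ v as bs p)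

xor-true-≢ : ∀ {a b} → a xor b ≡ true → a ≢ b
xor-true-≢ {true}  {true}  ()
xor-true-≢ {false} {false} ()
xor-true-≢ {true}  {false} _ ()
xor-true-≢ {false} {true}  _ ()

xor-false-≡ : ∀ {a b} → a xor b ≡ false → a ≡ b
xor-false-≡ {true}  {true}  _ = refl
xor-false-≡ {false} {false} _ = refl

parity : List Bool → Bool
parity = foldr _xor_ false

module Decision (B : Basis) (linear : All L B) (𝓕 : FrameClass) (k : ℕ) where

  open PolyTime B k public

  Bits : Set
  Bits = List Bool

  -- The decision procedure

  xorV : Bits → Bits → Bits
  xorV []       ys       = ys
  xorV (x ∷ xs) []       = x ∷ xs
  xorV (x ∷ xs) (y ∷ ys) = (x xor y) ∷ xorV xs ys

  xorV-identityʳ : ∀ xs → xorV xs [] ≡ xs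
  xorV-identityʳ []       = refl
  xorV-identityʳ (x ∷ xs) = refl

  neg : Bits → Bits
  neg v = xorV (true ∷ []) v

  isZero : Bits → Bool
  isZero = foldr (λ b s → if b then false else s) true

  -- Equality up to trailing zeros, that is, equality as linear forms.
  same : Bits → Bits → Bool
  same x y = isZero (xorV x y)

  -- Positions are counted in the bijective base-2 numeration of the input,
  -- with false for the digit one and true for the digit two.
  inc : Bits → Bits
  inc []           = false ∷ []
  inc (false ∷ xs) = true ∷ xs
  inc (true ∷ xs)  = false ∷ inc xs

  -- The final true makes names insensitive to the padding in xorV.
  terminate : Bits → Bits
  terminate xs = xs ++ true ∷ []

  -- The list contains the names of the sources, except for a variable, where it contains the index
  -- of that variable. An entry adds the name of the gate itself.
  RawGate Entry : Set
  RawGate = Sym × List Bits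
  Entry   = Bits × RawGate

  -- `Values` assigns vectors to names of gates. `Dict` assigns unit vectors to the keys of atoms:
  -- `var` with the name of a variable, or `◇ i` with the vector of ψ.
  Values Dict State : Set
  Values = List (Bits × Bits)
  Dict   = List ((Sym × Bits) × Bits)
  State  = Values × Dict

  find : Bits → Values → Maybe Bits
  find x = foldr (λ e s → if same x (proj₁ e) then just (proj₂ e) else s) nothing

  findKey : Sym × Bits → Dict → Maybe Bits
  findKey κ = foldr (λ e s → if proj₁ κ == proj₁ (proj₁ e)
                             then (if same (proj₂ κ) (proj₂ (proj₁ e)) then just (proj₂ e) else s)
                             else s) nothing

  cons? : Maybe Bits → Maybe (List Bits) → Maybe (List Bits)
  cons? v vs = caseMaybe nothing (λ ws → caseMaybe nothing (λ w → just (w ∷ ws)) v) vs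

  sources : List Bits → Values → Maybe (List Bits)
  sources xs R = foldr (λ x s → cons? (find x R) s) (just []) xs

  isVar : Sym → Bool
  isVar var = true
  isVar _   = false

  arguments : RawGate → Values → Maybe (List Bits)
  arguments g R = if isVar (proj₁ g) then just (proj₂ g) else sources (proj₂ g) R

  -- The unit vector of the latest atom, shifted by one place; the earliest atom gets the second
  -- coordinate because the first belongs to the constant 1.
  fresh : Dict → Bits
  fresh = caseList (false ∷ true ∷ []) (λ e _ → false ∷ proj₂ e)

  intern : Sym × Bits → Dict → Bits × Dict
  intern κ D = caseMaybe (fresh D , (κ , fresh D) ∷ D) (λ u → u , D) (findKey κ D)

  modal : FrameClass → Fin k → Bits → Dict → Bits × Dict
  modal K  i v D = if isZero v then ([] , D) else intern (◇ i , v) D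
  modal KD i v D =
    if isZero v then ([] , D) else (if isZero (neg v) then (true ∷ [] , D) else intern (◇ i , v) D)

  nth : ℕ → List Bits → Bits
  nth zero    = caseList [] (λ v _ → v)
  nth (suc n) = caseList [] (λ _ vs → nth n vs)

  combine : ∀ {n} → Bool → List (Fin n) → List Bits → Bits
  combine c []       vs = c ∷ []
  combine c (i ∷ is) vs = xorV (nth (toℕ i) vs) (combine c is vs)

  linearity : ∀ f → L (List.lookup B f)
  linearity f = go B linear f
    where
    go : ∀ B → All L B → ∀ f → L (List.lookup B f)
    go (f ∷ fs) (l ∷ ls) zero    = l
    go (f ∷ fs) (l ∷ ls) (suc i) = go fs ls i

  compute : Sym → List Bits → Dict → Bits × Dict
  compute var    vs D = intern (var , nth 0 vs) D
  compute (fn f) vs D = combine (proj₁ (linearity f)) (proj₁ (proj₂ (linearity f))) vs , D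
  compute (◇ i)  vs D = modal 𝓕 i (nth 0 vs) D
  compute (□ i)  vs D = neg (proj₁ (modal 𝓕 i (neg (nth 0 vs)) D)) , proj₂ (modal 𝓕 i (neg (nth 0 vs)) D)
  -- Digits and `end` label no gate that the parser produces; any value would do.
  compute _      vs D = [] , D

  record-value : Bits → Values → Bits × Dict → Values × Dict
  record-value x R r = (x , proj₁ r) ∷ R , proj₂ r

  visit : Entry → State → State
  visit e st = caseMaybe
    (caseMaybe st (λ vs → record-value (proj₁ e) (proj₁ st) (compute (proj₁ (proj₂ e)) vs (proj₂ st)))
               (arguments (proj₂ e) (proj₁ st)))
    (λ _ → st) (find (proj₁ e) (proj₁ st))

  numberStep : RawGate → Bits × List Entry → Bits × List Entry
  numberStep g (c , t) = inc c , (terminate c , g) ∷ t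

  number : List RawGate → List Entry
  number gs = proj₂ (foldl (λ s g → numberStep g s) ([] , []) gs)

  -- One copy of the table for each gate, since every traversal settles at least one further gate of
  -- an acyclic table. `number` builds its table backwards and `ʳ++` turns each copy round again.
  schedule : List Entry → List Entry
  schedule t = foldl (λ s _ → t ʳ++ s) [] t

  pass : List Entry → State → State
  pass es st = foldl (λ s e → visit e s) st es

  saturate : List Entry → State
  saturate es = pass es ([] , [])

  isJust : ∀ {A : Set} → Maybe A → Bool
  isJust = caseMaybe false (λ _ → true)

  -- This test rules out cycles and source indices that are out of range, as the gates concerned
  -- never obtain a value.
  resolved : Values → List Entry → Bool
  resolved R = foldr (λ e s → if isJust (find (proj₁ e) R)
                              then (if isJust (arguments (proj₂ e) R) then s else false) else false) true

  verdict : Bits → Values → List Entry → Bool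
  verdict o R t = if resolved R t then caseMaybe false (λ v → not (isZero v)) (find o R) else false

  decideGates : Bits → List RawGate → Bool
  decideGates o gs = verdict o (proj₁ (saturate (schedule (number gs)))) (number gs)

  -- The number of numerals that follow the symbol in a string: a variable has in-degree 0 but is
  -- followed by its index.
  degree : Sym → ℕ
  degree (fn f) = arity (List.lookup B f)
  degree _      = 1

  hasLength : ℕ → List Bits → Bool
  hasLength zero    = caseList true (λ _ _ → false)
  hasLength (suc n) = caseList false (λ _ xs → hasLength n xs)

  -- A string is read from the right, so the numerals of a gate are met before its label. The first
  -- component collects the numerals not yet claimed; a label claims all of them, and at the end
  -- exactly the index of the output gate must be left.
  Parse : Set
  Parse = List Bits × List RawGate

  digit : Bool → Parse → Maybe Parse
  digit b (xs , gs) = caseList nothing (λ x ys → just ((b ∷ x) ∷ ys , gs)) xs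

  gate : Sym → Parse → Maybe Parse
  gate σ (xs , gs) = if hasLength (degree σ) xs then just ([] , (σ , xs) ∷ gs) else nothing

  parseSymbol : Sym → Parse → Maybe Parse
  parseSymbol one st = digit false st
  parseSymbol two st = digit true st
  parseSymbol end st = just ((true ∷ []) ∷ proj₁ st , proj₂ st)
  parseSymbol σ   st = gate σ st

  parse : List Sym → Maybe Parse
  parse = foldr (λ σ s → caseMaybe nothing (λ st → parseSymbol σ st) s) (just ([] , []))

  judge : Parse → Bool
  judge (xs , gs) = caseList false (λ o ys → caseList (decideGates o gs) (λ _ _ → false) ys) xs

  decideString : List Sym → Bool
  decideString s = caseMaybe false judge (parse s)

  -- Polynomial time for the parts of the decision procedure

  if-≤ : ∀ {A} {{_ : Enc A}} b {x y : A} {n} → ⟪ x ⟫ ≤ n → ⟪ y ⟫ ≤ n → ⟪ if b then x else y ⟫ ≤ n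
  if-≤ true  p q = p
  if-≤ false p q = q

  module _ {E : Set} {{_ : Enc E}} where

    opaque
      notP : {b : E → Bool} → PF b → PF (λ ρ → not (b ρ))
      notP {b} bP = extP (λ ρ → go (b ρ)) (ifP bP (constP false) (constP true))
        where
        go : ∀ b → (if b then false else true) ≡ not b
        go true  = refl
        go false = refl

  module _ {E : Set} {{_ : Enc E}} where

    opaque
      xorP : {b c : E → Bool} → PF b → PF c → PF (λ ρ → b ρ xor c ρ)
      xorP {b} {c} bP cP = extP (λ ρ → go (b ρ) (c ρ)) (ifP bP (notP cP) cP)
        where
        go : ∀ b c → (if b then not c else c) ≡ b xor c
        go true  c = refl
        go false c = refl

  module _ {E : Set} {{_ : Enc E}} where

    opaque
      ==P : {a b : E → Sym} → PF a → PF b → PF (λ ρ → a ρ == b ρ)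
      ==P aP bP = switchP {g = λ a b → a == b} (λ a → testP (a ==_) idP) ∘P (aP ,P bP)

  module _ {E : Set} {{_ : Enc E}} where

    opaque
      xorVP : {xs ys : E → Bits} → PF xs → PF ys → PF (λ ρ → xorV (xs ρ) (ys ρ))
      xorVP {xs} {ys} xsP ysP = extP (λ ρ → go ρ (xs ρ) [] (ys ρ))
        (ʳ++P (fstP ∘P loopP) (sndP ∘P loopP))
        where
        -- The state consists of the sum computed so far, reversed, and the part of `ys` not yet
        -- read.
        body : E × Bool × (Bits × Bits) → Bits × Bits
        body (_ , b , out , ys) = caseList (b ∷ out , []) (λ y ys′ → (b xor y) ∷ out , ys′) ys
        bodyP : PF body
        bodyP = listP (sndP ∘P sndP ∘P sndP)
          (((fstP ∘P sndP) ∷P (fstP ∘P sndP ∘P sndP)) ,P constP [])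
          ((xorP (fstP ∘P sndP ∘P fstP) (fstP ∘P sndP) ∷P (fstP ∘P sndP ∘P sndP ∘P fstP)) ,P (sndP ∘P sndP))
        grows : Grows body (con 2)
        grows ρ b (out , [])     = s≤s (≤-reflexive refl)
        grows ρ b (out , y ∷ ys) = s≤s (s≤s (s≤s (+-monoʳ-≤ ⟪ out ⟫ (≤-trans (n≤1+n _) (n≤1+n _)))))
        loopP : PF (λ ρ → foldl (λ s b → body (ρ , b , s)) ([] , ys ρ) (xs ρ))
        loopP = foldl⁺P bodyP xsP (constP [] ,P ysP) (con 2) grows
        go : ∀ ρ xs out ys → let r = foldl (λ s b → body (ρ , b , s)) (out , ys) xs in
             proj₁ r ʳ++ proj₂ r ≡ out ʳ++ xorV xs ys
        go ρ []       out ys       = refl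
        go ρ (x ∷ xs) out []       = trans (go ρ xs (x ∷ out) []) (cong ((x ∷ out) ʳ++_) (xorV-identityʳ xs))
        go ρ (x ∷ xs) out (y ∷ ys) = go ρ xs ((x xor y) ∷ out) ys

  module _ {E : Set} {{_ : Enc E}} where

    opaque
      negP : {xs : E → Bits} → PF xs → PF (λ ρ → neg (xs ρ))
      negP = xorVP (constP (true ∷ []))

  module _ {E : Set} {{_ : Enc E}} where

    opaque
      isZeroP : {xs : E → Bits} → PF xs → PF (λ ρ → isZero (xs ρ))
      isZeroP xsP = foldrP {f = λ (_ , b , s) → if b then false else s}
        (ifP (fstP ∘P sndP) (constP false) (sndP ∘P sndP)) xsP (constP true)
        (con 0) (λ ρ b s → ≤-refl)

  module _ {E : Set} {{_ : Enc E}} where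

    opaque
      sameP : {xs ys : E → Bits} → PF xs → PF ys → PF (λ ρ → same (xs ρ) (ys ρ))
      sameP xsP ysP = isZeroP (xorVP xsP ysP)

  module _ {E : Set} {{_ : Enc E}} where

    opaque
      incP : {xs : E → Bits} → PF xs → PF (λ ρ → inc (xs ρ))
      incP {xs} xsP = extP (λ ρ → go ρ (xs ρ) true [])
        (ʳ++P (sndP ∘P loopP) (ifP (fstP ∘P loopP) (constP (false ∷ [])) (constP [])))
        where
        -- The flag is the carry: the digit two becomes one and passes the carry on, the digit one
        -- becomes two and absorbs it, so the new carry is the old bit. A carry left at the end
        -- becomes a new digit one.
        body : E × Bool × (Bool × Bits) → Bool × Bits
        body (_ , b , c , out) = if c then (b , not b ∷ out) else (false , b ∷ out)
        bodyP : PF body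
        bodyP = ifP (fstP ∘P sndP ∘P sndP)
          ((fstP ∘P sndP) ,P (notP (fstP ∘P sndP) ∷P (sndP ∘P sndP ∘P sndP)))
          (constP false ,P ((fstP ∘P sndP) ∷P (sndP ∘P sndP ∘P sndP)))
        grows : Grows body (con 2)
        grows ρ b (true  , out) = ≤-refl
        grows ρ b (false , out) = ≤-refl
        loopP : PF (λ ρ → foldl (λ s b → body (ρ , b , s)) (true , []) (xs ρ))
        loopP = foldl⁺P bodyP xsP (constP (true , [])) (con 2) grows
        go : ∀ ρ xs c out → let r = foldl (λ s b → body (ρ , b , s)) (c , out) xs in
             proj₂ r ʳ++ (if proj₁ r then false ∷ [] else []) ≡ out ʳ++ (if c then inc xs else xs)
        go ρ []           true  out = refl
        go ρ []           false out = refl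
        go ρ (true ∷ xs)  true  out = go ρ xs true (false ∷ out)
        go ρ (false ∷ xs) true  out = go ρ xs false (true ∷ out)
        go ρ (x ∷ xs)     false out = go ρ xs false (x ∷ out)

  module _ {E : Set} {{_ : Enc E}} where

    opaque
      findP : {x : E → Bits} {R : E → Values} → PF x → PF R → PF (λ ρ → find (x ρ) (R ρ))
      findP {x} xP RP = foldrP
        {f = λ (ρ , e , s) → if same (x ρ) (proj₁ e) then just (proj₂ e) else s}
        (ifP (sameP (xP ∘P fstP) (fstP ∘P fstP ∘P sndP)) (justP (sndP ∘P fstP ∘P sndP)) (sndP ∘P sndP))
        RP (constP nothing) (con 2 ⊕ var)
        (λ ρ e s → if-≤ (same (x ρ) (proj₁ e)) {just (proj₂ e)} {s}
          (≤-trans (+-monoʳ-≤ 2 (≤-trans (≤-trans (m≤n+m ⟪ proj₂ e ⟫ (suc ⟪ proj₁ e ⟫)) (m≤n+m ⟪ e ⟫ ⟪ ρ ⟫)) ≤-refl))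
                   (m≤m+n _ ⟪ s ⟫))
          (m≤n+m ⟪ s ⟫ _))

  module _ {E : Set} {{_ : Enc E}} where

    opaque
      findKeyP : {κ : E → Sym × Bits} {D : E → Dict} → PF κ → PF D → PF (λ ρ → findKey (κ ρ) (D ρ))
      findKeyP {κ} κP DP = foldrP
        {f = λ (ρ , e , s) → if proj₁ (κ ρ) == proj₁ (proj₁ e)
               then (if same (proj₂ (κ ρ)) (proj₂ (proj₁ e)) then just (proj₂ e) else s) else s}
        (ifP (==P (fstP ∘P κP ∘P fstP) (fstP ∘P fstP ∘P fstP ∘P sndP))
          (ifP (sameP (sndP ∘P κP ∘P fstP) (sndP ∘P fstP ∘P fstP ∘P sndP))
               (justP (sndP ∘P fstP ∘P sndP)) (sndP ∘P sndP))
          (sndP ∘P sndP))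
        DP (constP nothing) (con 2 ⊕ var)
        (λ ρ e s → if-≤ (proj₁ (κ ρ) == proj₁ (proj₁ e))
            {if same (proj₂ (κ ρ)) (proj₂ (proj₁ e)) then just (proj₂ e) else s} {s}
          (if-≤ (same (proj₂ (κ ρ)) (proj₂ (proj₁ e))) {just (proj₂ e)} {s}
            (≤-trans (+-monoʳ-≤ 2 (≤-trans (m≤n+m ⟪ proj₂ e ⟫ (suc ⟪ proj₁ e ⟫)) (m≤n+m ⟪ e ⟫ ⟪ ρ ⟫)))
                     (m≤m+n _ ⟪ s ⟫))
            (m≤n+m ⟪ s ⟫ _))
          (m≤n+m ⟪ s ⟫ _))

  module _ {E : Set} {{_ : Enc E}} where

    opaque
      cons?P : {v : E → Maybe Bits} {vs : E → Maybe (List Bits)} → PF v → PF vs →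
               PF (λ ρ → cons? (v ρ) (vs ρ))
      cons?P vP vsP = maybeP vsP (constP nothing)
        (maybeP (vP ∘P fstP) (constP nothing) (justP (sndP ∷P (sndP ∘P fstP))))

  module _ {E : Set} {{_ : Enc E}} where

    opaque
      sourcesP : {xs : E → List Bits} {R : E → Values} → PF xs → PF R → PF (λ ρ → sources (xs ρ) (R ρ))
      sourcesP {xs} {R} xsP RP = go₁ (findP sndP (RP ∘P fstP))
        where
        -- The growth of the fold is measured by the output bound of the lookup itself, which is why
        -- the lookup is taken as an argument.
        go₁ : PF {E × Bits} (λ ρx → find (proj₂ ρx) (R (proj₁ ρx))) → PF (λ ρ → sources (xs ρ) (R ρ))
        go₁ argP = foldrP {f = λ (ρ , x , s) → cons? (find x (R ρ)) s}
          (cons?P (argP ∘P (fstP ,P (fstP ∘P sndP))) (sndP ∘P sndP))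
          xsP (constP (just [])) (con 1 ⊕ bound argP ⟨ con 1 ⊕ var ⟩)
          (λ ρ x s → ≤-trans (go (find x (R ρ)) s (bounded argP (ρ , x)))
            (+-monoˡ-≤ ⟪ s ⟫ (s≤s (≤-subst (bound argP) (con 1 ⊕ var) {⟪ ρ , x ⟫} {⟪ ρ ⟫ + ⟪ x ⟫} ≤-refl))))
          where
          go : ∀ (v : Maybe Bits) (s : Maybe (List Bits)) {n} → ⟪ v ⟫ ≤ n → ⟪ cons? v s ⟫ ≤ suc n + ⟪ s ⟫
          go v        nothing   p = s≤s z≤n
          go nothing  (just vs) p = s≤s z≤n
          go (just v) (just vs) {n} p = ≤-trans (≤-reflexive (rearrange ⟪ v ⟫ ⟪ vs ⟫))
            (s≤s (+-monoˡ-≤ ⟪ just vs ⟫ (≤-trans (≤-trans (n≤1+n _) (n≤1+n _)) p)))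
            where
            rearrange : ∀ a b → 2 + suc (a + b) ≡ suc (a + (2 + b))
            rearrange = solve-∀

  module _ {E : Set} {{_ : Enc E}} where

    opaque
      argumentsP : {g : E → RawGate} {R : E → Values} → PF g → PF R → PF (λ ρ → arguments (g ρ) (R ρ))
      argumentsP gP RP = ifP (testP isVar (fstP ∘P gP)) (justP (sndP ∘P gP)) (sourcesP (sndP ∘P gP) RP)

  module _ {E : Set} {{_ : Enc E}} where

    opaque
      freshP : {D : E → Dict} → PF D → PF (λ ρ → fresh (D ρ))
      freshP DP = listP DP (constP (false ∷ true ∷ [])) (constP false ∷P (sndP ∘P fstP ∘P sndP))

  module _ {E : Set} {{_ : Enc E}} where

    opaque
      internP : {κ : E → Sym × Bits} {D : E → Dict} → PF κ → PF D → PF (λ ρ → intern (κ ρ) (D ρ))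
      internP κP DP = maybeP (findKeyP κP DP)
        (freshP DP ,P ((κP ,P freshP DP) ∷P DP)) (sndP ,P (DP ∘P fstP))

  module _ {E : Set} {{_ : Enc E}} where

    opaque
      modalP : ∀ 𝓕 i {v : E → Bits} {D : E → Dict} → PF v → PF D → PF (λ ρ → modal 𝓕 i (v ρ) (D ρ))
      modalP K  i vP DP = ifP (isZeroP vP) (constP [] ,P DP) (internP (constP (◇ i) ,P vP) DP)
      modalP KD i vP DP = ifP (isZeroP vP) (constP [] ,P DP)
        (ifP (isZeroP (negP vP)) (constP (true ∷ []) ,P DP) (internP (constP (◇ i) ,P vP) DP))

  opaque
    nthP : ∀ n → PF (nth n)
    nthP zero    = listP idP (constP []) (fstP ∘P sndP)
    nthP (suc n) = listP idP (constP []) (nthP n ∘P sndP ∘P sndP)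

  opaque
    combineP : ∀ {n} c (is : List (Fin n)) → PF (combine c is)
    combineP c []       = constP (c ∷ [])
    combineP c (i ∷ is) = xorVP (nthP (toℕ i)) (combineP c is)

  opaque
    computeP : ∀ σ → PF (λ (vD : List Bits × Dict) → compute σ (proj₁ vD) (proj₂ vD))
    computeP one    = constP [] ,P sndP
    computeP two    = constP [] ,P sndP
    computeP end    = constP [] ,P sndP
    computeP var    = internP (constP var ,P (nthP 0 ∘P fstP)) sndP
    computeP (fn f) = (combineP (proj₁ (linearity f)) (proj₁ (proj₂ (linearity f))) ∘P fstP) ,P sndP
    computeP (□ i)  = negP (fstP ∘P m) ,P (sndP ∘P m)
      where
      m : PF (λ (vD : List Bits × Dict) → modal 𝓕 i (neg (nth 0 (proj₁ vD))) (proj₂ vD))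
      m = modalP 𝓕 i (negP (nthP 0 ∘P fstP)) sndP
    computeP (◇ i)  = modalP 𝓕 i (nthP 0 ∘P fstP) sndP

  opaque
    visitP : PF (λ (es : Entry × State) → visit (proj₁ es) (proj₂ es))
    visitP = maybeP (findP (fstP ∘P fstP) (fstP ∘P sndP))
      (maybeP (argumentsP (sndP ∘P fstP) (fstP ∘P sndP)) sndP
        (((fstP ∘P fstP ∘P fstP) ,P (fstP ∘P resultP)) ∷P (fstP ∘P sndP ∘P fstP)
         ,P (sndP ∘P resultP)))
      (sndP ∘P fstP)
      where
      resultP : PF {(Entry × State) × List Bits}
                   (λ x → compute (proj₁ (proj₂ (proj₁ (proj₁ x)))) (proj₂ x) (proj₂ (proj₂ (proj₁ x))))
      resultP = switchP {g = λ σ (vD : List Bits × Dict) → compute σ (proj₁ vD) (proj₂ vD)} computeP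
        ∘P ((fstP ∘P sndP ∘P fstP ∘P fstP) ,P (sndP ,P (sndP ∘P sndP ∘P fstP)))

  inc-length : ∀ xs → length (inc xs) ≤ suc (length xs)
  inc-length []           = ≤-refl
  inc-length (false ∷ xs) = n≤1+n _
  inc-length (true ∷ xs)  = s≤s (inc-length xs)

  size-Bits : ∀ (v : Bits) → ⟪ v ⟫ ≡ 1 + 2 * length v
  size-Bits []      = refl
  size-Bits (b ∷ v) = trans (cong (2 +_) (size-Bits v)) (rearrange (length v))
    where
    rearrange : ∀ n → 2 + (1 + 2 * n) ≡ 1 + 2 * suc n
    rearrange = solve-∀

  opaque
    isJustP : ∀ {E A : Set} {{_ : Enc E}} {{_ : Enc A}} {x : E → Maybe A} → PF x → PF (λ ρ → isJust (x ρ))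
    isJustP xP = maybeP xP (constP false) (constP true)

  opaque
    resolvedP : PF (λ (Rt : Values × List Entry) → resolved (proj₁ Rt) (proj₂ Rt))
    resolvedP = foldrP
      {f = λ (Rt , e , s) → if isJust (find (proj₁ e) (proj₁ Rt))
                            then (if isJust (arguments (proj₂ e) (proj₁ Rt)) then s else false) else false}
      (ifP (isJustP (findP (fstP ∘P fstP ∘P sndP) (fstP ∘P fstP)))
        (ifP (isJustP (argumentsP (sndP ∘P fstP ∘P sndP) (fstP ∘P fstP))) (sndP ∘P sndP) (constP false))
        (constP false))
      sndP (constP true) (con 0) (λ _ _ _ → ≤-refl)

  opaque
    verdictP : PF (λ (oRt : Bits × Values × List Entry) → verdict (proj₁ oRt) (proj₁ (proj₂ oRt)) (proj₂ (proj₂ oRt)))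
    verdictP = ifP (resolvedP ∘P sndP)
      (maybeP (findP fstP (fstP ∘P sndP)) (constP false) (notP (isZeroP sndP)))
      (constP false)

  opaque
    scheduleP : PF schedule
    scheduleP = foldl⁺P {f = λ (t , _ , s) → t ʳ++ s}
      (ʳ++P fstP (sndP ∘P sndP)) idP (constP []) var
      (λ t a s → ≤-trans (ʳ++-size t s) (+-monoˡ-≤ ⟪ s ⟫ (m≤m+n ⟪ t ⟫ ⟪ a ⟫)))
      where
      ʳ++-size : ∀ (t s : List Entry) → ⟪ t ʳ++ s ⟫ ≤ ⟪ t ⟫ + ⟪ s ⟫
      ʳ++-size []      s = n≤1+n _
      ʳ++-size (e ∷ t) s = ≤-trans (ʳ++-size t (e ∷ s)) (≤-reflexive (rearrange ⟪ t ⟫ ⟪ e ⟫ ⟪ s ⟫))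
        where
        rearrange : ∀ a b c → a + suc (b + c) ≡ suc (b + a) + c
        rearrange = solve-∀

  opaque
    hasLengthP : ∀ n → PF (hasLength n)
    hasLengthP zero    = listP idP (constP true) (constP false)
    hasLengthP (suc n) = listP idP (constP false) (hasLengthP n ∘P sndP ∘P sndP)

  opaque
    digitP : ∀ b → PF (digit b)
    digitP b = listP fstP (constP nothing)
      (justP (((constP b ∷P (fstP ∘P sndP)) ∷P (sndP ∘P sndP)) ,P (sndP ∘P fstP)))

  opaque
    gateP : ∀ σ → PF (gate σ)
    gateP σ = ifP (hasLengthP (degree σ) ∘P fstP)
      (justP (constP [] ,P ((constP σ ,P fstP) ∷P sndP))) (constP nothing)

  opaque
    parseSymbolP : ∀ σ → PF (parseSymbol σ)
    parseSymbolP one    = digitP false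
    parseSymbolP two    = digitP true
    parseSymbolP end    = justP ((constP (true ∷ []) ∷P fstP) ,P sndP)
    parseSymbolP var    = gateP var
    parseSymbolP (fn f) = gateP (fn f)
    parseSymbolP (□ i)  = gateP (□ i)
    parseSymbolP (◇ i)  = gateP (◇ i)

  digit-size : ∀ b st → ⟪ digit b st ⟫ ≤ 4 + ⟪ just st ⟫
  digit-size b ([] , gs)     = s≤s z≤n
  digit-size b (x ∷ xs , gs) = ≤-trans (≤-reflexive (rearrange ⟪ x ⟫ ⟪ xs ⟫ ⟪ gs ⟫)) (m≤n+m _ 2)
    where
    rearrange : ∀ a b c → 3 + (suc ((2 + a) + b) + c) ≡ 2 + (3 + (suc (a + b) + c))
    rearrange = solve-∀

  gate-size : ∀ σ st → ⟪ gate σ st ⟫ ≤ 4 + ⟪ just st ⟫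
  gate-size σ (xs , gs) = if-≤ (hasLength (degree σ) xs) {just ([] , (σ , xs) ∷ gs)} {nothing}
    (≤-trans (≤-reflexive (rearrange ⟪ xs ⟫ ⟪ gs ⟫)) ≤-refl) (s≤s z≤n)
    where
    rearrange : ∀ a b → 3 + (1 + suc (suc (1 + a) + b)) ≡ 4 + (3 + (a + b))
    rearrange = solve-∀

  -- A constant per symbol suffices even for labels, because the pending numerals are moved into the
  -- gate and not copied.
  parseSymbol-size : ∀ σ st → ⟪ parseSymbol σ st ⟫ ≤ 4 + ⟪ just st ⟫
  parseSymbol-size one    st = digit-size false st
  parseSymbol-size two    st = digit-size true st
  parseSymbol-size end    st = ≤-refl
  parseSymbol-size var    st = gate-size var st
  parseSymbol-size (fn f) st = gate-size (fn f) st
  parseSymbol-size (□ i)  st = gate-size (□ i) st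
  parseSymbol-size (◇ i)  st = gate-size (◇ i) st

  opaque
    parseP : PF parse
    parseP = foldrP {f = λ (_ , σ , s) → caseMaybe nothing (λ st → parseSymbol σ st) s}
      (maybeP (sndP ∘P sndP) (constP nothing)
        (switchP {g = parseSymbol} parseSymbolP ∘P ((fstP ∘P sndP ∘P fstP) ,P sndP)))
      idP (constP (just ([] , []))) (con 4) (λ _ σ s → go σ s)
      where
      go : ∀ σ s → ⟪ caseMaybe nothing (λ st → parseSymbol σ st) s ⟫ ≤ 4 + ⟪ s ⟫
      go σ nothing   = s≤s z≤n
      go σ (just st) = parseSymbol-size σ st

  -- Size bounds

  find-∈ : ∀ x R {v} → find x R ≡ just v → ∃ λ y → (y , v) ∈ R × same x y ≡ true
  find-∈ x ((y , w) ∷ R) eq with same x y in x≈y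
  find-∈ x ((y , w) ∷ R) refl | true = y , here refl , x≈y
  find-∈ x ((y , w) ∷ R) eq   | false with find-∈ x R eq
  ... | z , z∈ , x≈z = z , there z∈ , x≈z

  sameKey : Sym × Bits → Sym × Bits → Bool
  sameKey (σ , v) (τ , w) = if σ == τ then same v w else false

  findKey-∈ : ∀ κ D {u} → findKey κ D ≡ just u → ∃ λ κ′ → (κ′ , u) ∈ D × sameKey κ κ′ ≡ true
  findKey-∈ κ (e ∷ D) eq with proj₁ κ == proj₁ (proj₁ e) in σ≡
  findKey-∈ κ (e ∷ D) eq | true with same (proj₂ κ) (proj₂ (proj₁ e)) in v≡
  findKey-∈ κ (e ∷ D) refl | true | true =
    proj₁ e , here refl , trans (cong (λ b → if b then same (proj₂ κ) (proj₂ (proj₁ e)) else false) σ≡) v≡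
  findKey-∈ κ (e ∷ D) eq | true | false with findKey-∈ κ D eq
  ... | κ′ , κ′∈ , p = κ′ , there κ′∈ , p
  findKey-∈ κ (e ∷ D) eq | false with findKey-∈ κ D eq
  ... | κ′ , κ′∈ , p = κ′ , there κ′∈ , p

  findKey-∉ : ∀ κ D → findKey κ D ≡ nothing → All (λ e → sameKey κ (proj₁ e) ≡ false) D
  findKey-∉ κ []      eq = []
  findKey-∉ κ (e ∷ D) eq with proj₁ κ == proj₁ (proj₁ e) in σ≡
  findKey-∉ κ (e ∷ D) eq | true with same (proj₂ κ) (proj₂ (proj₁ e)) in v≡
  findKey-∉ κ (e ∷ D) eq | true | false =
    trans (cong (λ b → if b then same (proj₂ κ) (proj₂ (proj₁ e)) else false) σ≡) v≡ ∷ findKey-∉ κ D eq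
  findKey-∉ κ (e ∷ D) eq | false = cong (λ b → if b then same (proj₂ κ) (proj₂ (proj₁ e)) else false) σ≡ ∷ findKey-∉ κ D eq

  sources-Pointwise : ∀ xs R {vs} → sources xs R ≡ just vs → Pointwise (λ x v → find x R ≡ just v) xs vs
  sources-Pointwise []       R refl = []
  sources-Pointwise (x ∷ xs) R eq with sources xs R in eqs
  ... | just ws with find x R in eq′
  sources-Pointwise (x ∷ xs) R refl | just ws | just w = eq′ ∷ sources-Pointwise xs R eqs

  length-xorV : ∀ xs ys {n} → length xs ≤ n → length ys ≤ n → length (xorV xs ys) ≤ n
  length-xorV []       ys       p q = q
  length-xorV (x ∷ xs) []       p q = p
  length-xorV (x ∷ xs) (y ∷ ys) (s≤s p) (s≤s q) = s≤s (length-xorV xs ys p q)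

  length-nth : ∀ i vs {n} → All (λ v → length v ≤ n) vs → length (nth i vs) ≤ n
  length-nth zero    []       []       = z≤n
  length-nth zero    (v ∷ vs) (p ∷ ps) = p
  length-nth (suc i) []       []       = z≤n
  length-nth (suc i) (v ∷ vs) (p ∷ ps) = length-nth i vs ps

  length-combine : ∀ {m} c (is : List (Fin m)) vs {n} → All (λ v → length v ≤ suc n) vs →
                   length (combine c is vs) ≤ suc n
  length-combine c []       vs ps = s≤s z≤n
  length-combine c (i ∷ is) vs ps =
    length-xorV (nth (toℕ i) vs) (combine c is vs) (length-nth (toℕ i) vs ps) (length-combine c is vs ps)

  -- `m` counts the visits made so far and `S` bounds the size of the input. A visit creates at most
  -- one atom, and a vector has one coordinate per atom besides the first. A key is the name of a
  -- variable, bounded by `S`, or a vector, which accounts for the sum.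
  record DictBound (m S : ℕ) (D : Dict) : Set where
    constructor dictBound
    field
      dict-length : length D ≤ m
      dict-sizes  : All (λ e → length (proj₂ (proj₁ e)) ≤ S + suc m × length (proj₂ e) ≤ suc m) D

  record StateBound (m S : ℕ) (st : State) : Set where
    constructor stateBound
    field
      values-length : length (proj₁ st) ≤ m
      values-sizes  : All (λ e → ⟪ proj₁ e ⟫ ≤ S × length (proj₂ e) ≤ suc m) (proj₁ st)
      dict-bound    : DictBound m S (proj₂ st)

  open DictBound
  open StateBound

  DictBound-suc : ∀ {m S D} → DictBound m S D → DictBound (suc m) S D
  DictBound-suc {m} {S} (dictBound l s) = dictBound (m≤n⇒m≤1+n l)
    (All.map (λ (p , q) → ≤-trans p (+-monoʳ-≤ S (n≤1+n (suc m))) , m≤n⇒m≤1+n q) s)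

  Bounded : ℕ → ℕ → Bits × Dict → Set
  Bounded m S r = length (proj₁ r) ≤ suc m × DictBound m S (proj₂ r)

  fresh-bound : ∀ {m S D} → DictBound m S D → length (fresh D) ≤ suc (suc m)
  fresh-bound {D = []}    _ = s≤s (s≤s z≤n)
  fresh-bound {D = e ∷ D} (dictBound _ ((_ , q) ∷ _)) = s≤s q

  intern-bound : ∀ {m S D} κ → length (proj₂ κ) ≤ S + suc m → DictBound m S D →
                 Bounded (suc m) S (intern κ D)
  intern-bound {m} {S} {D} κ κ≤ b with findKey κ D in eq
  ... | nothing = fresh-bound b , dictBound (s≤s (dict-length b))
        ((≤-trans κ≤ (+-monoʳ-≤ S (n≤1+n (suc m))) , fresh-bound b) ∷ dict-sizes (DictBound-suc b))
  ... | just u with findKey-∈ κ D eq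
  ... | κ′ , κ′∈ , _ = m≤n⇒m≤1+n (proj₂ (All.lookup (dict-sizes b) κ′∈)) , DictBound-suc b

  modal-bound : ∀ {m S D} 𝓕 i v → length v ≤ suc m → DictBound m S D → Bounded (suc m) S (modal 𝓕 i v D)
  modal-bound {m} {S} K  i v v≤ b with isZero v
  ... | true  = z≤n , DictBound-suc b
  ... | false = intern-bound (◇ i , v) (≤-trans v≤ (m≤n+m (suc m) S)) b
  modal-bound {m} {S} KD i v v≤ b with isZero v
  ... | true  = z≤n , DictBound-suc b
  ... | false with isZero (neg v)
  ... | true  = s≤s z≤n , DictBound-suc b
  ... | false = intern-bound (◇ i , v) (≤-trans v≤ (m≤n+m (suc m) S)) b

  length-neg : ∀ v {n} → length v ≤ suc n → length (neg v) ≤ suc n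
  length-neg v v≤ = length-xorV (true ∷ []) v (s≤s z≤n) v≤

  compute-bound : ∀ {m S D} σ vs → (isVar σ ≡ true → All (λ v → length v ≤ S) vs) →
    (isVar σ ≡ false → All (λ v → length v ≤ suc m) vs) → DictBound m S D →
    Bounded (suc m) S (compute σ vs D)
  compute-bound one vs p q b = z≤n , DictBound-suc b
  compute-bound two vs p q b = z≤n , DictBound-suc b
  compute-bound end vs p q b = z≤n , DictBound-suc b
  compute-bound {m} {S} var vs p q b =
    intern-bound (var , nth 0 vs) (≤-trans (length-nth 0 vs (p refl)) (m≤m+n S (suc m))) b
  compute-bound (fn f) vs p q b =
    m≤n⇒m≤1+n (length-combine (proj₁ (linearity f)) (proj₁ (proj₂ (linearity f))) vs (q refl)) , DictBound-suc b
  compute-bound {D = D} (□ i) vs p q b with modal-bound 𝓕 i (neg (nth 0 vs)) (length-neg (nth 0 vs) (length-nth 0 vs (q refl))) b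
  ... | l , b′ = length-neg (proj₁ (modal 𝓕 i (neg (nth 0 vs)) D)) l , b′
  compute-bound (◇ i) vs p q b = modal-bound 𝓕 i (nth 0 vs) (length-nth 0 vs (q refl)) b

  arguments-var : ∀ g R {vs} → arguments g R ≡ just vs → isVar (proj₁ g) ≡ true → vs ≡ proj₂ g
  arguments-var (σ , xs) R eq var? with isVar σ
  arguments-var (σ , xs) R refl refl | true = refl

  arguments-sources : ∀ g R {vs} → arguments g R ≡ just vs → isVar (proj₁ g) ≡ false →
                      sources (proj₂ g) R ≡ just vs
  arguments-sources (σ , xs) R eq ¬var with isVar σ
  arguments-sources (σ , xs) R eq refl | false = eq

  names-bound : ∀ (xs : List Bits) {S} → ⟪ xs ⟫ ≤ S → All (λ v → length v ≤ S) xs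
  names-bound []       p = []
  names-bound (x ∷ xs) p =
    ≤-trans (length≤size x) (≤-trans (m≤m+n ⟪ x ⟫ ⟪ xs ⟫) (<⇒≤ p)) ∷
    names-bound xs (≤-trans (m≤n+m ⟪ xs ⟫ ⟪ x ⟫) (<⇒≤ p))

  sources-bound : ∀ {P : Bits → Set} xs R {vs} → All (λ e → P (proj₂ e)) R →
                  sources xs R ≡ just vs → All P vs
  sources-bound {P} xs R ps eq = go (sources-Pointwise xs R eq)
    where
    go : ∀ {xs vs} → Pointwise (λ x v → find x R ≡ just v) xs vs → All P vs
    go []       = []
    go {x ∷ _} (p ∷ pw) = All.lookup ps (proj₁ (proj₂ (find-∈ x R p))) ∷ go pw

  StateBound-suc : ∀ {m S st} → StateBound m S st → StateBound (suc m) S st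
  StateBound-suc (stateBound l s d) = stateBound (m≤n⇒m≤1+n l) (All.map (λ (p , q) → p , m≤n⇒m≤1+n q) s) (DictBound-suc d)

  visit-bound : ∀ {m S st} e → ⟪ e ⟫ ≤ S → StateBound m S st → StateBound (suc m) S (visit e st)
  visit-bound {m} {S} {R , D} (x , σ , xs) e≤ b with find x R
  ... | just _  = StateBound-suc b
  ... | nothing with arguments (σ , xs) R in eq
  ... | nothing = StateBound-suc b
  ... | just vs with compute-bound {m} {S} {D} σ vs
      (λ v → subst (All _) (sym (arguments-var (σ , xs) R eq v)) (names-bound xs xs≤))
      (λ v → sources-bound xs R (All.map proj₂ (values-sizes b)) (arguments-sources (σ , xs) R eq v))
      (dict-bound b)
    where
    xs≤ : ⟪ xs ⟫ ≤ S
    xs≤ = ≤-trans (≤-trans (≤-trans (n≤1+n ⟪ xs ⟫) (n≤1+n _)) (≤-trans (m≤n+m (2 + ⟪ xs ⟫) ⟪ x ⟫) (n≤1+n _))) e≤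
  ... | l , d = stateBound (s≤s (values-length b)) ((x≤ , l) ∷ values-sizes (StateBound-suc b)) d
    where
    x≤ : ⟪ x ⟫ ≤ S
    x≤ = ≤-trans (≤-trans (m≤m+n ⟪ x ⟫ (2 + ⟪ xs ⟫)) (n≤1+n _)) e≤

  saturate-bound : ∀ {m S st} es → ⟪ es ⟫ ≤ S → StateBound m S st →
                   StateBound (m + length es) S (pass es st)
  saturate-bound {m} {S} {st} []       es≤ b = subst (λ n → StateBound n S st) (sym (+-identityʳ m)) b
  saturate-bound {m} {S} {st} (e ∷ es) es≤ b =
    subst (λ n → StateBound n S (pass es (visit e st))) (sym (+-suc m (length es)))
    (saturate-bound es (≤-trans (≤-trans (m≤n+m ⟪ es ⟫ ⟪ e ⟫) (n≤1+n _)) es≤)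
      (visit-bound e (≤-trans (≤-trans (m≤m+n ⟪ e ⟫ ⟪ es ⟫) (n≤1+n _)) es≤) b))

  size-All : ∀ {A : Set} {{_ : Enc A}} {b} (xs : List A) → All (λ x → ⟪ x ⟫ ≤ b) xs →
             ⟪ xs ⟫ ≤ 1 + length xs * suc b
  size-All []       []       = ≤-refl
  size-All {b = b} (x ∷ xs) (p ∷ ps) = ≤-trans (s≤s (+-mono-≤ p (size-All xs ps)))
    (≤-reflexive (rearrange b (length xs * suc b)))
    where
    rearrange : ∀ b c → suc (b + (1 + c)) ≡ 1 + (suc b + c)
    rearrange = solve-∀

  valueP keyP stateP : Poly
  valueP = con 1 ⊕ (var ⊕ (con 1 ⊕ con 2 ⊗ (con 1 ⊕ var)))
  keyP   = con 1 ⊕ ((con 1 ⊕ (con 1 ⊕ (con 1 ⊕ con 2 ⊗ (var ⊕ (con 1 ⊕ var))))) ⊕ (con 1 ⊕ con 2 ⊗ (con 1 ⊕ var)))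
  stateP = con 1 ⊕ ((con 1 ⊕ var ⊗ (con 1 ⊕ valueP)) ⊕ (con 1 ⊕ var ⊗ (con 1 ⊕ keyP)))

  size-state : ∀ {n st} → StateBound n n st → ⟪ st ⟫ ≤ eval stateP n
  size-state {n} {R , D} b = s≤s (+-mono-≤
    (≤-trans (size-All R (All.map (λ {e} → value≤ e) (values-sizes b))) (s≤s (*-monoˡ-≤ (suc (eval valueP n)) (values-length b))))
    (≤-trans (size-All D (All.map (λ {e} → key≤ e) (dict-sizes (dict-bound b))))
             (s≤s (*-monoˡ-≤ (suc (eval keyP n)) (dict-length (dict-bound b))))))
    where
    bits≤ : ∀ (v : Bits) {l} → length v ≤ l → ⟪ v ⟫ ≤ 1 + 2 * l
    bits≤ v p = ≤-trans (≤-reflexive (size-Bits v)) (s≤s (*-monoʳ-≤ 2 p))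
    value≤ : ∀ (e : Bits × Bits) → ⟪ proj₁ e ⟫ ≤ n × length (proj₂ e) ≤ suc n → ⟪ e ⟫ ≤ eval valueP n
    value≤ (x , v) (p , q) = s≤s (+-mono-≤ p (bits≤ v q))
    key≤ : ∀ (e : (Sym × Bits) × Bits) → length (proj₂ (proj₁ e)) ≤ n + suc n × length (proj₂ e) ≤ suc n →
           ⟪ e ⟫ ≤ eval keyP n
    key≤ ((σ , v) , u) (p , q) = s≤s (+-mono-≤ (s≤s (s≤s (bits≤ v p))) (bits≤ u q))

  StateBound-+ : ∀ {m S st} n → StateBound m S st → StateBound (n + m) S st
  StateBound-+ zero    b = b
  StateBound-+ (suc n) b = StateBound-suc (StateBound-+ n b)

  opaque
    -- A visit writes a vector whose length depends on the dictionary, so the growth is not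
    -- independent of the state and `Grows` is out of reach. `StateBound` bounds the state after
    -- each prefix directly.
    saturateP : PF saturate
    saturateP = foldlP {f = λ (_ , e , s) → visit e s} (visitP ∘P sndP) idP (constP ([] , [])) stateP
      (λ es ys zs eq → size-state (bnd es ys zs eq))
      where
      bnd : ∀ es ys zs → es ≡ ys ++ zs →
            StateBound ⟪ es ⟫ ⟪ es ⟫ (pass ys ([] , []))
      bnd es ys zs eq = subst (λ n → StateBound n ⟪ es ⟫ (pass ys ([] , [])))
        (m∸n+n≡m (≤-trans (length≤size ys) ys≤))
        (StateBound-+ (⟪ es ⟫ ∸ length ys) (saturate-bound {0} ys ys≤ (stateBound z≤n [] (dictBound z≤n []))))
        where
        ys≤ : ⟪ ys ⟫ ≤ ⟪ es ⟫
        ys≤ = ≤-trans (size-prefix ys zs) (≤-reflexive (cong ⟪_⟫ (sym eq)))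

  opaque
    numberP : PF number
    numberP = sndP ∘P foldlP {f = λ (_ , g , s) → numberStep g s}
      ((incP (fstP ∘P sndP ∘P sndP)) ,P
       (((++P (fstP ∘P sndP ∘P sndP) (constP (true ∷ []))) ,P (fstP ∘P sndP)) ∷P (sndP ∘P sndP ∘P sndP)))
      idP (constP ([] , []))
      -- The counter never has more digits than there are gates. With N for the input size, a
      -- terminated counter has size at most 3 + 2N, and two inner nodes attach it to its gate and
      -- to the table, whence 5 + 2N.
      (con 1 ⊕ ((con 1 ⊕ con 2 ⊗ var) ⊕ (con 1 ⊕ var ⊗ (con 5 ⊕ con 2 ⊗ var)))) bnd
      where
      sizes : ∀ N gs c t → length c + length gs ≤ N →
        let r = foldl (λ s g → numberStep g s) (c , t) gs in
        length (proj₁ r) ≤ N × ⟪ proj₂ r ⟫ ≤ ⟪ t ⟫ + ⟪ gs ⟫ * (5 + 2 * N)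
      sizes N []       c t p = subst (_≤ N) (+-identityʳ (length c)) p , m≤m+n ⟪ t ⟫ _
      sizes N (g ∷ gs) c t p with sizes N gs (inc c) ((terminate c , g) ∷ t)
        (≤-trans (+-monoˡ-≤ (length gs) (inc-length c)) (≤-trans (≤-reflexive (sym (+-suc (length c) (length gs)))) p))
      ... | q , r = q , ≤-trans r (≤-trans (≤-reflexive (assoc₁ ⟪ terminate c ⟫ ⟪ g ⟫ ⟪ t ⟫ (⟪ gs ⟫ * (5 + 2 * N))))
              (≤-trans (+-monoʳ-≤ ⟪ t ⟫ (+-monoˡ-≤ (⟪ gs ⟫ * (5 + 2 * N)) new≤))
                (≤-reflexive (cong (⟪ t ⟫ +_) (sym (*-distribʳ-+ (5 + 2 * N) (suc ⟪ g ⟫) ⟪ gs ⟫))))))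
        where
        assoc₁ : ∀ a b c d → suc (suc (a + b) + c) + d ≡ c + ((2 + a + b) + d)
        assoc₁ = solve-∀
        c≤ : length c ≤ N
        c≤ = ≤-trans (m≤m+n (length c) _) p
        terminate-size : ⟪ terminate c ⟫ ≤ 3 + 2 * N
        terminate-size = ≤-trans (≤-reflexive (trans (size-Bits (terminate c))
          (cong (λ n → 1 + 2 * n) (length-++ c))))
          (≤-trans (≤-reflexive (rearrange (length c))) (+-monoʳ-≤ 3 (*-monoʳ-≤ 2 c≤)))
          where
          rearrange : ∀ n → 1 + 2 * (n + 1) ≡ 3 + 2 * n
          rearrange = solve-∀
        new≤ : 2 + ⟪ terminate c ⟫ + ⟪ g ⟫ ≤ suc ⟪ g ⟫ * (5 + 2 * N)
        new≤ = +-mono-≤ (s≤s (s≤s terminate-size)) (m≤m*n ⟪ g ⟫ (5 + 2 * N))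
      bnd : ∀ gs ys zs → gs ≡ ys ++ zs →
        ⟪ foldl (λ s g → numberStep g s) ([] , []) ys ⟫ ≤
        1 + ((1 + 2 * ⟪ gs ⟫) + (1 + ⟪ gs ⟫ * (5 + 2 * ⟪ gs ⟫)))
      bnd gs ys zs eq with sizes ⟪ gs ⟫ ys [] [] (≤-trans (length≤size ys) ys≤)
        where
        ys≤ : ⟪ ys ⟫ ≤ ⟪ gs ⟫
        ys≤ = ≤-trans (size-prefix ys zs) (≤-reflexive (cong ⟪_⟫ (sym eq)))
      ... | c≤ , t≤ = s≤s (+-mono-≤
        (≤-trans (≤-reflexive (size-Bits (proj₁ (foldl (λ s g → numberStep g s) ([] , []) ys)))) (s≤s (*-monoʳ-≤ 2 c≤)))
        (≤-trans t≤ (s≤s (*-monoˡ-≤ (5 + 2 * ⟪ gs ⟫) ys≤))))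
        where
        ys≤ : ⟪ ys ⟫ ≤ ⟪ gs ⟫
        ys≤ = ≤-trans (size-prefix ys zs) (≤-reflexive (cong ⟪_⟫ (sym eq)))

  opaque
    decideGatesP : PF (λ (og : Bits × List RawGate) → decideGates (proj₁ og) (proj₂ og))
    decideGatesP = verdictP ∘P (fstP ,P ((fstP ∘P saturateP ∘P scheduleP ∘P tableP) ,P tableP))
      where
      tableP : PF {Bits × List RawGate} (λ og → number (proj₂ og))
      tableP = numberP ∘P sndP

  opaque
    judgeP : PF judge
    judgeP = listP fstP (constP false)
      (listP (sndP ∘P sndP) (decideGatesP ∘P ((fstP ∘P sndP) ,P (sndP ∘P fstP))) (constP false))

  opaque
    decideStringP : PF decideString
    decideStringP = maybeP parseP (constP false) (judgeP ∘P sndP)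

  opaque
    -- The reversal undoes the one performed when the machine reads its tape.
    decision : PF (λ s → decideString (reverse s))
    decision = decideStringP ∘P reverseP idP

  size-string : ∀ (s : List Sym) → ⟪ s ⟫ ≡ 1 + 2 * length s
  size-string []      = refl
  size-string (a ∷ s) = trans (cong (2 +_) (size-string s)) (rearrange (length s))
    where
    rearrange : ∀ n → 2 + (1 + 2 * n) ≡ 1 + 2 * suc n
    rearrange = solve-∀

  module _ (c : Fun) (tp : Poly)
           (sound : ∀ s → ⟦ c ⟧ ⌜ reverse s ⌝ ≡ ⌜ decideString s ⌝)
           (fast : ∀ (s : List Sym) → T c ⌜ s ⌝ ≤ eval tp ⟪ s ⟫) where

    private
      cost : Poly
      cost = con 2 ⊕ (con 6 ⊗ var ⊕ con 1 ⊕ tp ⟨ con 1 ⊕ con 2 ⊗ var ⟩) ⊕ con 1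

      test : Maybe Sym → Bool
      test = maybe′ isTwo false

      time : ∀ s → 2 + (6 * length s + 1 + T c (encodeList (reverse s))) + 1 ≤ eval cost (length s)
      time s = +-monoˡ-≤ 1 (+-monoʳ-≤ 2 (+-monoʳ-≤ (6 * length s + 1)
        (≤-trans (fast (reverse s)) (≤-subst tp (con 1 ⊕ con 2 ⊗ var)
          (≤-reflexive (trans (size-string (reverse s)) (cong (λ n → 1 + 2 * n) (length-reverse s))))))))

      root-bit : ∀ (b : Bool) → test (root ⌜ b ⌝) ≡ b
      root-bit true  = refl
      root-bit false = refl

      halts : ∀ s {n} → eval cost (length s) ≤ n →
              run (decider c test) n (initial (decider c test) s) ≡ just (decideString s)
      halts s cost≤ = trans (decider-run c test s (≤-trans (time s) cost≤))
        (cong just (trans (cong (λ d → test (root d)) (sound s)) (root-bit (decideString s))))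

      within-poly : (∃₂ λ a d → ∀ n → eval cost n ≤ a * n ^ d + a) →
        ∃ λ (M : TM Sym) → ∃₂ λ a d → ∀ s →
        run M (a * length s ^ d + a) (initial M s) ≡ just (decideString s)
      within-poly (a , d , cost≤) = decider c test , a , d , λ s → halts s (cost≤ (length s))

    machine-for : ∃ λ (M : TM Sym) → ∃₂ λ a d → ∀ s →
                  run M (a * length s ^ d + a) (initial M s) ≡ just (decideString s)
    machine-for = within-poly (poly-bound cost)

  decider-correct : ∃ λ (M : TM Sym) → ∃₂ λ a d → ∀ s →
                    run M (a * length s ^ d + a) (initial M s) ≡ just (decideString s)
  decider-correct = go (comp decision)
    where
    go : Comp ⌜_⌝ (λ s → ⌜ decideString (reverse s) ⌝) →
         ∃ λ (M : TM Sym) → ∃₂ λ a d → ∀ s →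
         run M (a * length s ^ d + a) (initial M s) ≡ just (decideString s)
    go (mkComp c c≗ tp t≤ _ _) = machine-for c tp
      (λ s → trans (c≗ (reverse s)) (cong (λ s → ⌜ decideString s ⌝) (reverse-involutive s))) t≤

  -- Vectors as linear forms and their meaning in models

  dot-xorV : ∀ u v as → dot (xorV u v) as ≡ dot u as xor dot v as
  dot-xorV []      v       as       = refl
  dot-xorV (b ∷ u) []      as       = sym (xor-identityʳ (dot (b ∷ u) as))
  dot-xorV (b ∷ u) (c ∷ v) []       = refl
  dot-xorV (b ∷ u) (c ∷ v) (a ∷ as) =
    trans (cong₂ _xor_ (Bool.∧-distribʳ-xor a b c) (dot-xorV u v as))
          (xor-interchange (b ∧ a) (c ∧ a) (dot u as) (dot v as))

  dot-zero : ∀ v as → isZero v ≡ true → dot v as ≡ false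
  dot-zero []          as       eq = refl
  dot-zero (false ∷ v) []       eq = refl
  dot-zero (false ∷ v) (a ∷ as) eq = dot-zero v as eq

  dot-same : ∀ u v as → same u v ≡ true → dot u as ≡ dot v as
  dot-same u v as eq = xor-false-≡ (trans (sym (dot-xorV u v as)) (dot-zero (xorV u v) as eq))

  dot-neg : ∀ v as → dot (neg v) (true ∷ as) ≡ not (dot v (true ∷ as))
  dot-neg v as = dot-xorV (true ∷ []) v (true ∷ as)

  same-refl : ∀ v → same v v ≡ true
  same-refl []          = refl
  same-refl (true ∷ v)  = same-refl v
  same-refl (false ∷ v) = same-refl v

  terminate-nonzero : ∀ x → isZero (terminate x) ≡ false
  terminate-nonzero []          = refl
  terminate-nonzero (true ∷ x)  = refl
  terminate-nonzero (false ∷ x) = terminate-nonzero x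

  terminate-injective : ∀ x y → same (terminate x) (terminate y) ≡ true → x ≡ y
  terminate-injective []          []          eq = refl
  terminate-injective []          (false ∷ y) ()
  terminate-injective []          (true ∷ y)  eq = contradiction (trans (sym eq) (terminate-nonzero y)) λ ()
  terminate-injective (false ∷ x) []          ()
  terminate-injective (true ∷ x)  []          eq = contradiction
    (trans (sym eq) (trans (cong isZero (xorV-identityʳ (terminate x))) (terminate-nonzero x))) λ ()
  terminate-injective (true ∷ x)  (true ∷ y)  eq = cong (true ∷_) (terminate-injective x y eq)
  terminate-injective (false ∷ x) (false ∷ y) eq = cong (false ∷_) (terminate-injective x y eq)

  bits : ℕᵇ → Bits
  bits ℕᵇ.zero  = []
  bits 2[1+ b ] = true ∷ bits b
  bits 1+[2 b ] = false ∷ bits b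

  numeral : Bits → ℕᵇ
  numeral []          = ℕᵇ.zero
  numeral (true ∷ x)  = 2[1+ numeral x ]
  numeral (false ∷ x) = 1+[2 numeral x ]

  numeral-bits : ∀ b → numeral (bits b) ≡ b
  numeral-bits ℕᵇ.zero  = refl
  numeral-bits 2[1+ b ] = cong 2[1+_] (numeral-bits b)
  numeral-bits 1+[2 b ] = cong 1+[2_] (numeral-bits b)

  bits-numeral : ∀ x → bits (numeral x) ≡ x
  bits-numeral []          = refl
  bits-numeral (true ∷ x)  = cong (true ∷_) (bits-numeral x)
  bits-numeral (false ∷ x) = cong (false ∷_) (bits-numeral x)

  name : ℕ → Bits
  name n = terminate (bits (ℕᵇ.fromℕ n))

  name-injective : ∀ m n → same (name m) (name n) ≡ true → m ≡ n
  name-injective m n eq = ℕᵇ.fromℕ-injective (trans (sym (numeral-bits _))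
    (trans (cong numeral (terminate-injective _ _ eq)) (numeral-bits _)))

  -- A dictionary lists the atoms with the latest first; a coordinate of a
  -- vector after the first one refers to an atom, counted from the earliest.
  data Atom : Set where
    letter  : ℕ → Atom
    diamond : Fin k → Bits → Atom

  key : Atom → Sym × Bits
  key (letter n)    = var , name n
  key (diamond i v) = ◇ i , v

  dict : List Atom → Dict
  dict []       = []
  dict (α ∷ As) = (key α , fresh (dict As)) ∷ dict As

  unit : ℕ → Bits
  unit zero    = false ∷ true ∷ []
  unit (suc n) = false ∷ unit n

  fresh-dict : ∀ As → fresh (dict As) ≡ unit (length As)
  fresh-dict []       = refl
  fresh-dict (α ∷ As) = cong (false ∷_) (fresh-dict As)

  length-unit : ∀ n → length (unit n) ≡ suc (suc n)
  length-unit zero    = refl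
  length-unit (suc n) = cong suc (length-unit n)

  dot-unit : ∀ c as b → dot (unit (length as)) (c ∷ as ++ b ∷ []) ≡ b
  dot-unit c []       b = xor-identityʳ b
  dot-unit c (a ∷ as) b = dot-unit a as b

  Nontrivial : FrameClass → Bits → Set
  Nontrivial K  v = isZero v ≡ false
  Nontrivial KD v = isZero v ≡ false × isZero (neg v) ≡ false

  -- `As` are the atoms older than the given one, and the length bound says that ψ mentions no
  -- others. This makes the meaning of atoms a recursion on the list.
  Proper : List Atom → Atom → Set
  Proper As (letter n)    = ⊤
  Proper As (diamond i v) = length v ≤ suc (length As) × Nontrivial 𝓕 v

  data Good : List Atom → Set where
    []  : Good []
    _∷_ : ∀ {α As} → Proper As α × All (λ β → sameKey (key α) (key β) ≡ false) As →
          Good As → Good (α ∷ As)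

  module _ (M : Model k) where
    open Model M

    -- Truth at a world need not be decidable, so the assignment is related to the world and not
    -- computed from it. It is unique by `matches-unique` and exists up to double negation by
    -- `matches-exist`. Its entries run from the earliest atom to the latest.
    AtomHolds : List Atom → World → Atom → Set
    VectorHolds : List Atom → World → Bits → Set
    Matches : List Atom → World → List Bool → Set

    AtomHolds As w (letter n)    = π n w
    AtomHolds As w (diamond i v) = ∃ λ w′ → R i w w′ × VectorHolds As w′ v
    VectorHolds As w v = ∃ λ as → Matches As w as × dot v (true ∷ as) ≡ true
    Matches []       w as = as ≡ []
    Matches (α ∷ As) w as = ∃₂ λ as′ b →
      as ≡ as′ ++ b ∷ [] × Matches As w as′ × Reflects (AtomHolds As w α) b

    matches-length : ∀ As {w as} → Matches As w as → length as ≡ length As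
    matches-length []       refl = refl
    matches-length (α ∷ As) (as′ , b , refl , m , _) =
      trans (length-++ as′) (trans (+-comm (length as′) 1) (cong suc (matches-length As m)))

    matches-unique : ∀ As {w as bs} → Matches As w as → Matches As w bs → as ≡ bs
    matches-unique []       refl refl = refl
    matches-unique (α ∷ As) (as , a , refl , m , r) (bs , b , refl , n , s) =
      cong₂ (λ cs c → cs ++ c ∷ []) (matches-unique As m n) (det r s)

    matches-extend : ∀ α As {w as} → Matches As w as → ¬ ¬ ∃ λ b → Matches (α ∷ As) w (as ++ b ∷ [])
    matches-extend α As m ¬∃ = ¬¬-excluded-middle λ d → ¬∃ (_ , _ , _ , refl , m , proof d)

    matches-exist : ∀ As w → ¬ ¬ ∃ λ as → Matches As w as
    matches-exist []       w ¬∃ = ¬∃ ([] , refl)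
    matches-exist (α ∷ As) w ¬∃ = matches-exist As w λ (as , m) →
      matches-extend α As m λ (b , m′) → ¬∃ (_ , m′)

  Property : Set₁
  Property = (M : Model k) → Model.World M → Set

  -- The invariant that a vector is the value of a property in all models of the class. Bounding the
  -- length by the atoms known now lets later atoms be added without changing the vector.
  record Sem (As : List Atom) (Pr : Property) (v : Bits) : Set₁ where
    constructor sem
    field
      short    : length v ≤ suc (length As)
      reflects : ∀ M → Model.frame M ∈Class 𝓕 → ∀ w as → Matches M As w as →
                 ¬ ¬ Reflects (Pr M w) (dot v (true ∷ as))

  open Sem

  dot-short : ∀ v (As : List Atom) {as b} → length v ≤ suc (length As) → length as ≡ length As →
              dot v (true ∷ as ++ b ∷ []) ≡ dot v (true ∷ as)
  dot-short v As {as} p q = dot-++ v (true ∷ as) _ (subst (λ n → length v ≤ suc n) (sym q) p)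

  sem-weaken : ∀ {As Pr v} α → Sem As Pr v → Sem (α ∷ As) Pr v
  sem-weaken {As} {Pr} {v} α (sem p r) = sem (m≤n⇒m≤1+n p) λ { M M∈ w _ (as , b , refl , m , _) →
    subst (λ c → ¬ ¬ Reflects (Pr M w) c) (sym (dot-short v As p (matches-length M As m))) (r M M∈ w as m) }

  -- A diamond found in the dictionary was defined over the atoms older than itself, so the meaning
  -- of ψ has to be brought back to that shorter list. The truth value of the dropped atom is
  -- supplied by excluded middle under the double negation.
  sem-strengthen : ∀ {As Pr v} α → length v ≤ suc (length As) → Sem (α ∷ As) Pr v → Sem As Pr v
  sem-strengthen {As} {Pr} {v} α p (sem _ r) = sem p λ M M∈ w as m ¬r →
    matches-extend M α As m λ (b , m′) →
    r M M∈ w (as ++ b ∷ []) m′ λ x →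
    ¬r (subst (Reflects (Pr M w)) (dot-short v As p (matches-length M As m)) x)

  sem-same : ∀ {As Pr} u v → same u v ≡ true → length v ≤ suc (length As) → Sem As Pr u → Sem As Pr v
  sem-same {As} {Pr} u v eq p (sem _ r) = sem p λ M M∈ w as m →
    subst (λ c → ¬ ¬ Reflects (Pr M w) c) (dot-same u v (true ∷ as) eq) (r M M∈ w as m)

  Diamond : Fin k → Property → Property
  Diamond i Pr M w = ∃ λ w′ → Model.R M i w w′ × Pr M w′

  Letter : ℕ → Property
  Letter n M w = Model.π M n w

  reflects-↔ : ∀ {P Q : Set} {b} → (P → ¬ ¬ Q) → (Q → ¬ ¬ P) → Reflects P b → ¬ ¬ Reflects Q b
  reflects-↔ f g (ofʸ p)  k′ = f p λ q → k′ (ofʸ q)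
  reflects-↔ f g (ofⁿ ¬p) k′ = k′ (ofⁿ λ q → g q ¬p)

  vector⇒property : ∀ {As Pr v} → Sem As Pr v → ∀ M → Model.frame M ∈Class 𝓕 → ∀ w →
                    VectorHolds M As w v → ¬ ¬ Pr M w
  vector⇒property {Pr = Pr} s M M∈ w (as , m , eq) ¬p = reflects s M M∈ w as m λ x →
    ¬p (invert (subst (Reflects (Pr M w)) eq x))

  property⇒vector : ∀ {As Pr v} → Sem As Pr v → ∀ M → Model.frame M ∈Class 𝓕 → ∀ w →
                    Pr M w → ¬ ¬ VectorHolds M As w v
  property⇒vector {As} {Pr} {v} s M M∈ w p ¬v = matches-exist M As w λ (as , m) →
    reflects s M M∈ w as m λ x → ¬v (as , m , det x (ofʸ p))

  atom⇔diamond : ∀ {As Pr v} i → Sem As Pr v → ∀ M → Model.frame M ∈Class 𝓕 → ∀ w b →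
    Reflects (AtomHolds M As w (diamond i v)) b → ¬ ¬ Reflects (Diamond i Pr M w) b
  atom⇔diamond i s M M∈ w b = reflects-↔
    (λ (w′ , r , h) ¬d → vector⇒property s M M∈ w′ h λ p → ¬d (w′ , r , p))
    (λ (w′ , r , p) ¬a → property⇒vector s M M∈ w′ p λ h → ¬a (w′ , r , h))

  sem-new : ∀ {As} α {Pr} → (∀ M → Model.frame M ∈Class 𝓕 → ∀ w b →
              Reflects (AtomHolds M As w α) b → ¬ ¬ Reflects (Pr M w) b) →
            Sem (α ∷ As) Pr (fresh (dict As))
  sem-new {As} α {Pr} f rewrite fresh-dict As = sem (≤-reflexive (length-unit (length As)))
    λ { M M∈ w _ (as , b , refl , m , r) → subst (λ c → ¬ ¬ Reflects (Pr M w) c)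
      (sym (trans (cong (λ n → dot (unit n) (true ∷ as ++ b ∷ [])) (sym (matches-length M As m))) (dot-unit true as b)))
      (f M M∈ w b r) }

  key-short : ∀ {As i v u} → Good As → ((◇ i , v) , u) ∈ dict As → length v ≤ suc (length As)
  key-short {diamond _ _ ∷ As} ((p , _) ∷ g) (here refl) = m≤n⇒m≤1+n (proj₁ p)
  key-short {α ∷ As}           (_ ∷ g)       (there u∈)  = m≤n⇒m≤1+n (key-short g u∈)

  sem-old-diamond : ∀ {As Pr i v u} → Good As → ((◇ i , v) , u) ∈ dict As →
                    Sem As Pr v → Sem As (Diamond i Pr) u
  sem-old-diamond {diamond i v ∷ As} ((p , _) ∷ g) (here refl) s =
    sem-new (diamond i v) (atom⇔diamond i (sem-strengthen (diamond i v) (proj₁ p) s))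
  sem-old-diamond {α ∷ As} (_ ∷ g) (there u∈) s =
    sem-weaken α (sem-old-diamond g u∈ (sem-strengthen α (key-short g u∈) s))

  sem-old-letter : ∀ {As n x u} → ((var , x) , u) ∈ dict As → same (name n) x ≡ true →
                   Sem As (Letter n) u
  sem-old-letter {letter m ∷ As} {n} (here refl) eq rewrite name-injective n m eq =
    sem-new (letter m) λ M M∈ w b x ¬x → ¬x x
  sem-old-letter {α ∷ As} (there u∈) eq = sem-weaken α (sem-old-letter u∈ eq)

  infix 4 _⊑_

  data _⊑_ (As : List Atom) : List Atom → Set where
    kept  : As ⊑ As
    grown : ∀ {α} → As ⊑ (α ∷ As)

  sem-⊑ : ∀ {As As′ Pr v} → As ⊑ As′ → Sem As Pr v → Sem As′ Pr v
  sem-⊑ kept s = s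
  sem-⊑ (grown {α}) s = sem-weaken α s

  record Outcome (As : List Atom) (Pr : Property) (r : Bits × Dict) : Set₁ where
    constructor outcome
    field
      atoms   : List Atom
      dict≡   : proj₂ r ≡ dict atoms
      good    : Good atoms
      extends : As ⊑ atoms
      meaning : Sem atoms Pr (proj₁ r)

  open Outcome

  sameKey-symbol : ∀ κ κ′ → sameKey κ κ′ ≡ true → proj₁ κ ≡ proj₁ κ′ × same (proj₂ κ) (proj₂ κ′) ≡ true
  sameKey-symbol (σ , v) (τ , w) eq with σ == τ in σ≡τ
  ... | true = ==⇒≡ σ τ σ≡τ , eq

  All-dict : ∀ {P : Sym × Bits → Set} As → All (λ e → P (proj₁ e)) (dict As) → All (λ β → P (key β)) As
  All-dict []       []       = []
  All-dict (α ∷ As) (p ∷ ps) = p ∷ All-dict As ps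

  -- A key is found up to trailing zeros. The stored vector is then the same linear form as `v`,
  -- hence also a value of `Pr`, and the stored diamond means `Diamond i Pr`.
  intern-diamond : ∀ {As Pr} i v → Good As → Nontrivial 𝓕 v → Sem As Pr v →
                   Outcome As (Diamond i Pr) (intern (◇ i , v) (dict As))
  intern-diamond {As} i v g nt s with findKey (◇ i , v) (dict As) in eq
  ... | nothing = outcome (diamond i v ∷ As) refl
        (((short s , nt) , All-dict As (findKey-∉ (◇ i , v) (dict As) eq)) ∷ g) grown
        (sem-new (diamond i v) (atom⇔diamond i s))
  ... | just u with findKey-∈ (◇ i , v) (dict As) eq
  ... | (τ , v′) , u∈ , sk with sameKey-symbol (◇ i , v) (τ , v′) sk
  ... | refl , v≈v′ = outcome As refl g kept
        (sem-old-diamond g u∈ (sem-same v v′ v≈v′ (key-short g u∈) s))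

  intern-letter : ∀ {As} n → Good As → Outcome As (Letter n) (intern (var , name n) (dict As))
  intern-letter {As} n g with findKey (var , name n) (dict As) in eq
  ... | nothing = outcome (letter n ∷ As) refl
        ((tt , All-dict As (findKey-∉ (var , name n) (dict As) eq)) ∷ g) grown
        (sem-new (letter n) λ M M∈ w b x ¬x → ¬x x)
  ... | just u with findKey-∈ (var , name n) (dict As) eq
  ... | (τ , x) , u∈ , sk with sameKey-symbol (var , name n) (τ , x) sk
  ... | refl , n≈x = outcome As refl g kept (sem-old-letter u∈ n≈x)

  never : ∀ {As Pr} v → isZero v ≡ true → Sem As Pr v → ∀ M → Model.frame M ∈Class 𝓕 → ∀ w → ¬ Pr M w
  never {As} v z s M M∈ w p = matches-exist M As w λ (as , m) → reflects s M M∈ w as m λ x →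
    contradiction (trans (sym (det x (ofʸ p))) (dot-zero v (true ∷ as) z)) λ ()

  always : ∀ {As Pr} v → isZero (neg v) ≡ true → Sem As Pr v → ∀ M → Model.frame M ∈Class 𝓕 → ∀ w → ¬ ¬ Pr M w
  always {As} {Pr} v z s M M∈ w ¬p = matches-exist M As w λ (as , m) → reflects s M M∈ w as m λ x →
    ¬p (invert (subst (Reflects (Pr M w))
      (Bool.not-injective (trans (sym (dot-neg v as)) (dot-zero (neg v) (true ∷ as) z))) x))

  sem-never : ∀ {As Pr i} v → isZero v ≡ true → Sem As Pr v → Sem As (Diamond i Pr) []
  sem-never v z s = sem z≤n λ M M∈ w as m ¬r → ¬r (ofⁿ λ (w′ , _ , p) → never v z s M M∈ w′ p)

  sem-always : ∀ {As Pr i} v → isZero (neg v) ≡ true → (∀ {F : Frame k} → F ∈Class 𝓕 → F ∈Class KD) →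
               Sem As Pr v → Sem As (Diamond i Pr) (true ∷ [])
  sem-always {i = i} v z serial s = sem (s≤s z≤n) λ M M∈ w as m ¬r →
    let (w′ , r) = serial M∈ i w in
    always v z s M M∈ w′ λ p → ¬r (ofʸ (w′ , r , p))

  modal-outcome : ∀ {As Pr} i v → Good As → Sem As Pr v → Outcome As (Diamond i Pr) (modal 𝓕 i v (dict As))
  modal-outcome {As} {Pr} i v g s = go 𝓕 refl
    where
    go : ∀ 𝓖 → 𝓕 ≡ 𝓖 → Outcome As (Diamond i Pr) (modal 𝓖 i v (dict As))
    go K 𝓕≡ with isZero v in z
    ... | true  = outcome As refl g kept (sem-never v z s)
    ... | false = intern-diamond i v g (subst (λ 𝓖 → Nontrivial 𝓖 v) (sym 𝓕≡) z) s
    go KD 𝓕≡ with isZero v in z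
    ... | true  = outcome As refl g kept (sem-never v z s)
    ... | false with isZero (neg v) in z′
    ... | true  = outcome As refl g kept (sem-always v z′ (λ {F} → subst (λ 𝓖 → F ∈Class 𝓖) 𝓕≡) s)
    ... | false = intern-diamond i v g (subst (λ 𝓖 → Nontrivial 𝓖 v) (sym 𝓕≡) (z , z′)) s

  Not : Property → Property
  Not Pr M w = ¬ Pr M w

  reflects-not : ∀ {P : Set} {b} → Reflects P b → Reflects (¬ P) (not b)
  reflects-not (ofʸ p)  = ofⁿ λ ¬p → ¬p p
  reflects-not (ofⁿ ¬p) = ofʸ ¬p

  sem-not : ∀ {As Pr v} → Sem As Pr v → Sem As (Not Pr) (neg v)
  sem-not {As} {Pr} {v} (sem p r) = sem (length-neg v p) λ M M∈ w as m ¬r → r M M∈ w as m λ x →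
    ¬r (subst (Reflects (¬ Pr M w)) (sym (dot-neg v as)) (reflects-not x))

  -- The double negation shift for finite families: the arguments of a Boolean function can be
  -- assumed decided all at once.
  ¬¬-finite : ∀ {n} {P : Fin n → Set} → (∀ j → ¬ ¬ P j) → ¬ ¬ (∀ j → P j)
  ¬¬-finite {zero}  f ¬g = ¬g λ ()
  ¬¬-finite {suc n} f ¬g = f zero λ p → ¬¬-finite (λ j → f (suc j)) λ g →
    ¬g λ { zero → p ; (suc j) → g j }

  Holds : Formula B k → Property
  Holds φ M w = M , w ⊨ φ

  dot-combine : ∀ {n} c (is : List (Fin n)) vs as →
    dot (combine c is vs) (true ∷ as) ≡
    foldr _xor_ c (List.map (lookup (Vec.tabulate λ j → dot (nth (toℕ j) vs) (true ∷ as))) is)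
  dot-combine c []       vs as = trans (xor-identityʳ (c ∧ true)) (Bool.∧-identityʳ c)
  dot-combine c (i ∷ is) vs as = trans (dot-xorV (nth (toℕ i) vs) (combine c is vs) (true ∷ as))
    (cong₂ _xor_ (sym (lookup∘tabulate (λ j → dot (nth (toℕ j) vs) (true ∷ as)) i)) (dot-combine c is vs as))

  combine-short : ∀ {n As} c (is : List (Fin n)) vs → (∀ (j : Fin n) → length (nth (toℕ j) vs) ≤ suc As) →
                  length (combine c is vs) ≤ suc As
  combine-short c []       vs p = s≤s z≤n
  combine-short c (i ∷ is) vs p = length-xorV (nth (toℕ i) vs) (combine c is vs) (p i) (combine-short c is vs p)

  sem-fn : ∀ {As} f φs vs → (∀ j → Sem As (Holds (φs j)) (nth (toℕ j) vs)) →
           Sem As (Holds (node (fn f) φs)) (combine (proj₁ (linearity f)) (proj₁ (proj₂ (linearity f))) vs)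
  sem-fn {As} f φs vs s = sem (combine-short c is vs λ j → short (s j)) λ M M∈ w as m ¬r →
    ¬¬-finite (λ j → reflects (s j) M M∈ w as m) λ rs →
      let bs : Vec Bool (arity (List.lookup B f))
          bs = Vec.tabulate λ j → dot (nth (toℕ j) vs) (true ∷ as)
          rs′ : ∀ j → Reflects (M , w ⊨ φs j) (lookup bs j)
          rs′ j = subst (Reflects (M , w ⊨ φs j)) (sym (lookup∘tabulate (λ j → dot (nth (toℕ j) vs) (true ∷ as)) j)) (rs j)
          value : proj₂ (List.lookup B f) bs ≡ dot (combine c is vs) (true ∷ as)
          value = trans (proj₂ (proj₂ (linearity f)) bs) (sym (dot-combine c is vs as))
      in ¬r (decided bs rs′ _ value)
    where
    c = proj₁ (linearity f)
    is = proj₁ (proj₂ (linearity f))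
    decided : ∀ {M w} bs → (∀ j → Reflects (M , w ⊨ φs j) (lookup bs j)) → ∀ b →
              proj₂ (List.lookup B f) bs ≡ b → Reflects (M , w ⊨ node (fn f) φs) b
    decided bs rs true  eq = ofʸ (bs , rs , eq)
    decided bs rs false eq = ofⁿ λ (bs′ , rs′ , eq′) →
      contradiction (trans (sym eq′) (trans (cong (proj₂ (List.lookup B f)) (same-bits bs′ rs′)) eq)) λ ()
      where
      same-bits : ∀ bs′ → (∀ j → Reflects _ (lookup bs′ j)) → bs′ ≡ bs
      same-bits bs′ rs′ = trans (sym (tabulate∘lookup bs′))
        (trans (tabulate-cong λ j → det (rs′ j) (rs j)) (tabulate∘lookup bs))

  -- A variable gate has no subformula; its only argument is the numeral of its index.
  Subformulas : (σ : Label B k) → List Atom → (Fin (inDegree σ) → Formula B k) → List Bits → Set₁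
  Subformulas (var n) As φs vs = Lift _ (vs ≡ name n ∷ [])
  Subformulas σ       As φs vs = ∀ j → Sem As (Holds (φs j)) (nth (toℕ j) vs)

  symbol : Label B k → Sym
  symbol (var n) = var
  symbol (fn f)  = fn f
  symbol (□ i)   = □ i
  symbol (◇ i)   = ◇ i

  compute-outcome : ∀ {As} σ φs vs → Good As → Subformulas σ As φs vs →
                    Outcome As (Holds (node σ φs)) (compute (symbol σ) vs (dict As))
  compute-outcome (var n) φs vs g (lift refl) = let o = intern-letter n g in
    outcome (atoms o) (dict≡ o) (good o) (extends o) (sem (short (meaning o)) (reflects (meaning o)))
  compute-outcome {As} (fn f) φs vs g s = outcome As refl g kept (sem-fn f φs vs s)
  compute-outcome (□ i) φs vs g s = let o = modal-outcome i (neg (nth 0 vs)) g (sem-not (s zero))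
                                        x = sem-not (meaning o) in
    outcome (atoms o) (dict≡ o) (good o) (extends o) (sem (short x) (reflects x))
  compute-outcome (◇ i) φs vs g s = let o = modal-outcome i (nth 0 vs) g (s zero) in
    outcome (atoms o) (dict≡ o) (good o) (extends o) (sem (short (meaning o)) (reflects (meaning o)))

  -- Independence of the atoms

  data Tree : Set where
    tree : (ℕ → Bool) → (Fin k → List Tree) → Tree

  valuation : Tree → ℕ → Bool
  valuation (tree v c) = v

  children : Tree → Fin k → List Tree
  children (tree v c) = c

  orElse : ∀ {A : Set} → List A → A → List A
  orElse []       y = y ∷ []
  orElse (x ∷ xs) y = x ∷ xs

  -- In the class KD a missing successor is replaced by a loop.
  successors : FrameClass → Tree → Fin k → List Tree
  successors K  t i = children t i
  successors KD t i = orElse (children t i) t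

  trees : Model k
  trees = record
    { frame = record { World = Tree ; R = λ i t u → u ∈ successors 𝓕 t i }
    ; π     = λ n t → valuation t n ≡ true }

  trees-∈Class : Model.frame trees ∈Class 𝓕
  trees-∈Class = go 𝓕
    where
    go : ∀ 𝓖 → record { World = Tree ; R = λ i t u → u ∈ successors 𝓖 t i } ∈Class 𝓖
    go K    = tt
    go KD i t with children t i
    ... | []    = t , here refl
    ... | u ∷ _ = u , here refl

  trees-decidable : ∀ (φ : Formula B k) t → Dec (trees , t ⊨ φ)
  trees-decidable (node (var n) φs) t with valuation t n
  ... | true  = yes refl
  ... | false = no λ ()
  trees-decidable (node (fn f) φs) t = go _ refl
    where
    bs : Vec Bool (arity (List.lookup B f))
    bs = Vec.tabulate λ j → does (trees-decidable (φs j) t)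
    rs : ∀ j → Reflects (trees , t ⊨ φs j) (lookup bs j)
    rs j = subst (Reflects (trees , t ⊨ φs j))
      (sym (lookup∘tabulate (λ j → does (trees-decidable (φs j) t)) j)) (proof (trees-decidable (φs j) t))
    go : ∀ b → proj₂ (List.lookup B f) bs ≡ b → Dec (trees , t ⊨ node (fn f) φs)
    go true  eq = yes (bs , rs , eq)
    go false eq = no λ (bs′ , rs′ , eq′) → contradiction (trans (sym eq′)
      (trans (cong (proj₂ (List.lookup B f)) (trans (sym (tabulate∘lookup bs′))
        (trans (tabulate-cong λ j → det (rs′ j) (rs j)) (tabulate∘lookup bs)))) eq)) λ ()
  trees-decidable (node (□ i) φs) t =
    ¬? (map′ (λ x → let (u , u∈ , p) = find-member x in u , u∈ , p) (λ (u , u∈ , p) → lose u∈ p)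
             (Any.any? (λ u → ¬? (trees-decidable (φs zero) u)) (successors 𝓕 t i)))
  trees-decidable (node (◇ i) φs) t =
    map′ (λ x → let (u , u∈ , p) = find-member x in u , u∈ , p) (λ (u , u∈ , p) → lose u∈ p)
         (Any.any? (λ u → trees-decidable (φs zero) u) (successors 𝓕 t i))

  -- Boolean counterparts of `Matches`, `VectorHolds` and `AtomHolds`, computable because each tree
  -- has finitely many successors.
  assign : List Atom → Tree → List Bool
  value : List Atom → Tree → Bits → Bool
  atomValue : List Atom → Tree → Atom → Bool
  assign []       t = []
  assign (α ∷ As) t = assign As t ++ atomValue As t α ∷ []
  value As t v = dot v (true ∷ assign As t)
  atomValue As t (letter n)    = valuation t n
  atomValue As t (diamond i v) = any (λ u → value As u v) (successors 𝓕 t i)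

  any-true : ∀ {A : Set} (p : A → Bool) xs {x} → x ∈ xs → p x ≡ true → any p xs ≡ true
  any-true p (x ∷ xs) (here refl) eq rewrite eq = refl
  any-true p (x ∷ xs) (there x∈)  eq rewrite any-true p xs x∈ eq = Bool.∨-zeroʳ (p x)

  any-witness : ∀ {A : Set} (p : A → Bool) xs → any p xs ≡ true → ∃ λ x → x ∈ xs × p x ≡ true
  any-witness p (x ∷ xs) eq with p x in px
  ... | true  = x , here refl , px
  ... | false with any-witness p xs eq
  ... | y , y∈ , py = y , there y∈ , py

  assign-matches : ∀ As t → Matches trees As t (assign As t)
  assign-matches []       t = refl
  assign-matches (α ∷ As) t = assign As t , atomValue As t α , refl , assign-matches As t , reflectAtom α
    where
    reflect : ∀ {P : Set} b → (b ≡ true → P) → (P → b ≡ true) → Reflects P b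
    reflect true  f g = ofʸ (f refl)
    reflect false f g = ofⁿ λ p → contradiction (g p) λ ()
    reflectAtom : ∀ α → Reflects (AtomHolds trees As t α) (atomValue As t α)
    reflectAtom (letter n)    = reflect (valuation t n) (λ x → x) (λ x → x)
    reflectAtom (diamond i v) = reflect (any (λ u → value As u v) (successors 𝓕 t i))
      (λ eq → let (u , u∈ , p) = any-witness _ (successors 𝓕 t i) eq in
              u , u∈ , assign As u , assign-matches As u , p)
      (λ (u , u∈ , as , m , p) → any-true _ (successors 𝓕 t i) u∈
        (trans (cong (λ as → dot v (true ∷ as)) (matches-unique trees As (assign-matches As u) m)) p))

  length-assign : ∀ As t → length (assign As t) ≡ length As
  length-assign As t = matches-length trees As (assign-matches As t)

  order : List Atom → List Atom
  order []       = []
  order (α ∷ As) = order As ++ α ∷ []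

  length-order : ∀ As → length (order As) ≡ length As
  length-order []       = refl
  length-order (α ∷ As) = trans (length-++ (order As))
    (trans (+-comm (length (order As)) 1) (cong suc (length-order As)))

  value-weaken : ∀ α As t v → length v ≤ suc (length As) → value (α ∷ As) t v ≡ value As t v
  value-weaken α As t v p = dot-short v As p (length-assign As t)

  any-cong : ∀ {A : Set} {p q : A → Bool} → (∀ x → p x ≡ q x) → ∀ xs → any p xs ≡ any q xs
  any-cong eq []       = refl
  any-cong eq (x ∷ xs) = cong₂ _∨_ (eq x) (any-cong eq xs)

  ShortAtom : ℕ → Atom → Set
  ShortAtom n (letter _)    = ⊤
  ShortAtom n (diamond i v) = length v ≤ suc n

  atomValue-weaken : ∀ β As t α → ShortAtom (length As) α → atomValue (β ∷ As) t α ≡ atomValue As t α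
  atomValue-weaken β As t (letter n)    p = refl
  atomValue-weaken β As t (diamond i v) p = any-cong (λ u → value-weaken β As u v p) (successors 𝓕 t i)

  proper-short : ∀ {As} α → Proper As α → ShortAtom (length As) α
  proper-short (letter n)    p = tt
  proper-short (diamond i v) p = proj₁ p

  short-suc : ∀ {n} α → ShortAtom n α → ShortAtom (suc n) α
  short-suc (letter n)    p = tt
  short-suc (diamond i v) p = m≤n⇒m≤1+n p

  good-short : ∀ {As} → Good As → All (ShortAtom (length As)) (order As)
  good-short []                      = []
  good-short (_∷_ {α} {As} (p , _) g) =
    ++⁺ (All.map (λ {β} → short-suc β) (good-short g)) (short-suc α (proper-short α p) ∷ [])

  -- Each diamond may be evaluated over all of `As` and not only over the atoms older than it, since
  -- its vector is short. A single evaluation function thus serves all atoms. `order` lists them as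
  -- the coordinates do, earliest first.
  assign-order : ∀ {As} → Good As → ∀ t → assign As t ≡ List.map (atomValue As t) (order As)
  assign-order []                      t = refl
  assign-order (_∷_ {α} {As} (p , _) g) t = trans
    (cong₂ (λ as a → as ++ a ∷ [])
      (trans (assign-order g t) (sym (map-weaken (good-short g))))
      (sym (atomValue-weaken α As t α (proper-short α p))))
    (sym (map-++ (atomValue (α ∷ As) t) (order As) (α ∷ [])))
    where
    map-weaken : ∀ {αs} → All (ShortAtom (length As)) αs →
                 List.map (atomValue (α ∷ As) t) αs ≡ List.map (atomValue As t) αs
    map-weaken []              = refl
    map-weaken {β ∷ _} (p ∷ ps) = cong₂ _∷_ (atomValue-weaken α As t β p) (map-weaken ps)

  select : ∀ {A : Set} → Bits → List A → List A
  select (true ∷ v)  (x ∷ xs) = x ∷ select v xs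
  select (false ∷ v) (x ∷ xs) = select v xs
  select _           _        = []

  dot-select : ∀ {A : Set} (f : A → Bool) v xs → dot v (List.map f xs) ≡ parity (List.map f (select v xs))
  dot-select f []          xs       = refl
  dot-select f (true ∷ v)  []       = refl
  dot-select f (false ∷ v) []       = refl
  dot-select f (true ∷ v)  (x ∷ xs) = cong (f x xor_) (dot-select f v xs)
  dot-select f (false ∷ v) (x ∷ xs) = dot-select f v xs

  select-All : ∀ {A : Set} {P : A → Set} v {xs} → All P xs → All P (select v xs)
  select-All []          ps       = []
  select-All (true ∷ v)  []       = []
  select-All (false ∷ v) []       = []
  select-All (true ∷ v)  (p ∷ ps) = p ∷ select-All v ps
  select-All (false ∷ v) (p ∷ ps) = select-All v ps

  select-AllPairs : ∀ {A : Set} {R : A → A → Set} v {xs} → AllPairs R xs → AllPairs R (select v xs)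
  select-AllPairs []          ps       = []
  select-AllPairs (true ∷ v)  []       = []
  select-AllPairs (false ∷ v) []       = []
  select-AllPairs (true ∷ v)  (p ∷ ps) = select-All v p ∷ select-AllPairs v ps
  select-AllPairs (false ∷ v) (p ∷ ps) = select-AllPairs v ps

  select-nonempty : ∀ {A : Set} v (xs : List A) → length v ≤ length xs → isZero v ≡ false → select v xs ≢ []
  select-nonempty (true ∷ v)  (x ∷ xs) p       z ()
  select-nonempty (false ∷ v) (x ∷ xs) (s≤s p) z eq = select-nonempty v xs p z eq

  data Flip {A : Set} (f g : A → Bool) : List A → Set where
    here  : ∀ {x xs} → f x ≢ g x → All (λ y → f y ≡ g y) xs → Flip f g (x ∷ xs)
    there : ∀ {x xs} → f x ≡ g x → Flip f g xs → Flip f g (x ∷ xs)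

  flip-parity : ∀ {A : Set} {f g : A → Bool} {xs} → Flip f g xs → parity (List.map f xs) ≢ parity (List.map g xs)
  flip-parity {f = f} {g} (here {x} {xs} x≢ ys≡) eq = x≢ (xor-cancelʳ (f x) (g x) _ (trans eq
      (cong (g x xor_) (sym (agree ys≡)))))
    where
    xor-cancelʳ : ∀ a b c → a xor c ≡ b xor c → a ≡ b
    xor-cancelʳ true  true  c eq = refl
    xor-cancelʳ false false c eq = refl
    xor-cancelʳ true  false true ()
    xor-cancelʳ true  false false ()
    xor-cancelʳ false true  true ()
    xor-cancelʳ false true  false ()
    agree : ∀ {ys} → All (λ y → f y ≡ g y) ys → parity (List.map f ys) ≡ parity (List.map g ys)
    agree []       = refl
    agree (p ∷ ps) = cong₂ _xor_ p (agree ps)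
  flip-parity {f = f} {g} (there {x} {xs} x≡ fl) eq = flip-parity fl (xor-cancelˡ (f x) _ _
      (trans eq (cong (_xor parity (List.map g xs)) (sym x≡))))
    where
    xor-cancelˡ : ∀ a b c → a xor b ≡ a xor c → b ≡ c
    xor-cancelˡ true  b c eq = Bool.not-injective eq
    xor-cancelˡ false b c eq = eq

  -- Of the evaluation of vectors only two facts enter below: different vectors under the same
  -- modality are told apart by some tree, and each vector is realised, in KD also falsified. Both
  -- come from satisfiability over older atoms.
  module _ (ev : Tree → Bits → Bool) where

    atomEv : Tree → Atom → Bool
    atomEv t (letter n)    = valuation t n
    atomEv t (diamond i v) = any (λ u → ev u v) (successors 𝓕 t i)

    Separate : Atom → Atom → Set
    Separate (letter m)    (letter n)    = m ≢ n
    Separate (diamond i v) (diamond j w) = i ≡ j → ∃ λ t → ev t v ≢ ev t w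
    Separate _             _             = ⊤

    Live : Atom → Set
    Live (letter n)    = ⊤
    Live (diamond i v) = (∃ λ t → ev t v ≡ true) × (𝓕 ≡ KD → ∃ λ t → ev t v ≡ false)

    Inhabited : List Tree → Set
    Inhabited S = 𝓕 ≡ KD → ∃ (_∈ S)

    module _ (i : Fin k) where

      hits : Bits → List Tree → Bool
      hits v S = any (λ u → ev u v) S

      HitsAtom : List Tree → Atom → Set
      HitsAtom S (letter n)    = ⊤
      HitsAtom S (diamond j v) = i ≡ j → hits v S ≡ true

      -- Read `S` as a set of successors along i: of all the diamonds with label i in the list, only
      -- the one over `v` is false.
      data Isolates (S : List Tree) (v : Bits) : List Atom → Set where
        here  : ∀ {αs} → hits v S ≡ false → All (HitsAtom S) αs → Isolates S v (diamond i v ∷ αs)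
        there : ∀ {α αs} → HitsAtom S α → Isolates S v αs → Isolates S v (α ∷ αs)

      OffLabel : Atom → Set
      OffLabel (letter n)    = ⊤
      OffLabel (diamond j v) = i ≢ j

      hits-atom-∷ : ∀ {S} t α → HitsAtom S α → HitsAtom (t ∷ S) α
      hits-atom-∷ t (letter n)    h = tt
      hits-atom-∷ t (diamond j v) h eq rewrite h eq = Bool.∨-zeroʳ (ev t v)

      off-hits : ∀ {S} α → OffLabel α → HitsAtom S α
      off-hits (letter n)    o = tt
      off-hits (diamond j v) o eq = contradiction eq o

      isolates-∷ : ∀ {S v αs} t → ev t v ≡ false → Isolates S v αs → Isolates (t ∷ S) v αs
      isolates-∷ {S} {v} t e (here m hs) = here (trans (cong (_∨ hits v S) e) m) (All.map (λ {α} → hits-atom-∷ t α) hs)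
      isolates-∷ t e (there {α} h is) = there (hits-atom-∷ t α h) (isolates-∷ t e is)

      isolates-∈ : ∀ {S v αs} → Isolates S v αs → diamond i v ∈ αs
      isolates-∈ (here _ _)   = here refl
      isolates-∈ (there _ is) = there (isolates-∈ is)

      isolates-all : ∀ {S v αs} t → ev t v ≡ true → Isolates S v αs → All (HitsAtom (t ∷ S)) αs
      isolates-all {S} {v} t e (here m hs) = (λ _ → cong (_∨ hits v S) e) ∷ All.map (λ {α} → hits-atom-∷ t α) hs
      isolates-all t e (there {α} h is) = hits-atom-∷ t α h ∷ isolates-all t e is

      -- Adding one tree that separates two missed vectors leaves exactly one
      -- of them missed.
      isolate : ∀ {αs} → AllPairs Separate αs → All Live αs →
                All OffLabel αs ⊎ ∃₂ λ S v → Inhabited S × Isolates S v αs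
      isolate [] [] = inj₁ []
      isolate {letter n ∷ αs} (sp ∷ sps) (l ∷ ls) with isolate sps ls
      ... | inj₁ off                = inj₁ (tt ∷ off)
      ... | inj₂ (S , v , inh , is) = inj₂ (S , v , inh , there tt is)
      isolate {diamond j w ∷ αs} (sp ∷ sps) (l ∷ ls) with i Fin.≟ j | isolate sps ls
      ... | no i≢j   | inj₁ off                = inj₁ (i≢j ∷ off)
      ... | no i≢j   | inj₂ (S , v , inh , is) = inj₂ (S , v , inh , there (λ i≡j → contradiction i≡j i≢j) is)
      ... | yes refl | inj₁ off                = inj₂ (base 𝓕 refl)
        where
        -- For the last diamond with label i in the list, K allows the empty set of successors. KD
        -- needs an inhabited one, and a tree that falsifies ψ provides it.
        base : ∀ 𝓖 → 𝓕 ≡ 𝓖 → ∃₂ λ S v → Inhabited S × Isolates S v (diamond i w ∷ αs)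
        base K  𝓕≡ = [] , w , (λ 𝓕≡KD → contradiction (trans (sym 𝓕≡) 𝓕≡KD) λ ()) ,
                     here refl (All.map (λ {α} → off-hits α) off)
        base KD 𝓕≡ = let (t , e) = proj₂ l 𝓕≡ in
          t ∷ [] , w , (λ _ → t , here refl) ,
          here (trans (cong (_∨ false) e) refl) (All.map (λ {α} → off-hits α) off)
      ... | yes refl | inj₂ (S , v , inh , is) with hits w S in hw
      ... | true  = inj₂ (S , v , inh , there (λ _ → hw) is)
      ... | false with All.lookup sp (isolates-∈ is) refl
      ... | t , w≢v with ev t w in ew | ev t v in ev′
      ... | true  | true  = contradiction refl w≢v
      ... | false | false = contradiction refl w≢v
      ... | true  | false = inj₂ (t ∷ S , v , (λ _ → t , here refl) ,
              there (λ _ → cong (_∨ hits w S) ew) (isolates-∷ t ev′ is))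
      ... | false | true  = inj₂ (t ∷ S , w , (λ _ → t , here refl) ,
              here (trans (cong (_∨ hits w S) ew) hw) (isolates-all t ev′ is))

      leaf : Tree
      leaf = tree (λ _ → false) (λ _ → [])

      -- The other labels lead to a fixed leaf. Without children, KD would give them a loop at the
      -- root, and diamonds with these labels could notice a change of `S`.
      sprout : List Tree → Tree
      sprout S = tree (λ _ → false) (λ j → if does (i Fin.≟ j) then S else leaf ∷ [])

      successors-orElse : ∀ {t j S} → children t j ≡ S → Inhabited S → successors 𝓕 t j ≡ S
      successors-orElse {t} {j} {S} c inh = go 𝓕 refl
        where
        go : ∀ 𝓖 → 𝓕 ≡ 𝓖 → successors 𝓖 t j ≡ S
        go K  _ = c
        go KD 𝓕≡ = trans (cong (λ l → orElse l t) c) (nonempty S (inh 𝓕≡))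
          where
          nonempty : ∀ S → ∃ (_∈ S) → orElse S t ≡ S
          nonempty (_ ∷ _) _ = refl

      sprout-on : ∀ S → Inhabited S → successors 𝓕 (sprout S) i ≡ S
      sprout-on S = successors-orElse (cong (λ b → if b then S else leaf ∷ []) (dec-true (i Fin.≟ i) refl))

      sprout-off : ∀ S j → i ≢ j → successors 𝓕 (sprout S) j ≡ leaf ∷ []
      sprout-off S j i≢j = successors-orElse
        (cong (λ b → if b then S else leaf ∷ []) (dec-false (i Fin.≟ j) i≢j)) λ _ → leaf , here refl

      sprout-agree : ∀ S t → Inhabited S → ∀ α → HitsAtom S α → atomEv (sprout S) α ≡ atomEv (sprout (t ∷ S)) α
      sprout-agree S t inh (letter n)    h = refl
      sprout-agree S t inh (diamond j v) h with i Fin.≟ j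
      ... | yes refl = trans (cong (hits v) (sprout-on S inh)) (trans (h refl)
            (sym (trans (cong (hits v) (sprout-on (t ∷ S) λ _ → t , here refl)) (hits-atom-∷ {S} t (diamond i v) h refl))))
      ... | no i≢j   = cong (hits v) (trans (sprout-off S j i≢j) (sym (sprout-off (t ∷ S) j i≢j)))

      -- Adding `t` makes the one missed diamond true. The other diamonds with label i were true and
      -- stay so, and neither letters nor other labels depend on `S`.
      isolates-flip : ∀ {S v αs t} → Inhabited S → ev t v ≡ true → Isolates S v αs →
                      Flip (atomEv (sprout S)) (atomEv (sprout (t ∷ S))) αs
      isolates-flip {S} {v} {t = t} inh e (here m hs) = here
        (λ eq → contradiction (trans (sym (trans (cong (hits v) (sprout-on S inh)) m)) (trans eq
          (trans (cong (hits v) (sprout-on (t ∷ S) λ _ → t , here refl)) (cong (_∨ hits v S) e)))) λ ())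
        (All.map (λ {α} → sprout-agree S t inh α) hs)
      isolates-flip {S} {t = t} inh e (there {α} h is) = there (sprout-agree S t inh α h) (isolates-flip inh e is)

    -- The first atom only determines the kind of flip. A letter is changed at the root, where no
    -- diamond sees it; for a diamond with label i, some diamond with that label is flipped, not
    -- necessarily the first.
    flip-exists : ∀ α αs → AllPairs Separate (α ∷ αs) → All Live (α ∷ αs) →
                  ∃₂ λ t u → Flip (atomEv t) (atomEv u) (α ∷ αs)
    flip-exists (letter n) αs (sp ∷ _) _ = t₀ , t₁ ,
      here (λ eq → contradiction (trans eq (≡ᵇ-refl n)) λ ()) (All.map (λ {α} → agree α) sp)
      where
      -- A common child along every label prevents loops in KD, which would expose the changed
      -- letter to the diamonds.
      twig : Tree
      twig = tree (λ _ → false) (λ _ → [])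
      t₀ t₁ : Tree
      t₀ = tree (λ _ → false) (λ _ → twig ∷ [])
      t₁ = tree (λ m → m ≡ᵇ n) (λ _ → twig ∷ [])
      ≡ᵇ-refl : ∀ n → (n ≡ᵇ n) ≡ true
      ≡ᵇ-refl zero    = refl
      ≡ᵇ-refl (suc n) = ≡ᵇ-refl n
      ≡ᵇ-≢ : ∀ m n → n ≢ m → false ≡ (m ≡ᵇ n)
      ≡ᵇ-≢ zero    zero    n≢m = contradiction refl n≢m
      ≡ᵇ-≢ zero    (suc n) n≢m = refl
      ≡ᵇ-≢ (suc m) zero    n≢m = refl
      ≡ᵇ-≢ (suc m) (suc n) n≢m = ≡ᵇ-≢ m n λ eq → n≢m (cong suc eq)
      successors-eq : ∀ 𝓖 j → successors 𝓖 t₀ j ≡ successors 𝓖 t₁ j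
      successors-eq K  j = refl
      successors-eq KD j = refl
      agree : ∀ α → Separate (letter n) α → atomEv t₀ α ≡ atomEv t₁ α
      agree (letter m)    n≢m = ≡ᵇ-≢ m n n≢m
      agree (diamond j v) _   = cong (any (λ u → ev u v)) (successors-eq 𝓕 j)
    flip-exists (diamond i w) αs sps ls with isolate i sps ls
    ... | inj₁ (i≢i ∷ _)         = contradiction refl i≢i
    ... | inj₂ (S , v , inh , is) with proj₁ (All.lookup ls (isolates-∈ i is))
    ... | t , e = sprout i S , sprout i (t ∷ S) , isolates-flip i inh e is

  Satisfying : List Atom → Set
  Satisfying As = ∀ v → length v ≤ suc (length As) → isZero v ≡ false → ∃ λ t → value As t v ≡ true

  module _ {α As} (good : Good (α ∷ As)) (sat : Satisfying As) where

    -- Different keys under one modality mean that `xorV v w` is not zero, and a tree satisfying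
    -- this sum gives `v` and `w` different values.
    separated : ∀ β γ → ShortAtom (length As) β → ShortAtom (length As) γ →
                sameKey (key β) (key γ) ≡ false → Separate (value As) β γ
    separated (letter m)    (letter n)    p q eq refl =
      contradiction (trans (sym eq) (trans (cong (λ b → if b then same (name m) (name m) else false) (==-refl (var {B = B} {k = k})))
        (same-refl (name m)))) λ ()
    separated (letter m)    (diamond j w) p q eq = tt
    separated (diamond i v) (letter n)    p q eq = tt
    separated (diamond i v) (diamond j w) p q eq refl =
      let (t , h) = sat (xorV v w) (length-xorV v w p q)
                        (trans (sym (cong (λ b → if b then same v w else false) (==-refl (◇ {B = B} i)))) eq)
      in t , xor-true-≢ (trans (sym (dot-xorV v w (true ∷ assign As t))) h)

    live : ∀ β → Proper As β → Live (value As) β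
    live (letter n)    p = tt
    live (diamond i v) (p , nt) = go 𝓕 refl nt
      where
      go : ∀ 𝓖 → 𝓕 ≡ 𝓖 → Nontrivial 𝓖 v → Live (value As) (diamond i v)
      go K  𝓕≡ z       = sat v p z , λ 𝓕≡KD → contradiction (trans (sym 𝓕≡) 𝓕≡KD) λ ()
      go KD 𝓕≡ (z , z′) = sat v p z , λ _ →
        let (t , h) = sat (neg v) (length-neg v p) z′
        in t , Bool.not-injective (trans (sym (dot-neg v (assign As t))) h)

    separate-sym : ∀ β γ → Separate (value As) β γ → Separate (value As) γ β
    separate-sym (letter m)    (letter n)    s eq   = s (sym eq)
    separate-sym (letter m)    (diamond j w) s      = tt
    separate-sym (diamond i v) (letter n)    s      = tt
    separate-sym (diamond i v) (diamond j w) s refl = let (t , h) = s refl in t , λ eq → h (sym eq)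

    proper-weaken : ∀ {Bs} β → length Bs ≤ length As → Proper Bs β → Proper As β
    proper-weaken (letter n)    l p       = tt
    proper-weaken (diamond i v) l (p , q) = ≤-trans p (s≤s l) , q

    order-All : ∀ {P : Atom → Set} Bs → All P Bs → All P (order Bs)
    order-All []       []       = []
    order-All (β ∷ Bs) (p ∷ ps) = ++⁺ (order-All Bs ps) (p ∷ [])

    proper-all : ∀ {Bs} → length Bs ≤ suc (length As) → Good Bs → All (Proper As) Bs
    proper-all l [] = []
    proper-all (s≤s l) (_∷_ {β} (p , _) g) = proper-weaken β l p ∷ proper-all (m≤n⇒m≤1+n l) g

    separate-all : ∀ {Bs} → length Bs ≤ suc (length As) → Good Bs → AllPairs (Separate (value As)) (order Bs)
    separate-all l [] = []
    separate-all (s≤s l) (_∷_ {β} {Bs} (p , ds) g) =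
      AllPairs.++⁺ (separate-all (m≤n⇒m≤1+n l) g) ([] ∷ [])
        (All.map (λ s → s ∷ []) (order-All Bs (zipped ds (proper-all (m≤n⇒m≤1+n l) g))))
      where
      zipped : ∀ {Cs} → All (λ γ → sameKey (key β) (key γ) ≡ false) Cs → All (Proper As) Cs →
               All (λ γ → Separate (value As) γ β) Cs
      zipped []       []       = []
      zipped {γ ∷ _} (d ∷ ds) (q ∷ qs) = separate-sym β γ
        (separated β γ (proper-short β (proper-weaken β l p)) (proper-short γ q) d) ∷ zipped ds qs

    value-order : ∀ t c v → value (α ∷ As) t (c ∷ v) ≡
                  c xor parity (List.map (atomEv (value As) t) (select v (order (α ∷ As))))
    value-order t c v = cong₂ _xor_ (Bool.∧-identityʳ c)
      (trans (cong (dot v) (trans (cong (assign As t ++_) refl) assigned)) (dot-select (atomEv (value As) t) v (order (α ∷ As))))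
      where
      ev≡ : ∀ β → atomValue As t β ≡ atomEv (value As) t β
      ev≡ (letter n)    = refl
      ev≡ (diamond i v) = refl
      assigned : assign (α ∷ As) t ≡ List.map (atomEv (value As) t) (order (α ∷ As))
      tail-good : Good (α ∷ As) → Good As
      tail-good (_ ∷ g) = g
      assigned = trans (cong (λ as → as ++ atomValue As t α ∷ []) (assign-order (tail-good good) t))
        (trans (sym (map-++ (atomValue As t) (order As) (α ∷ []))) (map-cong ev≡ (order (α ∷ As))))

    -- If the vector contains an atom, flipping exactly one of its atoms changes its value, so one
    -- of the two trees satisfies it. If it contains none, it is the constant 1 and any tree will
    -- do.
    satisfying-step : Satisfying (α ∷ As)
    satisfying-step []      p ()
    satisfying-step (c ∷ v) (s≤s p) z = go (select v (order (α ∷ As))) refl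
      where
      some : Tree
      some = tree (λ _ → false) (λ _ → [])
      first : ∀ c → isZero v ≡ true → isZero (c ∷ v) ≡ false → c ≡ true
      first true  zv z = refl
      first false zv z = contradiction (trans (sym zv) z) λ ()
      pick : ∀ c x y → x ≢ y → c xor x ≡ true ⊎ c xor y ≡ true
      pick c     true  true  n = contradiction refl n
      pick c     false false n = contradiction refl n
      pick true  true  false n = inj₂ refl
      pick true  false true  n = inj₁ refl
      pick false true  false n = inj₁ refl
      pick false false true  n = inj₂ refl
      go : ∀ αs → select v (order (α ∷ As)) ≡ αs → ∃ λ t → value (α ∷ As) t (c ∷ v) ≡ true
      go [] eq = some , trans (value-order some c v)
        (trans (cong (λ αs → c xor parity (List.map (atomEv (value As) some) αs)) eq)
          (trans (xor-identityʳ c) c≡))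
        where
        v≤ : length v ≤ length (order (α ∷ As))
        v≤ = ≤-trans p (≤-reflexive (sym (length-order (α ∷ As))))
        zero-or-not : ∀ b → isZero v ≡ b → c ≡ true
        zero-or-not true  zv = first c zv z
        zero-or-not false zv = contradiction eq (select-nonempty v (order (α ∷ As)) v≤ zv)
        c≡ : c ≡ true
        c≡ = zero-or-not (isZero v) refl
      go (β ∷ αs) eq with flip-exists (value As) β αs
          (subst (AllPairs (Separate (value As))) eq (select-AllPairs v (separate-all ≤-refl good)))
          (subst (All (Live (value As))) eq (select-All v (order-All (α ∷ As)
            (All.map (λ {γ} → live γ) (proper-all ≤-refl good)))))
      ... | t , u , fl with pick c (parity (List.map (atomEv (value As) t) (β ∷ αs)))
                                   (parity (List.map (atomEv (value As) u) (β ∷ αs))) (flip-parity fl)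
      ... | inj₁ e = t , trans (value-order t c v)
            (trans (cong (λ αs → c xor parity (List.map (atomEv (value As) t) αs)) eq) e)
      ... | inj₂ e = u , trans (value-order u c v)
            (trans (cong (λ αs → c xor parity (List.map (atomEv (value As) u) αs)) eq) e)

  -- Satisfiability over the older atoms yields separation and realisation for all diamonds of the
  -- longer list, because even the latest one has its vector over the older atoms.
  satisfying : ∀ {As} → Good As → Satisfying As
  satisfying [] []          p ()
  satisfying [] (true ∷ []) p z  = tree (λ _ → false) (λ _ → []) , refl
  satisfying [] (false ∷ []) p ()
  satisfying [] (_ ∷ _ ∷ _) (s≤s ()) z
  satisfying g@(_ ∷ g′) = satisfying-step g (satisfying g′)

  sat-nonzero : ∀ {As φ v} → Good As → Sem As (Holds φ) v → isZero v ≡ false → Satisfiable 𝓕 φ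
  sat-nonzero {As} {φ} {v} g s z with satisfying g v (Sem.short s) z
  ... | t , e = trees , trees-∈Class , t , decidable-stable (trees-decidable φ t) λ ¬h →
        Sem.reflects s trees trees-∈Class t (assign As t) (assign-matches As t) λ r →
        ¬h (invert (subst (Reflects (trees , t ⊨ φ)) e r))

  unsat-zero : ∀ {As φ v} → Sem As (Holds φ) v → isZero v ≡ true → ¬ Satisfiable 𝓕 φ
  unsat-zero {v = v} s z (M , M∈ , w , h) = never v z s M M∈ w h

  -- Strings and circuits

  digitSymbol : Bool → Sym
  digitSymbol b = if b then two else one

  -- The last bit is the terminator and is written as `end`, whatever its value.
  unparseName : Bits → List Sym
  unparseName []             = end ∷ []
  unparseName (b ∷ [])       = end ∷ []
  unparseName (b ∷ x@(_ ∷ _)) = digitSymbol b ∷ unparseName x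

  unparseGate : RawGate → List Sym
  unparseGate (σ , xs) = σ ∷ concatMap unparseName xs

  unparse : Parse → List Sym
  unparse (xs , gs) = concatMap unparseName xs ++ concatMap unparseGate gs

  Terminated : Bits → Set
  Terminated x = ∃ λ y → x ≡ terminate y

  unparseName-∷ : ∀ b {x} → Terminated x → unparseName (b ∷ x) ≡ digitSymbol b ∷ unparseName x
  unparseName-∷ b ([]    , refl) = refl
  unparseName-∷ b (_ ∷ _ , refl) = refl

  unparseName-bits : ∀ b → unparseName (terminate (bits b)) ≡ digits b ++ end ∷ []
  unparseName-bits ℕᵇ.zero  = refl
  unparseName-bits 2[1+ b ] = trans (unparseName-∷ true (bits b , refl)) (cong (two ∷_) (unparseName-bits b))
  unparseName-bits 1+[2 b ] = trans (unparseName-∷ false (bits b , refl)) (cong (one ∷_) (unparseName-bits b))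

  unparseName-name : ∀ n → unparseName (name n) ≡ encodeℕ n
  unparseName-name n = unparseName-bits (ℕᵇ.fromℕ n)

  terminated-name : ∀ {x} → Terminated x → ∃ λ n → x ≡ name n
  terminated-name (y , refl) = ℕᵇ.toℕ (numeral y) ,
    cong terminate (sym (trans (cong bits (ℕᵇ.fromℕ-toℕ (numeral y))) (bits-numeral y)))

  terminated-same : ∀ {x y} → Terminated x → Terminated y → same x y ≡ true → x ≡ y
  terminated-same (x , refl) (y , refl) eq = cong terminate (terminate-injective x y eq)

  name-terminated : ∀ n → Terminated (name n)
  name-terminated n = bits (ℕᵇ.fromℕ n) , refl

  data IsLabel : Sym → Set where
    label : (σ : Label B k) → IsLabel (symbol σ)

  LegalGate : RawGate → Set
  LegalGate (σ , xs) = IsLabel σ × length xs ≡ degree σ × All Terminated xs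

  Legal : Parse → Set
  Legal (xs , gs) = All Terminated xs × All LegalGate gs

  hasLength-true : ∀ n xs → hasLength n xs ≡ true → length xs ≡ n
  hasLength-true zero    []       eq = refl
  hasLength-true (suc n) (x ∷ xs) eq = cong suc (hasLength-true n xs eq)

  hasLength-length : ∀ xs → hasLength (length xs) xs ≡ true
  hasLength-length []       = refl
  hasLength-length (x ∷ xs) = hasLength-length xs

  digit-sound : ∀ b st {st′} → Legal st → digit b st ≡ just st′ →
                unparse st′ ≡ digitSymbol b ∷ unparse st × Legal st′
  digit-sound b (x ∷ xs , gs) ((t@(y , refl) ∷ ts) , ls) refl =
    cong (λ l → (l ++ concatMap unparseName xs) ++ concatMap unparseGate gs) (unparseName-∷ b t) ,
    ((b ∷ y , refl) ∷ ts) , ls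

  gate-sound : ∀ ℓ st {st′} → Legal st → gate (symbol ℓ) st ≡ just st′ →
               unparse st′ ≡ symbol ℓ ∷ unparse st × Legal st′
  gate-sound ℓ (xs , gs) (ts , ls) eq with hasLength (degree (symbol ℓ)) xs in hl
  gate-sound ℓ (xs , gs) (ts , ls) refl | true = refl , [] , (label ℓ , hasLength-true _ xs hl , ts) ∷ ls

  parseSymbol-sound : ∀ σ st {st′} → Legal st → parseSymbol σ st ≡ just st′ →
                      unparse st′ ≡ σ ∷ unparse st × Legal st′
  parseSymbol-sound one    st l eq = digit-sound false st l eq
  parseSymbol-sound two    st l eq = digit-sound true st l eq
  parseSymbol-sound end    st (ts , ls) refl = refl , (([] , refl) ∷ ts) , ls
  parseSymbol-sound var    st l eq = gate-sound (var 0) st l eq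
  parseSymbol-sound (fn f) st l eq = gate-sound (fn f) st l eq
  parseSymbol-sound (□ i)  st l eq = gate-sound (□ i) st l eq
  parseSymbol-sound (◇ i)  st l eq = gate-sound (◇ i) st l eq

  parse-sound : ∀ s {st} → parse s ≡ just st → unparse st ≡ s × Legal st
  parse-sound []      refl = refl , [] , []
  parse-sound (σ ∷ s) eq with parse s in eqs
  ... | just st′ with parse-sound s eqs
  ... | unp , l with parseSymbol-sound σ st′ l eq
  ... | unp′ , l′ = trans unp′ (cong (σ ∷_) unp) , l′

  parse-name : ∀ b s {xs gs} → parse s ≡ just (xs , gs) →
               parse ((digits b ++ end ∷ []) ++ s) ≡ just (terminate (bits b) ∷ xs , gs)
  parse-name ℕᵇ.zero  s eq rewrite eq = refl
  parse-name 2[1+ b ] s eq rewrite parse-name b s eq = refl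
  parse-name 1+[2 b ] s eq rewrite parse-name b s eq = refl

  names : ∀ {n m} → Vec (Fin n) m → List Bits
  names us = List.map (λ u → name (toℕ u)) (toList us)

  parse-names : ∀ {n m} (us : Vec (Fin n) m) s {xs gs} → parse s ≡ just (xs , gs) →
                parse (concatMap encodeFin (toList us) ++ s) ≡
                just (names us ++ xs , gs)
  parse-names []       s eq = eq
  parse-names (u ∷ us) s eq = trans (cong parse (++-assoc (encodeFin u) (concatMap encodeFin (toList us)) s))
    (parse-name (ℕᵇ.fromℕ (toℕ u)) (concatMap encodeFin (toList us) ++ s) (parse-names us s eq))

  rawArguments : ∀ {n} (ℓ : Label B k) → Vec (Fin n) (inDegree ℓ) → List Bits
  rawArguments (var x) us = name x ∷ []
  rawArguments (fn f)  us = names us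
  rawArguments (□ i)   us = names us
  rawArguments (◇ i)   us = names us

  raw : ∀ {n} → Gate B k n → RawGate
  raw (ℓ , us) = symbol ℓ , rawArguments ℓ us

  length-names : ∀ {n m} (us : Vec (Fin n) m) → length (names us) ≡ m
  length-names []       = refl
  length-names (u ∷ us) = cong suc (length-names us)

  gate-complete : ∀ σ xs gs → length xs ≡ degree σ → gate σ (xs , gs) ≡ just ([] , (σ , xs) ∷ gs)
  gate-complete σ xs gs eq rewrite sym eq | hasLength-length xs = refl

  parse-gate : ∀ {n} (g : Gate B k n) s {gs} → parse s ≡ just ([] , gs) →
               parse (encodeGate g ++ s) ≡ just ([] , raw g ∷ gs)
  parse-gate (var x , []) s {gs} eq =
    trans (cong (λ l → parse (var ∷ (l ++ s))) (++-identityʳ (encodeℕ x)))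
      (trans (cong (caseMaybe nothing (gate var)) (parse-name (ℕᵇ.fromℕ x) s eq)) refl)
  parse-gate (fn f , us) s {gs} eq = trans (cong (caseMaybe nothing (gate (fn f)))
    (trans (parse-names us s eq) (cong (λ xs → just (xs , gs)) (++-identityʳ _))))
    (gate-complete (fn f) (rawArguments (fn f) us) gs (length-names us))
  parse-gate (□ i , us) s {gs} eq = trans (cong (caseMaybe nothing (gate (□ i)))
    (trans (parse-names us s eq) (cong (λ xs → just (xs , gs)) (++-identityʳ _))))
    (gate-complete (□ i) (rawArguments (□ i) us) gs (length-names us))
  parse-gate (◇ i , us) s {gs} eq = trans (cong (caseMaybe nothing (gate (◇ i)))
    (trans (parse-names us s eq) (cong (λ xs → just (xs , gs)) (++-identityʳ _))))
    (gate-complete (◇ i) (rawArguments (◇ i) us) gs (length-names us))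

  parse-gates : ∀ {n} (gs : List (Gate B k n)) → parse (concatMap encodeGate gs) ≡ just ([] , List.map raw gs)
  parse-gates []       = refl
  parse-gates (g ∷ gs) = parse-gate g (concatMap encodeGate gs) (parse-gates gs)

  parse-circuit : ∀ {n} (o : Fin n) (gs : List (Gate B k n)) →
    parse (encodeFin o ++ concatMap encodeGate gs) ≡ just (name (toℕ o) ∷ [] , List.map raw gs)
  parse-circuit o gs = parse-name (ℕᵇ.fromℕ (toℕ o)) (concatMap encodeGate gs) (parse-gates gs)

  unparse-names : ∀ {n m} (us : Vec (Fin n) m) →
    concatMap unparseName (names us) ≡ concatMap encodeFin (toList us)
  unparse-names []       = refl
  unparse-names (u ∷ us) = cong₂ _++_ (unparseName-name (toℕ u)) (unparse-names us)

  unparse-raw : ∀ {n} (g : Gate B k n) → unparseGate (raw g) ≡ encodeGate g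
  unparse-raw (var x , []) = cong (λ l → var ∷ (l ++ [])) (unparseName-name x)
  unparse-raw (fn f , us)  = cong (fn f ∷_) (unparse-names us)
  unparse-raw (□ i , us)   = cong (□ i ∷_) (unparse-names us)
  unparse-raw (◇ i , us)   = cong (◇ i ∷_) (unparse-names us)

  unparse-gates : ∀ {n} (gs : List (Gate B k n)) →
    concatMap unparseGate (List.map raw gs) ≡ concatMap encodeGate gs
  unparse-gates []       = refl
  unparse-gates (g ∷ gs) = cong₂ _++_ (unparse-raw g) (unparse-gates gs)

  inc-bits : ∀ b → inc (bits b) ≡ bits (ℕᵇ.suc b)
  inc-bits ℕᵇ.zero  = refl
  inc-bits 2[1+ b ] = cong (false ∷_) (inc-bits b)
  inc-bits 1+[2 b ] = refl

  inc-fromℕ : ∀ m → inc (bits (ℕᵇ.fromℕ m)) ≡ bits (ℕᵇ.fromℕ (suc m))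
  inc-fromℕ m = trans (inc-bits (ℕᵇ.fromℕ m)) (cong bits
    (trans (cong ℕᵇ.suc (ℕᵇ.fromℕ≡fromℕ' m)) (sym (ℕᵇ.fromℕ≡fromℕ' (suc m)))))

  entries : ℕ → List RawGate → List Entry
  entries m []       = []
  entries m (g ∷ gs) = (name m , g) ∷ entries (suc m) gs

  number-from : ∀ m gs t →
    proj₂ (foldl (λ s g → numberStep g s) (bits (ℕᵇ.fromℕ m) , t) gs) ≡ entries m gs ʳ++ t
  number-from m []       t = refl
  number-from m (g ∷ gs) t =
    trans (cong (λ c → proj₂ (foldl (λ s g → numberStep g s) (c , (name m , g) ∷ t) gs)) (inc-fromℕ m))
          (number-from (suc m) gs ((name m , g) ∷ t))

  number-entries : ∀ gs → number gs ≡ reverse (entries 0 gs)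
  number-entries gs = number-from 0 gs []

  passes : ℕ → List Entry → State → State
  passes zero    es st = st
  passes (suc n) es st = pass es (passes n es st)

  -- Each new copy is put in front of `ds` and hence visited before it, so the copies amount to
  -- `length us` traversals.
  pass-schedule : ∀ (t us ds : List Entry) st →
    pass (foldl (λ s _ → t ʳ++ s) ds us) st ≡ pass ds (passes (length us) (reverse t) st)
  pass-schedule t []       ds st = refl
  pass-schedule t (u ∷ us) ds st = trans (pass-schedule t us (t ʳ++ ds) st)
    (trans (cong (λ l → pass l (passes (length us) (reverse t) st)) (ʳ++-defn t))
           (foldl-++ (λ s e → visit e s) (passes (length us) (reverse t) st) (reverse t) ds))

  saturate-passes : ∀ gs → saturate (schedule (number gs)) ≡
                    passes (length (entries 0 gs)) (entries 0 gs) ([] , [])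
  saturate-passes gs rewrite number-entries gs = trans
    (pass-schedule (reverse (entries 0 gs)) (reverse (entries 0 gs)) [] ([] , []))
    (cong₂ (λ n es → passes n es ([] , [])) (length-reverse (entries 0 gs)) (reverse-involutive (entries 0 gs)))

  passes-induction : ∀ {ℓ} (P : State → Set ℓ) {es} → (∀ e st → e ∈ es → P st → P (visit e st)) →
                     ∀ n st → P st → P (passes n es st)
  passes-induction P      visited zero    st p = p
  passes-induction P {es} visited (suc n) st p =
    go es visited (passes n es st) (passes-induction P visited n st p)
    where
    go : ∀ ds → (∀ e st → e ∈ ds → P st → P (visit e st)) → ∀ st → P st → P (pass ds st)
    go []       visited st p = p
    go (d ∷ ds) visited st p =
      go ds (λ e st e∈ → visited e st (there e∈)) (visit d st) (visited d st (here refl) p)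

  Final : List RawGate → Values
  Final gs = proj₁ (saturate (schedule (number gs)))

  isJust-just : ∀ {A : Set} (x : Maybe A) → isJust x ≡ true → ∃ λ a → x ≡ just a
  isJust-just (just a) eq = a , refl

  -- Correctness and completeness of the traversals

  module _ {n : ℕ} (gates : Vec (Gate B k n) n) where

    private
      rawGates : List RawGate
      rawGates = List.map raw (toList gates)

      entry : Fin n → Entry
      entry i = name (toℕ i) , raw (lookup gates i)

    entries-tabulate : ∀ {m} (v : Vec (Gate B k n) m) s →
      entries s (List.map raw (toList v)) ≡ List.tabulate (λ i → name (s + toℕ i) , raw (lookup v i))
    entries-tabulate []      s = refl
    entries-tabulate (g ∷ v) s = cong₂ _∷_ (cong (λ t → name t , raw g) (sym (+-identityʳ s)))
      (trans (entries-tabulate v (suc s))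
             (List.tabulate-cong λ i → cong (λ t → name t , raw (lookup v i)) (sym (+-suc s (toℕ i)))))

    entries-entry : entries 0 rawGates ≡ List.tabulate entry
    entries-entry = entries-tabulate gates 0

    formula : ∀ {i} → Acc (Edge gates) i → Formula B k
    formula = unfoldAt gates

    node-cong : ∀ M (ℓ : Label B k) {φs ψs : Fin (inDegree ℓ) → Formula B k} →
      (∀ j w → M , w ⊨ φs j → M , w ⊨ ψs j) → (∀ j w → M , w ⊨ ψs j → M , w ⊨ φs j) →
      ∀ w → M , w ⊨ node ℓ φs → M , w ⊨ node ℓ ψs
    node-cong M (var x) f g w h = h
    node-cong M (fn b) f g w (bs , rs , eq) = bs , (λ j → transfer (f j w) (g j w) (rs j)) , eq
      where
      transfer : ∀ {P Q : Set} {b} → (P → Q) → (Q → P) → Reflects P b → Reflects Q b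
      transfer f g (ofʸ p)  = ofʸ (f p)
      transfer f g (ofⁿ ¬p) = ofⁿ λ q → ¬p (g q)
    node-cong M (□ i) f g w h (w′ , r , ¬ψ) = h (w′ , r , λ φ → ¬ψ (f zero w′ φ))
    node-cong M (◇ i) f g w (w′ , r , φ) = w′ , r , f zero w′ φ

    -- The children of a node form a function, so unfoldings along different accessibility proofs
    -- are compared by their truth at all worlds and not by equality.
    formula-irrelevant : ∀ {i} (a b : Acc (Edge gates) i) M w → M , w ⊨ formula a → M , w ⊨ formula b
    formula-irrelevant {i} (acc rs) (acc ss) M = node-cong M (proj₁ (lookup gates i))
      (λ j → formula-irrelevant (rs (∈-lookup j (proj₂ (lookup gates i)))) (ss (∈-lookup j (proj₂ (lookup gates i)))) M)
      (λ j → formula-irrelevant (ss (∈-lookup j (proj₂ (lookup gates i)))) (rs (∈-lookup j (proj₂ (lookup gates i)))) M)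

    -- A value comes with a proof that its gate is accessible. Acyclicity is therefore not assumed
    -- but obtained from the traversals, as is needed to turn an accepted string into a circuit.
    Correct : List Atom → Bits × Bits → Set₁
    Correct As (x , v) = ∃ λ i → x ≡ name (toℕ i) × ∃ λ (a : Acc (Edge gates) i) → Sem As (Holds (formula a)) v

    record Invariant (st : State) : Set₁ where
      constructor invariant
      field
        atoms   : List Atom
        dict≡   : proj₂ st ≡ dict atoms
        good    : Good atoms
        correct : All (Correct atoms) (proj₁ st)

    find-correct : ∀ {As} R i {v} → All (Correct As) R → find (name (toℕ i)) R ≡ just v →
                   ∃ λ (a : Acc (Edge gates) i) → Sem As (Holds (formula a)) v
    find-correct R i cs eq with find-∈ (name (toℕ i)) R eq
    ... | y , y∈ , same-y with All.lookup cs y∈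
    ... | j , refl , a , s with Fin.toℕ-injective (name-injective (toℕ i) (toℕ j) same-y)
    ... | refl = a , s

    module _ (R : Values) where

      positions : ∀ {m} (us : Vec (Fin n) m) {vs} →
        Pointwise (λ x v → find x R ≡ just v) (names us) vs →
        ∀ j → find (name (toℕ (lookup us j))) R ≡ just (nth (toℕ j) vs)
      positions (u ∷ us) (p ∷ ps) zero    = p
      positions (u ∷ us) (p ∷ ps) (suc j) = positions us ps j

      found : ∀ {m} (us : Vec (Fin n) m) {vs} → sources (names us) R ≡ just vs →
              ∀ {u} → u Vec.∈ us → ∃ λ v → find (name (toℕ u)) R ≡ just v
      found us {vs} eq {u} u∈ = nth (toℕ (VecAny.index u∈)) vs ,
        trans (cong (λ u → find (name (toℕ u)) R) (lookup-index u∈))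
              (positions us (sources-Pointwise _ R eq) (VecAny.index u∈))
        where
        lookup-index : ∀ {m u} {us : Vec (Fin n) m} (u∈ : u Vec.∈ us) → u ≡ lookup us (VecAny.index u∈)
        lookup-index (VecAny.here eq)  = eq
        lookup-index (VecAny.there u∈) = lookup-index u∈

      found-argument : ∀ (g : Gate B k n) {vs} → arguments (raw g) R ≡ just vs →
                       ∀ {u} → u Vec.∈ proj₂ g → ∃ λ v → find (name (toℕ u)) R ≡ just v
      found-argument (var x , []) eq ()
      found-argument (fn f , us) eq = found us eq
      found-argument (□ i , us)  eq = found us eq
      found-argument (◇ i , us)  eq = found us eq

      subformulas : ∀ {As} (g : Gate B k n) {vs} → arguments (raw g) R ≡ just vs →
        (φ : ∀ {u} → u Vec.∈ proj₂ g → Formula B k) →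
        (∀ {u} (u∈ : u Vec.∈ proj₂ g) → ∃ λ v → find (name (toℕ u)) R ≡ just v × Sem As (Holds (φ u∈)) v) →
        Subformulas (proj₁ g) As (λ j → φ (∈-lookup j (proj₂ g))) vs
      subformulas {As} g@(ℓ , us) {vs} eq φ s = go ℓ us eq φ s
        where
        each : ∀ {m} (us : Vec (Fin n) m) → sources (names us) R ≡ just vs →
          (φ : ∀ {u} → u Vec.∈ us → Formula B k) →
          (∀ {u} (u∈ : u Vec.∈ us) → ∃ λ v → find (name (toℕ u)) R ≡ just v × Sem As (Holds (φ u∈)) v) →
          ∀ j → Sem As (Holds (φ (∈-lookup j us))) (nth (toℕ j) vs)
        each us eq φ s j with s (∈-lookup j us)
        ... | v , fv , sv = subst (Sem As (Holds (φ (∈-lookup j us))))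
          (just-injective (trans (sym fv) (positions us (sources-Pointwise _ R eq) j))) sv
        go : ∀ ℓ (us : Vec (Fin n) (inDegree ℓ)) → arguments (raw (ℓ , us)) R ≡ just vs →
          (φ : ∀ {u} → u Vec.∈ us → Formula B k) →
          (∀ {u} (u∈ : u Vec.∈ us) → ∃ λ v → find (name (toℕ u)) R ≡ just v × Sem As (Holds (φ u∈)) v) →
          Subformulas ℓ As (λ j → φ (∈-lookup j us)) vs
        go (var x) [] eq φ s = lift (sym (just-injective eq))
        go (fn f)  us eq φ s = each us eq φ s
        go (□ i)   us eq φ s = each us eq φ s
        go (◇ i)   us eq φ s = each us eq φ s

    weaken-correct : ∀ {As As′} → As ⊑ As′ → ∀ {e} → Correct As e → Correct As′ e
    weaken-correct ext (i , x≡ , a , s) = i , x≡ , a , sem-⊑ ext s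

    visit-invariant : ∀ i st → Invariant st → Invariant (visit (entry i) st)
    visit-invariant i (R , D) inv@(invariant As refl g cs) with find (name (toℕ i)) R
    ... | just _  = inv
    ... | nothing with arguments (raw (lookup gates i)) R in eq
    ... | nothing = inv
    ... | just vs = invariant (Outcome.atoms o) (Outcome.dict≡ o) (Outcome.good o)
        ((i , refl , acc sub , Outcome.meaning o) ∷ All.map (weaken-correct (Outcome.extends o)) cs)
      where
      known : ∀ {u} → Edge gates u i → ∃ λ (a : Acc (Edge gates) u) → ∃ λ v →
              find (name (toℕ u)) R ≡ just v × Sem As (Holds (formula a)) v
      known {u} u∈ with found-argument R (lookup gates i) eq u∈
      ... | v , fv = let (a , s) = find-correct R u cs fv in a , v , fv , s
      -- Every source has a value already, and with it a proof of accessibility; together these make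
      -- gate `i` accessible.
      sub : ∀ {u} → Edge gates u i → Acc (Edge gates) u
      sub u∈ = proj₁ (known u∈)
      o : Outcome As (Holds (formula (acc sub))) (compute (symbol (proj₁ (lookup gates i))) vs (dict As))
      o = compute-outcome (proj₁ (lookup gates i)) (λ j → formula (sub (∈-lookup j (proj₂ (lookup gates i))))) vs g
            (subformulas R (lookup gates i) eq (λ u∈ → formula (sub u∈)) (λ u∈ → proj₂ (known u∈)))

    final-state : State
    final-state = saturate (schedule (number rawGates))

    entry-of : ∀ {e} → e ∈ entries 0 rawGates → ∃ λ i → e ≡ entry i
    entry-of e∈ = ∈-tabulate⁻ (subst (_ ∈_) entries-entry e∈)

    final-invariant : Invariant final-state
    final-invariant = subst Invariant (sym (saturate-passes rawGates))
      (passes-induction Invariant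
        (λ e st e∈ inv → let (i , e≡) = entry-of e∈ in
          subst (λ e → Invariant (visit e st)) (sym e≡) (visit-invariant i st inv))
        (length (entries 0 rawGates)) ([] , []) (invariant [] refl [] []))

    Resolved : State → Fin n → Bool
    Resolved st i = isJust (find (name (toℕ i)) (proj₁ st))

    visit-keeps : ∀ e st i → Resolved st i ≡ true → Resolved (visit e st) i ≡ true
    visit-keeps (x , g) (R , D) i r with find x R
    ... | just _  = r
    ... | nothing with arguments g R
    ... | nothing = r
    ... | just vs with same (name (toℕ i)) x
    ... | true  = refl
    ... | false = r

    pass-keeps : ∀ ds st i → Resolved st i ≡ true → Resolved (pass ds st) i ≡ true
    pass-keeps []       st i r = r
    pass-keeps (d ∷ ds) st i r = pass-keeps ds (visit d st) i (visit-keeps d st i r)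

    Ready : State → Fin n → Set
    Ready st i = ∀ {u} → Edge gates u i → Resolved st u ≡ true

    sources-just : ∀ {m} (us : Vec (Fin n) m) st → (∀ {u} → u Vec.∈ us → Resolved st u ≡ true) →
                   ∃ λ vs → sources (names us) (proj₁ st) ≡ just vs
    sources-just []       st r = [] , refl
    sources-just (u ∷ us) st r with sources-just us st (λ u∈ → r (VecAny.there u∈))
                                  | isJust-just (find (name (toℕ u)) (proj₁ st)) (r (VecAny.here refl))
    ... | vs , eqs | v , eq = v ∷ vs , cong₂ cons? eq eqs

    arguments-just : ∀ (g : Gate B k n) st → (∀ {u} → u Vec.∈ proj₂ g → Resolved st u ≡ true) →
                     ∃ λ vs → arguments (raw g) (proj₁ st) ≡ just vs
    arguments-just (var x , []) st r = _ , refl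
    arguments-just (fn f , us) st r = sources-just us st r
    arguments-just (□ i , us)  st r = sources-just us st r
    arguments-just (◇ i , us)  st r = sources-just us st r

    visit-resolves : ∀ st i → Ready st i → Resolved (visit (entry i) st) i ≡ true
    visit-resolves (R , D) i r with find (name (toℕ i)) R in fi
    ... | just _  = cong isJust fi
    ... | nothing with arguments (raw (lookup gates i)) R | arguments-just (lookup gates i) (R , D) r
    ... | just vs | _ = cong (λ b → isJust (if b then just (proj₁ (compute (symbol (proj₁ (lookup gates i))) vs D))
                                                 else find (name (toℕ i)) R))
                             (same-refl (name (toℕ i)))
    ... | nothing | _ , ()

    pass-resolves : ∀ ds st i → entry i ∈ ds → Ready st i → Resolved (pass ds st) i ≡ true
    pass-resolves (d ∷ ds) st i (here refl) r = pass-keeps ds (visit d st) i (visit-resolves st i r)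
    pass-resolves (d ∷ ds) st i (there e∈)  r =
      pass-resolves ds (visit d st) i e∈ λ {u} u∈ → visit-keeps d st u (r u∈)

    all-or-not : ∀ {m} (p : Fin n → Bool) (us : Vec (Fin n) m) →
                 (∀ {u} → u Vec.∈ us → p u ≡ true) ⊎ ∃ λ u → u Vec.∈ us × p u ≡ false
    all-or-not p []       = inj₁ λ ()
    all-or-not p (u ∷ us) with p u in pu | all-or-not p us
    ... | false | _                  = inj₂ (u , VecAny.here refl , pu)
    ... | true  | inj₂ (v , v∈ , pv) = inj₂ (v , VecAny.there v∈ , pv)
    ... | true  | inj₁ ps            = inj₁ λ { (VecAny.here refl) → pu ; (VecAny.there u∈) → ps u∈ }

    minimal : ∀ st {i} → Acc (Edge gates) i → Resolved st i ≡ false →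
              ∃ λ j → Resolved st j ≡ false × Ready st j
    minimal st {i} (acc rs) r with all-or-not (Resolved st) (proj₂ (lookup gates i))
    ... | inj₁ ready         = i , r , ready
    ... | inj₂ (u , u∈ , ru) = minimal st (rs u∈) ru

    resolvedSet : State → Subset n
    resolvedSet st = Vec.tabulate (Resolved st)

    ∈-resolvedSet : ∀ st {i} → Resolved st i ≡ true → i ∈ˢ resolvedSet st
    ∈-resolvedSet st {i} r = lookup⇒[]= i (resolvedSet st) (trans (lookup∘tabulate (Resolved st) i) r)

    resolvedSet-∈ : ∀ st {i} → i ∈ˢ resolvedSet st → Resolved st i ≡ true
    resolvedSet-∈ st {i} i∈ = trans (sym (lookup∘tabulate (Resolved st) i)) ([]=⇒lookup i∈)

    entry-∈ : ∀ i → entry i ∈ entries 0 rawGates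
    entry-∈ i = subst (entry i ∈_) (sym entries-entry) (∈-tabulate⁺ i)

    -- Every pass resolves a new gate, namely a minimal unresolved one.
    progress : WellFounded (Edge gates) → ∀ m → let st = passes m (entries 0 rawGates) ([] , []) in
               (∀ i → Resolved st i ≡ true) ⊎ m ≤ card (resolvedSet st)
    progress wf zero    = inj₂ z≤n
    progress wf (suc m) with progress wf m
    ... | inj₁ all = inj₁ λ i → pass-keeps (entries 0 rawGates) _ i (all i)
    ... | inj₂ m≤ with all-or-not (Resolved (passes m (entries 0 rawGates) ([] , []))) (Vec.allFin n)
    ... | inj₁ all = inj₁ λ i → pass-keeps (entries 0 rawGates) _ i
            (all (subst (Vec._∈ Vec.allFin n) (lookup∘tabulate (λ i → i) i) (∈-lookup i (Vec.allFin n))))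
    ... | inj₂ (i , _ , r) with minimal (passes m (entries 0 rawGates) ([] , [])) (wf i) r
    ... | j , ¬rj , ready = inj₂ (≤-trans (s≤s m≤) (p⊂q⇒∣p∣<∣q∣
            ( (λ {x} x∈ → ∈-resolvedSet st′ (pass-keeps (entries 0 rawGates) st x (resolvedSet-∈ st x∈)))
            , j , ∈-resolvedSet st′ (pass-resolves (entries 0 rawGates) st j (entry-∈ j) ready)
            , λ j∈ → contradiction (trans (sym (resolvedSet-∈ st j∈)) ¬rj) λ ())))
      where
      st st′ : State
      st  = passes m (entries 0 rawGates) ([] , [])
      st′ = pass (entries 0 rawGates) st

    all-resolved : WellFounded (Edge gates) → ∀ i → Resolved final-state i ≡ true
    all-resolved wf = subst (λ st → ∀ i → Resolved st i ≡ true) (sym (saturate-passes rawGates)) (go (progress wf n′))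
      where
      n′ = length (entries 0 rawGates)
      n′≡n : n′ ≡ n
      n′≡n = trans (cong length entries-entry) (length-tabulate entry)
      st = passes n′ (entries 0 rawGates) ([] , [])
      go : ((∀ i → Resolved st i ≡ true) ⊎ n′ ≤ card (resolvedSet st)) → ∀ i → Resolved st i ≡ true
      go (inj₁ all) = all
      -- A set of at least n resolved gates among n gates is the full set.
      go (inj₂ n≤) i = resolvedSet-∈ st (subst (i ∈ˢ_)
        (sym (∣p∣≡n⇒p≡⊤ (≤-antisym (∣p∣≤n (resolvedSet st)) (subst (_≤ card (resolvedSet st)) n′≡n n≤))))
        (lookup⇒[]= i _ (lookup-replicate i inside)))

    resolved-true : ∀ R t → All (λ e → isJust (find (proj₁ e) R) ≡ true × isJust (arguments (proj₂ e) R) ≡ true) t →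
                    resolved R t ≡ true
    resolved-true R []      []             = refl
    resolved-true R (e ∷ t) ((p , q) ∷ ps) rewrite p | q = resolved-true R t ps

    resolved-complete : WellFounded (Edge gates) → resolved (Final rawGates) (number rawGates) ≡ true
    resolved-complete wf = resolved-true (Final rawGates) (number rawGates) (All.tabulate λ {e} e∈ →
      let (i , e≡) = entry-of (reverse⁻ (subst (e ∈_) (number-entries rawGates) e∈))
          (vs , eq) = arguments-just (lookup gates i) final-state (λ {u} _ → all-resolved wf u)
      in subst (λ e → isJust (find (proj₁ e) (Final rawGates)) ≡ true × isJust (arguments (proj₂ e) (Final rawGates)) ≡ true)
               (sym e≡) (all-resolved wf i , cong isJust eq))

    -- The invariant stores an accessibility proof with each value, so once all gates have values
    -- the edge relation is well-founded.
    well-founded : (∀ i → Resolved final-state i ≡ true) → WellFounded (Edge gates)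
    well-founded r i = let (v , eq) = isJust-just _ (r i) in
      proj₁ (find-correct (Final rawGates) i (Invariant.correct final-invariant) eq)

    circuit : WellFounded (Edge gates) → Fin n → Circuit B k
    circuit wf o = record
      { size = n ; gates = gates ; output = o
      ; acyclic = λ v → wf⇒irrefl (resp₂ _) sym (Transitive.wellFounded (Edge gates) wf) refl }

    satisfiable-irrelevant : ∀ {i} (a b : Acc (Edge gates) i) → Satisfiable 𝓕 (formula a) → Satisfiable 𝓕 (formula b)
    satisfiable-irrelevant a b (M , M∈ , w , h) = M , M∈ , w , formula-irrelevant a b M w h

    accept : ∀ o {v} (a : Acc (Edge gates) o) → find (name (toℕ o)) (Final rawGates) ≡ just v →
             isZero v ≡ false → Satisfiable 𝓕 (formula a)
    accept o a eq z = let (b , s) = find-correct (Final rawGates) o (Invariant.correct final-invariant) eq in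
      satisfiable-irrelevant b a (sat-nonzero {φ = formula b} (Invariant.good final-invariant) s z)

    reject : ∀ o {v} (a : Acc (Edge gates) o) → find (name (toℕ o)) (Final rawGates) ≡ just v →
             isZero v ≡ true → ¬ Satisfiable 𝓕 (formula a)
    reject o a eq z h = let (b , s) = find-correct (Final rawGates) o (Invariant.correct final-invariant) eq in
      unsat-zero {φ = formula b} s z (satisfiable-irrelevant a b h)

  -- Recovering the circuit from an accepted string

  Known : ℕ → Values → Set
  Known n R = All (λ e → ∃ λ (i : Fin n) → proj₁ e ≡ name (toℕ i)) R

  visit-known : ∀ {n} e st → (∃ λ (i : Fin n) → proj₁ e ≡ name (toℕ i)) → Known n (proj₁ st) → Known n (proj₁ (visit e st))
  visit-known (x , g) (R , D) p ps with find x R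
  ... | just _  = ps
  ... | nothing with arguments g R
  ... | nothing = ps
  ... | just vs = p ∷ ps

  entries-known : ∀ n m gs {e} → m + length gs ≡ n → e ∈ entries m gs → ∃ λ (i : Fin n) → proj₁ e ≡ name (toℕ i)
  entries-known n m (g ∷ gs) eq (here refl) = fromℕ< m<n , cong name (sym (Fin.toℕ-fromℕ< m<n))
    where
    m<n : m < n
    m<n = ≤-trans (s≤s (m≤m+n m (length gs))) (≤-reflexive (trans (sym (+-suc m (length gs))) eq))
  entries-known n m (g ∷ gs) eq (there e∈) =
    entries-known n (suc m) gs (trans (sym (+-suc m (length gs))) eq) e∈

  final-known : ∀ gs → Known (length gs) (Final gs)
  final-known gs = subst (λ st → Known (length gs) (proj₁ st)) (sym (saturate-passes gs))
    (passes-induction (λ st → Known (length gs) (proj₁ st))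
      (λ e st e∈ → visit-known e st (entries-known (length gs) 0 gs refl e∈))
      (length (entries 0 gs)) ([] , []) [])

  -- A lookup succeeds only for a name that was recorded, and recorded names belong to existing
  -- gates; this puts the source indices into range. Names ending in their terminator are equal and
  -- not merely equal up to padding.
  indices : ∀ {n R} xs {vs} → Known n R → All Terminated xs →
            Pointwise (λ x v → find x R ≡ just v) xs vs → ∀ m → length xs ≡ m →
            ∃ λ (us : Vec (Fin n) m) → names us ≡ xs
  indices []       known []       []       zero    refl = [] , refl
  indices {R = R} (x ∷ xs) known (t ∷ ts) (p ∷ ps) (suc m) eq with find-∈ x R p
  ... | y , y∈ , x≈y with All.lookup known y∈ | indices xs known ts ps m (suc-injective eq)
  ... | i , refl | us , us≡ = i ∷ us , cong₂ _∷_ (sym (terminated-same t (name-terminated (toℕ i)) x≈y)) us≡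

  typed-gate : ∀ {n R} g {vs} → Known n R → LegalGate g →
               arguments g R ≡ just vs → ∃ λ (h : Gate B k n) → raw h ≡ g
  typed-gate {R = R} (_ , xs) known (label (fn f) , l , ts) eq =
    let (us , us≡) = indices xs known ts (sources-Pointwise xs R eq) _ l in (fn f , us) , cong (fn f ,_) us≡
  typed-gate {R = R} (_ , xs) known (label (□ i) , l , ts) eq =
    let (us , us≡) = indices xs known ts (sources-Pointwise xs R eq) 1 l in (□ i , us) , cong (□ i ,_) us≡
  typed-gate {R = R} (_ , xs) known (label (◇ i) , l , ts) eq =
    let (us , us≡) = indices xs known ts (sources-Pointwise xs R eq) 1 l in (◇ i , us) , cong (◇ i ,_) us≡
  typed-gate (_ , x ∷ []) known (label (var _) , l , t ∷ []) eq =
    let (n , x≡) = terminated-name t in (var n , []) , cong (λ x → var , x ∷ []) (sym x≡)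

  typed-gates : ∀ {n} gs → All (λ g → ∃ λ (h : Gate B k n) → raw h ≡ g) gs → ∀ m → length gs ≡ m →
                ∃ λ (hs : Vec (Gate B k n) m) → List.map raw (toList hs) ≡ gs
  typed-gates []       []             zero    refl = [] , refl
  typed-gates (g ∷ gs) ((h , h≡) ∷ p) (suc m) eq with typed-gates gs p m (suc-injective eq)
  ... | hs , hs≡ = h ∷ hs , cong₂ _∷_ h≡ hs≡

  resolved-All : ∀ R t → resolved R t ≡ true →
                 All (λ e → isJust (find (proj₁ e) R) ≡ true × isJust (arguments (proj₂ e) R) ≡ true) t
  resolved-All R []      eq = []
  resolved-All R (e ∷ t) eq with isJust (find (proj₁ e) R) in p | isJust (arguments (proj₂ e) R) in q
  ... | true | true = (p , q) ∷ resolved-All R t eq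

  entries-gate : ∀ m gs {g} → g ∈ gs → ∃ λ x → (x , g) ∈ entries m gs
  entries-gate m (g ∷ gs) (here refl) = name m , here refl
  entries-gate m (g ∷ gs) (there g∈)  = let (x , x∈) = entries-gate (suc m) gs g∈ in x , there x∈

  verdict-true : ∀ o R t → verdict o R t ≡ true →
                 resolved R t ≡ true × ∃ λ v → find o R ≡ just v × isZero v ≡ false
  verdict-true o R t eq with resolved R t | find o R
  ... | true | just v = refl , v , refl , Bool.not-injective eq

  verdict-zero : ∀ o R t → verdict o R t ≡ false → resolved R t ≡ true → ∀ {v} → find o R ≡ just v → isZero v ≡ true
  verdict-zero o R t eq r {v} f rewrite r | f = Bool.not-injective eq

  decideGates-sound : ∀ o gs → Terminated o → All LegalGate gs → decideGates o gs ≡ true →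
    ∃ λ (C : Circuit B k) → encode C ≡ unparse (o ∷ [] , gs) × Satisfiable 𝓕 (unfold C)
  decideGates-sound o gs t legal eq with verdict-true o (Final gs) (number gs) eq
  ... | r , v , f , z with typed-gates gs
        (All.tabulate λ {g} g∈ → typed-gate g (final-known gs) (All.lookup legal g∈)
          (proj₂ (isJust-just _ (proj₂ (All.lookup (resolved-All (Final gs) (number gs) r)
            (subst ((proj₁ (entries-gate 0 gs g∈) , g) ∈_) (sym (number-entries gs))
              (reverse⁺ (proj₂ (entries-gate 0 gs g∈))))))))) (length gs) refl
  ... | hs , hs≡ = go (length gs) hs hs≡ output
    where
    output : ∃ λ (i : Fin (length gs)) → o ≡ name (toℕ i)
    output = let (y , y∈ , o≈y) = find-∈ o (Final gs) f
                 (i , y≡) = All.lookup (final-known gs) y∈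
             in i , trans (terminated-same t (subst Terminated (sym y≡) (name-terminated (toℕ i))) o≈y) y≡
    -- The number of gates is generalised so that `gs`, on which it depends, can be replaced by the
    -- image of `hs`.
    go : ∀ n (hs : Vec (Gate B k n) n) → List.map raw (toList hs) ≡ gs → (∃ λ (i : Fin n) → o ≡ name (toℕ i)) →
         ∃ λ (C : Circuit B k) → encode C ≡ unparse (o ∷ [] , gs) × Satisfiable 𝓕 (unfold C)
    go n hs refl (i , refl) = circuit hs wf i ,
      cong₂ _++_ (sym (trans (++-identityʳ (unparseName (name (toℕ i)))) (unparseName-name (toℕ i)))) (sym (unparse-gates (toList hs))) ,
      accept hs i (edge-wellFounded (circuit hs wf i) i) f z
      where
      all : ∀ j → Resolved hs (final-state hs) j ≡ true
      all j = proj₁ (All.lookup (resolved-All (Final gs) (number gs) r)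
        (subst ((name (toℕ j) , raw (lookup hs j)) ∈_) (sym (number-entries gs)) (reverse⁺ (entry-∈ hs j))))
      wf : WellFounded (Edge hs)
      wf = well-founded hs all

  decideString-sound : ∀ s → decideString s ≡ true → CSAT 𝓕 k B s
  decideString-sound s eq with parse s in parsed
  ... | just (o ∷ [] , gs) with parse-sound s parsed
  ... | unparsed , (t ∷ []) , legal with decideGates-sound o gs t legal eq
  ... | C , encoded , sat = C , trans encoded unparsed , sat

  decideString-complete : ∀ s → decideString s ≡ false → ¬ CSAT 𝓕 k B s
  decideString-complete _ eq (C , refl , sat)
    rewrite parse-circuit (Circuit.output C) (toList (Circuit.gates C)) =
    reject gates output (edge-wellFounded C output) (proj₂ found-output)
      (verdict-zero (name (toℕ output)) (Final rawGates) (number rawGates) eq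
        (resolved-complete gates wf) (proj₂ found-output)) sat
    where
    open Circuit C
    rawGates : List RawGate
    rawGates = List.map raw (toList gates)
    wf : WellFounded (Edge gates)
    wf = edge-wellFounded C
    found-output : ∃ λ v → find (name (toℕ output)) (Final rawGates) ≡ just v
    found-output = isJust-just _ (all-resolved gates wf output)

  decideString-reflects : ∀ s → Reflects (CSAT 𝓕 k B s) (decideString s)
  decideString-reflects s = go (decideString s) refl
    where
    go : ∀ b → decideString s ≡ b → Reflects (CSAT 𝓕 k B s) b
    go true  eq = ofʸ (decideString-sound s eq)
    go false eq = ofⁿ (decideString-complete s eq)

theorem3p19 : (B : Basis) → All L B → (𝓕 : FrameClass) → (k : ℕ) → k ≥ 1 → P (CSAT 𝓕 k B)
theorem3p19 B linear 𝓕 k _ =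
  let (M , c , d , halts) = Decision.decider-correct B linear 𝓕 k in
  M , c , d , λ s → _ , halts s , Decision.decideString-reflects B linear 𝓕 k s
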